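{- Let $m,n\ge1$, let $\phi:[0,+\infty)\to(0,1]$ be non-increasing and let $\boldsymbol L\in\mathbb R^{m\times n}$ be $\phi$-multiplicatively badly approximable. Then for all $\boldsymbol T\in[1,+\infty)^n$ with $\bar T:=(T_1\cdots T_n)^{1/n}\ge 2$, $$\sum_{\substack{\boldsymbol q\in\mathbb Z^n\setminus\{\boldsymbol0\}\\0\le q_i\le T_i}}\frac{1}{\|L_1\boldsymbol q\|\cdots\|L_m\boldsymbol q\|}\ \ll_{m,n}\ \bar T^{\,n}\Big(\log\frac{\bar T}{\phi(\bar T)}\Big)^{m}+\frac{\bar T^{\,n}}{\phi(\bar T)}\Big(\log\frac{\bar T}{\phi(\bar T)}\Big)^{m-1}.$$
   Context: For $x\in\mathbb R$, $\|x\|$ is the distance from $x$ to the nearest integer and $x^+:=\max\{1,x\}$. The rows of $\boldsymbol L$ are $L_1,\dots,L_m$, and $L_i\boldsymbol q=\sum_j L_{ij}q_j$. $\boldsymbol L$ is $\phi$-multiplicatively badly approximable if $q_1^+\cdots q_n^+\prod_{i=1}^m\|L_i\boldsymbol q\|\ge\phi((q_1^+\cdots q_n^+)^{1/n})$ for all $\boldsymbol q\in\mathbb Z^n\setminus\{\boldsymbol0\}$ (in particular every $\|L_i\boldsymbol q\|$ is nonzero for such $\boldsymbol q$). -}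

module Defs where

import Algebra.Definitions.RawSemiring as RawSemiringOps
open import Algebra.Bundles.Raw using (RawSemiring)
open import Data.Fin.Base using (Fin; zero; suc)
open import Data.Integer.Base as ℤ using (ℤ; +_; -[1+_])
import Data.Integer.DivMod as ℤ
import Data.Integer.Properties as ℤ
open import Data.Integer.Solver using () renaming (module +-*-Solver to ℤ-Solver)
open import Data.List.Base as List using (List)
open import Data.List.Membership.Propositional using (_∈_)
open import Data.List.Relation.Unary.All using (All)
open import Data.List.Relation.Unary.Unique.Propositional using (Unique)
open import Data.Bool.Base using (true; false; if_then_else_)
open import Data.Nat.Base as ℕ using (ℕ; zero; suc)
import Data.Nat.Coprimality as Coprimality
import Data.Nat.Properties as ℕ
open import Data.Product.Base using (Σ; ∃-syntax; _×_; _,_; proj₁; proj₂)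
open import Data.Rational.Base as ℚ using (ℚ; 0ℚ; 1ℚ; ½; mkℚ; *≤*; *<*; round; floor; ceiling)
import Data.Rational.Properties as ℚ
open import Data.Rational.Solver using (module +-*-Solver)
open import Data.Sum.Base using (_⊎_; inj₁; inj₂)
open import Data.Vec.Base as Vec using (Vec)
open import Level using (0ℓ)
open import Relation.Binary.Definitions using (tri<; tri≈; tri>)
open import Relation.Binary.PropositionalEquality
open import Relation.Nullary using (¬_; Dec; yes; no; does; contradiction)

private
  module ℚ^ = RawSemiringOps ℚ.+-*-rawSemiring

module Rational where
  open import Data.Rational.Base using (_+_; _*_; _-_; -_; _≤_; _<_; ∣_∣; _⊔_)
  open ℚ^ using (_^_)
  open +-*-Solver using (solve; _:=_; _:+_; _:*_; _:-_; :-_; con)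

  sub-nonneg : ∀ {p q} → p ≤ q → 0ℚ ≤ q - p
  sub-nonneg {p} {q} h = subst (_≤ q - p) (ℚ.+-inverseʳ p) (ℚ.+-monoˡ-≤ (- p) h)

  ≤-by : ∀ {p q} d → 0ℚ ≤ d → q ≡ p + d → p ≤ q
  ≤-by {p} d h refl = subst (_≤ p + d) (ℚ.+-identityʳ p) (ℚ.+-monoʳ-≤ p h)

  +-nonneg : ∀ {p q} → 0ℚ ≤ p → 0ℚ ≤ q → 0ℚ ≤ p + q
  +-nonneg = ℚ.+-mono-≤

  *-monoˡ : ∀ {p q} r → 0ℚ ≤ r → p ≤ q → r * p ≤ r * q
  *-monoˡ r h = ℚ.*-monoˡ-≤-nonNeg r {{ℚ.nonNegative h}}

  *-monoʳ : ∀ {p q} r → 0ℚ ≤ r → p ≤ q → p * r ≤ q * r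
  *-monoʳ r h = ℚ.*-monoʳ-≤-nonNeg r {{ℚ.nonNegative h}}

  *-mono : ∀ {p q r s} → 0ℚ ≤ p → 0ℚ ≤ s → p ≤ q → r ≤ s → p * r ≤ q * s
  *-mono {p} {s = s} hp hs pq rs = ℚ.≤-trans (*-monoˡ p hp rs) (*-monoʳ s hs pq)

  *-nonneg : ∀ {p q} → 0ℚ ≤ p → 0ℚ ≤ q → 0ℚ ≤ p * q
  *-nonneg {p} {q} hp hq = subst (_≤ p * q) (ℚ.*-zeroʳ p) (*-monoˡ p hp hq)

  *-pos : ∀ {p q} → 0ℚ < p → 0ℚ < q → 0ℚ < p * q
  *-pos {p} {q} hp hq =
    subst (_< p * q) (ℚ.*-zeroʳ p) (ℚ.*-monoʳ-<-pos p {{ℚ.positive hp}} hq)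

  0≤1 : 0ℚ ≤ 1ℚ
  0≤1 = ℚ.nonNegative⁻¹ 1ℚ

  0<1 : 0ℚ < 1ℚ
  0<1 = ℚ.positive⁻¹ 1ℚ

  0≤½ : 0ℚ ≤ ½
  0≤½ = ℚ.nonNegative⁻¹ ½

  half-pos : ∀ {ε} → 0ℚ < ε → 0ℚ < ½ * ε
  half-pos = *-pos (ℚ.positive⁻¹ ½)

  halves : ∀ ε → ½ * ε + ½ * ε ≡ ε
  halves = solve 1 (λ e → con ½ :* e :+ con ½ :* e := e) refl

  p≤∣p∣ : ∀ p → p ≤ ∣ p ∣
  p≤∣p∣ p with ℚ.≤-total 0ℚ p
  ... | inj₁ h = ℚ.≤-reflexive (sym (ℚ.0≤p⇒∣p∣≡p h))
  ... | inj₂ h = ℚ.≤-trans h (ℚ.0≤∣p∣ p)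

  ∣-∣≤ : ∀ p q {e} → p ≤ q + e → q ≤ p + e → ∣ p - q ∣ ≤ e
  ∣-∣≤ p q {e} h k with ℚ.∣p∣≡p∨∣p∣≡-p (p - q)
  ... | inj₁ eq = subst (_≤ e) (sym eq) (≤-by (q + e - p) (sub-nonneg h)
        (solve 3 (λ p q e → e := (p :- q) :+ (q :+ e :- p)) refl p q e))
  ... | inj₂ eq = subst (_≤ e) (sym eq) (≤-by (p + e - q) (sub-nonneg k)
        (solve 3 (λ p q e → e := (:- (p :- q)) :+ (p :+ e :- q)) refl p q e))

  ≤-∣-∣ : ∀ p q {e} → ∣ p - q ∣ ≤ e → p ≤ q + e
  ≤-∣-∣ p q {e} h = ≤-by (e - (p - q)) (sub-nonneg (ℚ.≤-trans (p≤∣p∣ (p - q)) h))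
    (solve 3 (λ p q e → q :+ e := p :+ (e :- (p :- q))) refl p q e)

  ∣-∣-sym : ∀ p q → ∣ p - q ∣ ≡ ∣ q - p ∣
  ∣-∣-sym p q = trans (cong ∣_∣ (solve 2 (λ p q → p :- q := :- (q :- p)) refl p q))
                      (ℚ.∣-p∣≡∣p∣ (q - p))

  ∣-∣-tri : ∀ p q r → ∣ p - r ∣ ≤ ∣ p - q ∣ + ∣ q - r ∣
  ∣-∣-tri p q r = subst (λ s → ∣ s ∣ ≤ ∣ p - q ∣ + ∣ q - r ∣)
    (solve 3 (λ p q r → (p :- q) :+ (q :- r) := p :- r) refl p q r)
    (ℚ.∣p+q∣≤∣p∣+∣q∣ (p - q) (q - r))

  ∣-∣-+ : ∀ p q r s → ∣ (p + q) - (r + s) ∣ ≤ ∣ p - r ∣ + ∣ q - s ∣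
  ∣-∣-+ p q r s = subst (λ t → ∣ t ∣ ≤ ∣ p - r ∣ + ∣ q - s ∣)
    (solve 4 (λ p q r s → (p :- r) :+ (q :- s) := (p :+ q) :- (r :+ s)) refl p q r s)
    (ℚ.∣p+q∣≤∣p∣+∣q∣ (p - r) (q - s))

  ∣-∣-* : ∀ p q r s → ∣ p * q - r * s ∣ ≤ ∣ p ∣ * ∣ q - s ∣ + ∣ s ∣ * ∣ p - r ∣
  ∣-∣-* p q r s = subst₂ _≤_
    (cong ∣_∣ (solve 4 (λ p q r s → p :* (q :- s) :+ s :* (p :- r) := p :* q :- r :* s)
                 refl p q r s))
    (cong₂ _+_ (ℚ.∣p*q∣≡∣p∣*∣q∣ p (q - s)) (ℚ.∣p*q∣≡∣p∣*∣q∣ s (p - r)))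
    (ℚ.∣p+q∣≤∣p∣+∣q∣ (p * (q - s)) (s * (p - r)))

  -- totalised by recip 0 = 0
  recip : ℚ → ℚ
  recip p with p ℚ.≟ 0ℚ
  ... | yes _  = 0ℚ
  ... | no p≢0 = ℚ.1/_ p {{ℚ.≢-nonZero p≢0}}

  recip-inverse : ∀ {p} → 0ℚ < p → p * recip p ≡ 1ℚ
  recip-inverse {p} h with p ℚ.≟ 0ℚ
  ... | yes p≡0 = contradiction (sym p≡0) (ℚ.<⇒≢ h)
  ... | no p≢0  = ℚ.*-inverseʳ p {{ℚ.≢-nonZero p≢0}}

  recip-pos : ∀ {p} → 0ℚ < p → 0ℚ < recip p
  recip-pos {p} h with p ℚ.≟ 0ℚ
  ... | yes p≡0 = contradiction (sym p≡0) (ℚ.<⇒≢ h)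
  ... | no p≢0  = ℚ.positive⁻¹ _ {{ℚ.1/pos⇒pos p {{ℚ.positive h}}}}

  recip-scale : ∀ {K} → 0ℚ < K → ∀ ε → K * (recip K * ε) ≡ ε
  recip-scale {K} h ε = begin
    K * (recip K * ε) ≡⟨ ℚ.*-assoc K (recip K) ε ⟨
    K * recip K * ε   ≡⟨ cong (_* ε) (recip-inverse h) ⟩
    1ℚ * ε            ≡⟨ ℚ.*-identityˡ ε ⟩
    ε                 ∎
    where open ≡-Reasoning

  recip-antitone : ∀ {p q} → 0ℚ < p → p ≤ q → recip q ≤ recip p
  recip-antitone {p} {q} hp pq = subst₂ _≤_ eq₁ eq₂
    (*-monoˡ (recip p * recip q) (*-nonneg (ℚ.<⇒≤ (recip-pos hp)) (ℚ.<⇒≤ (recip-pos hq))) pq)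
    where
    hq = ℚ.<-≤-trans hp pq
    eq₁ : recip p * recip q * p ≡ recip q
    eq₁ = trans (solve 3 (λ a b p → a :* b :* p := p :* a :* b) refl (recip p) (recip q) p)
                (trans (cong (_* recip q) (recip-inverse hp)) (ℚ.*-identityˡ (recip q)))
    eq₂ : recip p * recip q * q ≡ recip p
    eq₂ = trans (solve 3 (λ a b q → a :* b :* q := q :* b :* a) refl (recip p) (recip q) q)
                (trans (cong (_* recip p) (recip-inverse hq)) (ℚ.*-identityˡ (recip p)))

  ∣-∣-recip : ∀ {δ p q} → 0ℚ < δ → δ ≤ p → δ ≤ q →
              ∣ recip p - recip q ∣ ≤ recip δ * recip δ * ∣ p - q ∣
  ∣-∣-recip {δ} {p} {q} hδ hp hq = subst (_≤ recip δ * recip δ * ∣ p - q ∣)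
    (trans (cong (_* ∣ p - q ∣) (sym (ℚ.0≤p⇒∣p∣≡p ab≥0)))
    (trans (sym (ℚ.∣p*q∣≡∣p∣*∣q∣ (a * b) (p - q)))
    (trans (cong ∣_∣ eq) (∣-∣-sym b a))))
    (*-monoʳ ∣ p - q ∣ (ℚ.0≤∣p∣ (p - q))
      (*-mono a≥0 (ℚ.<⇒≤ (recip-pos hδ)) (recip-antitone hδ hp) (recip-antitone hδ hq)))
    where
    a = recip p
    b = recip q
    p>0 = ℚ.<-≤-trans hδ hp
    q>0 = ℚ.<-≤-trans hδ hq
    a≥0 = ℚ.<⇒≤ (recip-pos p>0)
    b≥0 = ℚ.<⇒≤ (recip-pos q>0)
    ab≥0 : 0ℚ ≤ a * b
    ab≥0 = *-nonneg a≥0 b≥0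
    eq : a * b * (p - q) ≡ b - a
    eq = begin
      a * b * (p - q)             ≡⟨ solve 4 (λ a b p q → a :* b :* (p :- q) := p :* a :* b :- q :* b :* a) refl a b p q ⟩
      p * a * b - q * b * a       ≡⟨ cong₂ (λ s t → s * b - t * a) (recip-inverse p>0) (recip-inverse q>0) ⟩
      1ℚ * b - 1ℚ * a             ≡⟨ cong₂ _-_ (ℚ.*-identityˡ b) (ℚ.*-identityˡ a) ⟩
      b - a                       ∎
      where open ≡-Reasoning

  fromℤ : ℤ → ℚ
  fromℤ z = z ℚ./ 1

  fromℤ-mkℚ : ∀ z → fromℤ z ≡ mkℚ z 0 (Coprimality.sym (Coprimality.1-coprimeTo ℤ.∣ z ∣))
  fromℤ-mkℚ z = ℚ.↥p/↧p≡p (mkℚ z 0 _)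

  fromℤ-mono : ∀ {y z} → y ℤ.≤ z → fromℤ y ≤ fromℤ z
  fromℤ-mono {y} {z} h = subst₂ _≤_ (sym (fromℤ-mkℚ y)) (sym (fromℤ-mkℚ z))
    (*≤* (subst₂ ℤ._≤_ (sym (ℤ.*-identityʳ y)) (sym (ℤ.*-identityʳ z)) h))

  fromℤ-suc : ∀ z → fromℤ (ℤ.suc z) ≡ fromℤ z + 1ℚ
  fromℤ-suc z = begin
    fromℤ (ℤ.suc z)                ≡⟨ cong fromℤ eq ⟩
    fromℤ (z ℤ.* (+ 1) ℤ.+ (+ 1))  ≡⟨⟩
    mkℚ z 0 c + 1ℚ                 ≡⟨ cong (_+ 1ℚ) (fromℤ-mkℚ z) ⟨
    fromℤ z + 1ℚ                   ∎
    where
    open ≡-Reasoning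
    c = Coprimality.sym (Coprimality.1-coprimeTo ℤ.∣ z ∣)
    eq : ℤ.suc z ≡ z ℤ.* (+ 1) ℤ.+ (+ 1)
    eq = trans (ℤ.+-comm (+ 1) z) (cong (ℤ._+ (+ 1)) (sym (ℤ.*-identityʳ z)))

  fromℤ-< : ∀ {y z} → y ℤ.< z → fromℤ y + 1ℚ ≤ fromℤ z
  fromℤ-< {y} {z} h = subst (_≤ fromℤ z) (fromℤ-suc y) (fromℤ-mono (ℤ.i<j⇒suc[i]≤j h))

  floor≤ : ∀ p → fromℤ (floor p) ≤ p
  floor≤ p@(mkℚ n d-1 _) = subst (_≤ p) (sym (fromℤ-mkℚ (floor p)))
    (*≤* (subst (floor p ℤ.* (+ suc d-1) ℤ.≤_) (sym (ℤ.*-identityʳ n))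
      (ℤ.[n/d]*d≤n n (+ suc d-1))))

  <floor+1 : ∀ p → p < fromℤ (floor p) + 1ℚ
  <floor+1 p@(mkℚ n d-1 _) = subst (p <_)
    (trans (sym (fromℤ-mkℚ (ℤ.suc (floor p)))) (fromℤ-suc (floor p)))
    (*<* (subst₂ ℤ._<_ (sym (ℤ.*-identityʳ n))
      (cong (λ z → ℤ.suc z ℤ.* (+ suc d-1)) (sym (ℤ.div-pos-is-/ℕ n (suc d-1))))
      (ℤ.n<s[n/ℕd]*d n (suc d-1))))

  fromℤ-neg : ∀ z → fromℤ (ℤ.- z) ≡ - fromℤ z
  fromℤ-neg (+ zero)  = refl
  fromℤ-neg (+ suc n) = refl
  fromℤ-neg -[1+ n ]  = sym (neg-neg (fromℤ (+ suc n)))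
    where
    neg-neg : ∀ p → - (- p) ≡ p
    neg-neg = solve 1 (λ p → :- (:- p) := p) refl

  ceiling-floor : ∀ p → ceiling p ≡ ℤ.- floor (- p)
  ceiling-floor (mkℚ _ _ _) = refl

  ∥_∥ : ℚ → ℚ
  ∥ p ∥ = ∣ p - fromℤ (round p) ∣

  ∥∥≤½ : ∀ p → ∥ p ∥ ≤ ½
  ∥∥≤½ p with p ℚ.≤ᵇ 0ℚ
  ... | false = ∣-∣≤ p f
      (≤-by (f + 1ℚ - (p + ½)) (sub-nonneg (ℚ.<⇒≤ (<floor+1 (p + ½))))
        (solve 2 (λ p f → f :+ con ½ := p :+ (f :+ con 1ℚ :- (p :+ con ½))) refl p f))
      (floor≤ (p + ½))
    where f = fromℤ (floor (p + ½))
  ... | true  = subst (λ c → ∣ p - c ∣ ≤ ½) (sym (trans (cong fromℤ (ceiling-floor (p - ½)))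
                                             (fromℤ-neg (floor (- (p - ½))))))
      (∣-∣≤ p (- f)
        (≤-by (- (p - ½) - f) (sub-nonneg (floor≤ (- (p - ½))))
          (solve 2 (λ p f → (:- f) :+ con ½ := p :+ (:- (p :- con ½) :- f)) refl p f))
        (≤-by (f + 1ℚ - (- (p - ½))) (sub-nonneg (ℚ.<⇒≤ (<floor+1 (- (p - ½)))))
          (solve 2 (λ p f → p :+ con ½ := (:- f) :+ (f :+ con 1ℚ :- (:- (p :- con ½)))) refl p f)))
    where f = fromℤ (floor (- (p - ½)))

  ∥∥-minimal : ∀ p z → ∥ p ∥ ≤ ∣ p - fromℤ z ∣
  ∥∥-minimal p z with ℤ.<-cmp z (round p)
  ... | tri≈ _ refl _ = ℚ.≤-refl
  ... | tri< z<r _ _ = ℚ.≤-trans (∥∥≤½ p) (ℚ.≤-trans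
      (≤-by ((p + ½ - r) + (r - (k + 1ℚ)))
        (+-nonneg (sub-nonneg (≤-∣-∣ r p (subst (_≤ ½) (∣-∣-sym p r) (∥∥≤½ p))))
                  (sub-nonneg (fromℤ-< z<r)))
        (solve 3 (λ p r k → p :- k := con ½ :+ ((p :+ con ½ :- r) :+ (r :- (k :+ con 1ℚ))))
          refl p r k))
      (p≤∣p∣ (p - k)))
    where
    r = fromℤ (round p)
    k = fromℤ z
  ... | tri> _ _ r<z = ℚ.≤-trans (∥∥≤½ p) (subst (½ ≤_) (∣-∣-sym k p) (ℚ.≤-trans
      (≤-by ((r + ½ - p) + (k - (r + 1ℚ)))
        (+-nonneg (sub-nonneg (≤-∣-∣ p r (∥∥≤½ p))) (sub-nonneg (fromℤ-< r<z)))
        (solve 3 (λ p r k → k :- p := con ½ :+ ((r :+ con ½ :- p) :+ (k :- (r :+ con 1ℚ))))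
          refl p r k))
      (p≤∣p∣ (k - p))))
    where
    r = fromℤ (round p)
    k = fromℤ z

  ∣-∣-∥∥ : ∀ p q → ∣ ∥ p ∥ - ∥ q ∥ ∣ ≤ ∣ p - q ∣
  ∣-∣-∥∥ p q = ∣-∣≤ ∥ p ∥ ∥ q ∥ (half p q) (subst (λ d → ∥ q ∥ ≤ ∥ p ∥ + d) (∣-∣-sym q p) (half q p))
    where
    half : ∀ p q → ∥ p ∥ ≤ ∥ q ∥ + ∣ p - q ∣
    half p q = ℚ.≤-trans (∥∥-minimal p (round q))
      (subst (∣ p - fromℤ (round q) ∣ ≤_) (ℚ.+-comm ∣ p - q ∣ ∥ q ∥)
        (∣-∣-tri p q (fromℤ (round q))))

  ^-nonneg : ∀ {p} n → 0ℚ ≤ p → 0ℚ ≤ p ^ n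
  ^-nonneg zero    h = 0≤1
  ^-nonneg (suc n) h = *-nonneg h (^-nonneg n h)

  ^-pos : ∀ {p} n → 0ℚ < p → 0ℚ < p ^ n
  ^-pos zero    h = 0<1
  ^-pos (suc n) h = *-pos h (^-pos n h)

  ^-mono : ∀ {p q} n → 0ℚ ≤ p → p ≤ q → p ^ n ≤ q ^ n
  ^-mono zero    h pq = ℚ.≤-refl
  ^-mono (suc n) h pq = *-mono h (^-nonneg n (ℚ.≤-trans h pq)) pq (^-mono n h pq)

  1≤^ : ∀ {p} n → 1ℚ ≤ p → 1ℚ ≤ p ^ n
  1≤^ zero    h = ℚ.≤-refl
  1≤^ {p} (suc n) h = subst (_≤ p * p ^ n) (ℚ.*-identityˡ 1ℚ)
    (*-mono 0≤1 (^-nonneg n (ℚ.≤-trans 0≤1 h)) h (1≤^ n h))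

  ≤^suc : ∀ {p} n → 1ℚ ≤ p → p ≤ p ^ suc n
  ≤^suc {p} n h = subst (_≤ p ^ suc n) (ℚ.*-identityʳ p) (*-monoˡ p (ℚ.≤-trans 0≤1 h) (1≤^ n h))

  ^-cancel-< : ∀ {p q} n → 0ℚ ≤ q → p ^ n < q ^ n → p < q
  ^-cancel-< {p} {q} n h lt with p ℚ.<? q
  ... | yes p<q = p<q
  ... | no  p≮q = contradiction (ℚ.<-≤-trans lt (^-mono n h (ℚ.≮⇒≥ p≮q))) (ℚ.<-irrefl refl)

  ^-superadditive : ∀ {p q} n → 0ℚ ≤ p → 0ℚ ≤ q → p ^ suc n + q ^ suc n ≤ (p + q) ^ suc n
  ^-superadditive {p} {q} zero hp hq =
    ℚ.≤-reflexive (solve 2 (λ p q → p :* con 1ℚ :+ q :* con 1ℚ := (p :+ q) :* con 1ℚ) refl p q)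
  ^-superadditive {p} {q} (suc n) hp hq = ℚ.≤-trans
    (≤-by (p * q ^ suc n + q * p ^ suc n)
      (+-nonneg (*-nonneg hp (^-nonneg (suc n) hq)) (*-nonneg hq (^-nonneg (suc n) hp)))
      (solve 4 (λ p q a b → (p :+ q) :* (a :+ b) := p :* a :+ q :* b :+ (p :* b :+ q :* a))
        refl p q (p ^ suc n) (q ^ suc n)))
    (*-monoˡ (p + q) (+-nonneg hp hq) (^-superadditive n hp hq))

  1/suc : ℕ → ℚ
  1/suc k = + 1 ℚ./ suc k

  1/suc-mkℚ : ∀ k → 1/suc k ≡ mkℚ (+ 1) k (Coprimality.1-coprimeTo (suc k))
  1/suc-mkℚ k = ℚ.↥p/↧p≡p (mkℚ (+ 1) k _)

  1/suc-pos : ∀ k → 0ℚ < 1/suc k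
  1/suc-pos k = subst (0ℚ <_) (sym (1/suc-mkℚ k)) (ℚ.positive⁻¹ _)

  1/suc-nonneg : ∀ k → 0ℚ ≤ 1/suc k
  1/suc-nonneg k = ℚ.<⇒≤ (1/suc-pos k)

  1/suc-antitone : ∀ {k l} → k ℕ.≤ l → 1/suc l ≤ 1/suc k
  1/suc-antitone {k} {l} h = subst₂ _≤_ (sym (1/suc-mkℚ l)) (sym (1/suc-mkℚ k))
    (*≤* (subst₂ ℤ._≤_ (sym (ℤ.*-identityˡ (+ suc k))) (sym (ℤ.*-identityˡ (+ suc l)))
      (ℤ.+≤+ (ℕ.s≤s h))))

  1/suc-inverse : ∀ k → fromℤ (+ suc k) * 1/suc k ≡ 1ℚ
  1/suc-inverse k = trans (cong₂ _*_ (fromℤ-mkℚ (+ suc k)) (1/suc-mkℚ k))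
    (ℚ.*-inverseʳ (mkℚ (+ suc k) 0 (Coprimality.sym (Coprimality.1-coprimeTo (suc k)))))

  1/suc-≤ : ∀ ε → 0ℚ < ε → ∃[ N ] 1/suc N ≤ ε
  1/suc-≤ ε@(mkℚ (+ zero)  d-1 _) h = contradiction h (λ { (*<* (ℤ.+<+ ())) })
  1/suc-≤ ε@(mkℚ (+ suc p) d-1 _) h = d-1 , subst (_≤ ε) (sym (1/suc-mkℚ d-1))
    (*≤* (ℤ.*-monoʳ-≤-nonNeg (+ suc d-1) (ℤ.+≤+ (ℕ.s≤s (ℕ.z≤n {p})))))
  1/suc-≤ ε@(mkℚ -[1+ p ]  d-1 _) h = contradiction h (λ { (*<* ()) })

  Small : (ℕ → ℕ → ℚ) → Set
  Small e = ∀ ε → 0ℚ < ε → ∃[ N ] (∀ k l → N ℕ.≤ k → N ℕ.≤ l → e k l ≤ ε)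

  Cauchy : (ℕ → ℚ) → Set
  Cauchy s = ∀ ε → 0ℚ < ε → ∃[ N ] (∀ k l → N ℕ.≤ k → N ℕ.≤ l → ∣ s k - s l ∣ ≤ ε)

  Small-const : Small (λ _ _ → 0ℚ)
  Small-const ε h = 0 , λ _ _ _ _ → ℚ.<⇒≤ h

  Small-+ : ∀ {d e} → Small d → Small e → Small (λ k l → d k l + e k l)
  Small-+ {d} {e} hd he ε h with hd (½ * ε) (half-pos h) | he (½ * ε) (half-pos h)
  ... | M , p | N , q = M ℕ.⊔ N , λ k l hk hl →
    subst (d k l + e k l ≤_) (halves ε) (ℚ.+-mono-≤
      (p k l (ℕ.m⊔n≤o⇒m≤o M N hk) (ℕ.m⊔n≤o⇒m≤o M N hl))
      (q k l (ℕ.m⊔n≤o⇒n≤o M N hk) (ℕ.m⊔n≤o⇒n≤o M N hl)))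

  Small-* : ∀ {e} K → 0ℚ < K → Small e → Small (λ k l → K * e k l)
  Small-* {e} K hK he ε h with he (recip K * ε) (*-pos (recip-pos hK) h)
  ... | N , p = N , λ k l hk hl →
    subst (K * e k l ≤_) (recip-scale hK ε) (*-monoˡ K (ℚ.<⇒≤ hK) (p k l hk hl))

  Small-≤ : ∀ {d e} N → (∀ k l → N ℕ.≤ k → N ℕ.≤ l → d k l ≤ e k l) → Small e → Small d
  Small-≤ N le he ε h with he ε h
  ... | M , p = M ℕ.⊔ N , λ k l hk hl → ℚ.≤-trans
    (le k l (ℕ.m⊔n≤o⇒n≤o M N hk) (ℕ.m⊔n≤o⇒n≤o M N hl))
    (p k l (ℕ.m⊔n≤o⇒m≤o M N hk) (ℕ.m⊔n≤o⇒m≤o M N hl))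

  Small-1/suc : Small (λ k l → 1/suc k + 1/suc l)
  Small-1/suc = Small-+ left right
    where
    left : Small (λ k _ → 1/suc k)
    left ε h with 1/suc-≤ ε h
    ... | N , p = N , λ k l hk hl → ℚ.≤-trans (1/suc-antitone hk) p
    right : Small (λ _ l → 1/suc l)
    right ε h with 1/suc-≤ ε h
    ... | N , p = N , λ k l hk hl → ℚ.≤-trans (1/suc-antitone hl) p

  Cauchy-bounded : ∀ {s} → Cauchy s →
    ∃[ B ] ∃[ N ] (0ℚ < B × (∀ k → N ℕ.≤ k → ∣ s k ∣ ≤ B))
  Cauchy-bounded {s} hs with hs 1ℚ 0<1
  ... | N , p = ∣ s N ∣ + 1ℚ , N , ℚ.+-mono-≤-< (ℚ.0≤∣p∣ (s N)) 0<1 , λ k hk → ℚ.≤-trans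
    (subst (λ t → ∣ t ∣ ≤ ∣ s N ∣ + ∣ s k - s N ∣)
      (solve 2 (λ a b → a :+ (b :- a) := b) refl (s N) (s k))
      (ℚ.∣p+q∣≤∣p∣+∣q∣ (s N) (s k - s N)))
    (ℚ.+-monoʳ-≤ ∣ s N ∣ (p k N hk ℕ.≤-refl))

  Cauchy-const : ∀ p → Cauchy (λ _ → p)
  Cauchy-const p = Small-≤ {λ _ _ → ∣ p - p ∣} {λ _ _ → 0ℚ} 0
    (λ _ _ _ _ → ℚ.≤-reflexive (cong ∣_∣ (ℚ.+-inverseʳ p))) Small-const

  Cauchy-+ : ∀ {s t} → Cauchy s → Cauchy t → Cauchy (λ k → s k + t k)
  Cauchy-+ {s} {t} hs ht = Small-≤
    {λ k l → ∣ (s k + t k) - (s l + t l) ∣} {λ k l → ∣ s k - s l ∣ + ∣ t k - t l ∣} 0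
    (λ k l _ _ → ∣-∣-+ (s k) (t k) (s l) (t l))
    (Small-+ {λ k l → ∣ s k - s l ∣} {λ k l → ∣ t k - t l ∣} hs ht)

  Cauchy-* : ∀ {s t} → Cauchy s → Cauchy t → Cauchy (λ k → s k * t k)
  Cauchy-* {s} {t} hs ht = go (Cauchy-bounded {s} hs) (Cauchy-bounded {t} ht)
    where
    go : ∃[ A ] ∃[ M ] (0ℚ < A × (∀ k → M ℕ.≤ k → ∣ s k ∣ ≤ A)) →
         ∃[ B ] ∃[ N ] (0ℚ < B × (∀ k → N ℕ.≤ k → ∣ t k ∣ ≤ B)) →
         Cauchy (λ k → s k * t k)
    go (A , M , hA , a) (B , N , hB , b) = Small-≤
      {λ k l → ∣ s k * t k - s l * t l ∣} {λ k l → A * ∣ t k - t l ∣ + B * ∣ s k - s l ∣} (M ℕ.⊔ N)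
      (λ k l hk hl → ℚ.≤-trans (∣-∣-* (s k) (t k) (s l) (t l)) (ℚ.+-mono-≤
        (*-monoʳ ∣ t k - t l ∣ (ℚ.0≤∣p∣ (t k - t l)) (a k (ℕ.m⊔n≤o⇒m≤o M N hk)))
        (*-monoʳ ∣ s k - s l ∣ (ℚ.0≤∣p∣ (s k - s l)) (b l (ℕ.m⊔n≤o⇒n≤o M N hl)))))
      (Small-+ {λ k l → A * ∣ t k - t l ∣} {λ k l → B * ∣ s k - s l ∣}
        (Small-* {λ k l → ∣ t k - t l ∣} A hA ht) (Small-* {λ k l → ∣ s k - s l ∣} B hB hs))

  Cauchy-recip : ∀ {s} δ N → 0ℚ < δ → (∀ k → N ℕ.≤ k → δ ≤ s k) →
                 Cauchy s → Cauchy (λ k → recip (s k))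
  Cauchy-recip {s} δ N hδ le hs = Small-≤
    {λ k l → ∣ recip (s k) - recip (s l) ∣} {λ k l → recip δ * recip δ * ∣ s k - s l ∣} N
    (λ k l hk hl → ∣-∣-recip {δ} {s k} {s l} hδ (le k hk) (le l hl))
    (Small-* {λ k l → ∣ s k - s l ∣} (recip δ * recip δ)
      (*-pos {recip δ} {recip δ} (recip-pos hδ) (recip-pos hδ)) hs)

  Cauchy-∥∥ : ∀ {s} → Cauchy s → Cauchy (λ k → ∥ s k ∥)
  Cauchy-∥∥ {s} = Small-≤ {λ k l → ∣ ∥ s k ∥ - ∥ s l ∥ ∣} {λ k l → ∣ s k - s l ∣} 0
    (λ k l _ _ → ∣-∣-∥∥ (s k) (s l))

  ∣-∣-⊔ : ∀ c p q → ∣ (c ⊔ p) - (c ⊔ q) ∣ ≤ ∣ p - q ∣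
  ∣-∣-⊔ c p q = ∣-∣≤ (c ⊔ p) (c ⊔ q)
    (half p q) (subst (λ d → c ⊔ q ≤ (c ⊔ p) + d) (∣-∣-sym q p) (half q p))
    where
    half : ∀ p q → c ⊔ p ≤ (c ⊔ q) + ∣ p - q ∣
    half p q = ℚ.⊔-lub
      (ℚ.≤-trans (ℚ.p≤p⊔q c q) (≤-by ∣ p - q ∣ (ℚ.0≤∣p∣ (p - q)) refl))
      (ℚ.≤-trans (≤-∣-∣ p q ℚ.≤-refl) (ℚ.+-monoˡ-≤ ∣ p - q ∣ (ℚ.p≤q⊔p c q)))

  Cauchy-⊔ : ∀ {s} c → Cauchy s → Cauchy (λ k → c ⊔ s k)
  Cauchy-⊔ {s} c = Small-≤ {λ k l → ∣ (c ⊔ s k) - (c ⊔ s l) ∣} {λ k l → ∣ s k - s l ∣} 0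
    (λ k l _ _ → ∣-∣-⊔ c (s k) (s l))

  grid : ℕ → ℕ → ℚ
  grid k j = fromℤ (+ j) * 1/suc k

  grid-nonneg : ∀ k j → 0ℚ ≤ grid k j
  grid-nonneg k j = *-nonneg (fromℤ-mono {+ 0} {+ j} (ℤ.+≤+ ℕ.z≤n)) (1/suc-nonneg k)

  grid-suc : ∀ k j → grid k (suc j) ≡ grid k j + 1/suc k
  grid-suc k j = trans (cong (_* 1/suc k) (fromℤ-suc (+ j)))
    (trans (ℚ.*-distribʳ-+ (1/suc k) (fromℤ (+ j)) 1ℚ)
      (cong (λ r → grid k j + r) (ℚ.*-identityˡ (1/suc k))))

  -- the largest i ≤ b with (i / (k + 1)) ^ n ≤ x
  search : (n k : ℕ) → ℚ → (b : ℕ) → ℕ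
  search n k x zero = zero
  search n k x (suc b) = if does (grid k (suc b) ^ n ℚ.≤? x) then suc b else search n k x b

  if-elim : ∀ {P : Set} (Q : ℕ → Set) {i j} (P? : Dec P) →
            (P → Q i) → (¬ P → Q j) → Q (if does P? then i else j)
  if-elim Q (yes p) f g = f p
  if-elim Q (no ¬p) f g = g ¬p

  search-lower : ∀ n k {x} b → 0ℚ ≤ x → grid k (search (suc n) k x b) ^ suc n ≤ x
  search-lower n k {x} zero h = subst (_≤ x) (sym
    (trans (cong (_* grid k 0 ^ n) (ℚ.*-zeroˡ (1/suc k))) (ℚ.*-zeroˡ (grid k 0 ^ n)))) h
  search-lower n k {x} (suc b) h =
    if-elim (λ i → grid k i ^ suc n ≤ x) (grid k (suc b) ^ suc n ℚ.≤? x)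
      (λ le → le) (λ _ → search-lower n k b h)

  search-upper : ∀ n k {x} b → x < grid k (suc b) ^ n → x < grid k (suc (search n k x b)) ^ n
  search-upper n k zero h = h
  search-upper n k {x} (suc b) h =
    if-elim (λ i → x < grid k (suc i) ^ n) (grid k (suc b) ^ n ℚ.≤? x)
      (λ _ → h) (λ nle → search-upper n k b (ℚ.≰⇒> nle))

  searchBound : ℕ → ℚ → ℕ
  searchBound k x = suc ℤ.∣ ℚ.numerator x ∣ ℕ.* suc k

  searchBound-large : ∀ n k {x} → 0ℚ ≤ x → x < grid k (suc (searchBound k x)) ^ suc n
  searchBound-large n k {mkℚ -[1+ _ ] _ _} (*≤* ())
  searchBound-large n k {x@(mkℚ (+ a) d-1 _)} h = ℚ.<-≤-trans x<g (≤^suc n 1≤g)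
    where
    g = grid k (suc (searchBound k x))
    A = fromℤ (+ suc a)
    eq : g ≡ A + 1/suc k
    eq = trans (grid-suc k (searchBound k x)) (cong (_+ 1/suc k) (begin
      fromℤ (+ (suc a ℕ.* suc k)) * 1/suc k         ≡⟨ cong (_* 1/suc k) (hom (suc a) (suc k)) ⟩
      A * fromℤ (+ suc k) * 1/suc k                 ≡⟨ ℚ.*-assoc A (fromℤ (+ suc k)) (1/suc k) ⟩
      A * (fromℤ (+ suc k) * 1/suc k)               ≡⟨ cong (A *_) (1/suc-inverse k) ⟩
      A * 1ℚ                                        ≡⟨ ℚ.*-identityʳ A ⟩
      A                                             ∎))
      where
      open ≡-Reasoning
      hom : ∀ i j → fromℤ (+ (i ℕ.* j)) ≡ fromℤ (+ i) * fromℤ (+ j)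
      hom i j = trans (cong fromℤ (ℤ.pos-* i j))
        (sym (cong₂ _*_ (fromℤ-mkℚ (+ i)) (fromℤ-mkℚ (+ j))))
    A<g : A < g
    A<g = subst₂ _<_ (ℚ.+-identityʳ A) (sym eq) (ℚ.+-monoʳ-< A (1/suc-pos k))
    1≤g : 1ℚ ≤ g
    1≤g = ℚ.≤-trans (fromℤ-mono {+ 1} {+ suc a} (ℤ.+≤+ (ℕ.s≤s ℕ.z≤n))) (ℚ.<⇒≤ A<g)
    x≤A : x ≤ A
    x≤A = subst (x ≤_) (sym (fromℤ-mkℚ (+ suc a))) (*≤* (subst₂ ℤ._≤_
      (ℤ.pos-* a 1) (ℤ.pos-* (suc a) (suc d-1))
      (ℤ.+≤+ (ℕ.*-mono-≤ (ℕ.n≤1+n a) (ℕ.s≤s (ℕ.z≤n {d-1}))))))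
    x<g : x < g
    x<g = ℚ.≤-<-trans x≤A A<g

  -- the n-th root of x ≥ 0 rounded down to a multiple of 1 / (k + 1)
  rootBelow : (n k : ℕ) → ℚ → ℚ
  rootBelow n k x = grid k (search n k x (searchBound k x))

  rootBelow-lower : ∀ n k {x} → 0ℚ ≤ x → rootBelow (suc n) k x ^ suc n ≤ x
  rootBelow-lower n k {x} h = search-lower n k (searchBound k x) h

  rootBelow-upper : ∀ n k {x} → 0ℚ ≤ x → x < (rootBelow (suc n) k x + 1/suc k) ^ suc n
  rootBelow-upper n k {x} h =
    subst (λ r → x < r ^ suc n) (grid-suc k (search (suc n) k x (searchBound k x)))
      (search-upper (suc n) k (searchBound k x) (searchBound-large n k h))

  Cauchy-root : ∀ {s} n → (∀ k → 0ℚ ≤ s k) → Cauchy s → Cauchy (λ k → rootBelow (suc n) k (s k))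
  Cauchy-root {s} n s≥0 hs ε h =
    go (hs ((½ * ε) ^ suc n) (^-pos (suc n) (half-pos h))) (1/suc-≤ (½ * ε) (half-pos h))
    where
    r : ℕ → ℚ
    r k = rootBelow (suc n) k (s k)
    ½ε≥0 : 0ℚ ≤ ½ * ε
    ½ε≥0 = ℚ.<⇒≤ (half-pos h)
    r+≥0 : ∀ l → 0ℚ ≤ r l + 1/suc l
    r+≥0 l = +-nonneg (grid-nonneg l (search (suc n) l (s l) (searchBound l (s l)))) (1/suc-nonneg l)
    half : ∀ k l → ∣ s k - s l ∣ ≤ (½ * ε) ^ suc n → 1/suc l ≤ ½ * ε → r k ≤ r l + ε
    half k l close fine = ℚ.≤-trans
      (ℚ.<⇒≤ (^-cancel-< {r k} {r l + 1/suc l + ½ * ε} (suc n) (+-nonneg (r+≥0 l) ½ε≥0)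
        (ℚ.≤-<-trans (rootBelow-lower n k (s≥0 k))
        (ℚ.≤-<-trans (≤-∣-∣ (s k) (s l) close)
        (ℚ.<-≤-trans (ℚ.+-monoˡ-< ((½ * ε) ^ suc n) (rootBelow-upper n l (s≥0 l)))
        (^-superadditive n (r+≥0 l) ½ε≥0))))))
      (subst (r l + 1/suc l + ½ * ε ≤_)
        (trans (ℚ.+-assoc (r l) (½ * ε) (½ * ε)) (cong (λ e → r l + e) (halves ε)))
        (ℚ.+-monoˡ-≤ (½ * ε) (ℚ.+-monoʳ-≤ (r l) fine)))
    go : ∃[ M ] (∀ k l → M ℕ.≤ k → M ℕ.≤ l → ∣ s k - s l ∣ ≤ (½ * ε) ^ suc n) →
         ∃[ N ] 1/suc N ≤ ½ * ε →
         ∃[ N ] (∀ k l → N ℕ.≤ k → N ℕ.≤ l → ∣ r k - r l ∣ ≤ ε)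
    go (M , p) (N , q) = M ℕ.⊔ N , λ k l hk hl →
      let kM = ℕ.m⊔n≤o⇒m≤o M N hk ; lM = ℕ.m⊔n≤o⇒m≤o M N hl
          kN = ℕ.m⊔n≤o⇒n≤o M N hk ; lN = ℕ.m⊔n≤o⇒n≤o M N hl
      in ∣-∣≤ (r k) (r l) (half k l (p k l kM lM) (ℚ.≤-trans (1/suc-antitone lN) q))
                          (half l k (p l k lM kM) (ℚ.≤-trans (1/suc-antitone kN) q))

  ∣-∣-^ : ∀ {p q ρ} n → 0ℚ ≤ p → 0ℚ ≤ q → p ≤ ρ → q ≤ ρ →
          ∣ p ^ suc n - q ^ suc n ∣ ≤ fromℤ (+ suc n) * ρ ^ n * ∣ p - q ∣
  ∣-∣-^ {p} {q} {ρ} zero hp hq pρ qρ = ℚ.≤-reflexive (trans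
    (cong₂ (λ a b → ∣ a - b ∣) (ℚ.*-identityʳ p) (ℚ.*-identityʳ q))
    (sym (ℚ.*-identityˡ ∣ p - q ∣)))
  ∣-∣-^ {p} {q} {ρ} (suc n) hp hq pρ qρ = ℚ.≤-trans (∣-∣-* p (p ^ suc n) q (q ^ suc n))
    (subst (∣ p ∣ * ∣ p ^ suc n - q ^ suc n ∣ + ∣ q ^ suc n ∣ * d ≤_) eq (ℚ.+-mono-≤
      (*-mono (ℚ.0≤∣p∣ p) bound≥0 (subst (_≤ ρ) (sym (ℚ.0≤p⇒∣p∣≡p hp)) pρ)
        (∣-∣-^ n hp hq pρ qρ))
      (*-monoʳ d d≥0 (subst (_≤ ρ ^ suc n) (sym (ℚ.0≤p⇒∣p∣≡p (^-nonneg (suc n) hq)))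
        (^-mono (suc n) hq qρ)))))
    where
    d = ∣ p - q ∣
    d≥0 = ℚ.0≤∣p∣ (p - q)
    ρ≥0 = ℚ.≤-trans hp pρ
    N = fromℤ (+ suc n)
    bound≥0 : 0ℚ ≤ N * ρ ^ n * d
    bound≥0 = *-nonneg (*-nonneg (fromℤ-mono {+ 0} {+ suc n} (ℤ.+≤+ ℕ.z≤n)) (^-nonneg n ρ≥0)) d≥0
    eq : ρ * (N * ρ ^ n * d) + ρ ^ suc n * d ≡ fromℤ (+ suc (suc n)) * ρ ^ suc n * d
    eq = trans
      (solve 4 (λ N ρ a d → ρ :* (N :* a :* d) :+ ρ :* a :* d := (N :+ con 1ℚ) :* (ρ :* a) :* d)
        refl N ρ (ρ ^ n) d)
      (cong (λ N → N * ρ ^ suc n * d) (sym (fromℤ-suc (+ suc n))))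

  geometric : ℕ → ℚ → ℚ
  geometric zero    u = 0ℚ
  geometric (suc n) u = geometric n u + u ^ n

  geometric-sum : ∀ n u → (1ℚ - u) * geometric n u ≡ 1ℚ - u ^ n
  geometric-sum zero    u = ℚ.*-zeroʳ (1ℚ - u)
  geometric-sum (suc n) u = begin
    (1ℚ - u) * (geometric n u + u ^ n)
      ≡⟨ ℚ.*-distribˡ-+ (1ℚ - u) (geometric n u) (u ^ n) ⟩
    (1ℚ - u) * geometric n u + (1ℚ - u) * u ^ n
      ≡⟨ cong (λ s → s + (1ℚ - u) * u ^ n) (geometric-sum n u) ⟩
    1ℚ - u ^ n + (1ℚ - u) * u ^ n
      ≡⟨ solve 2 (λ u a → con 1ℚ :- a :+ (con 1ℚ :- u) :* a := con 1ℚ :- u :* a) refl u (u ^ n) ⟩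
    1ℚ - u ^ suc n ∎
    where open ≡-Reasoning

  geometric-nonneg : ∀ n {u} → 0ℚ ≤ u → 0ℚ ≤ geometric n u
  geometric-nonneg zero    h = ℚ.≤-refl
  geometric-nonneg (suc n) h = +-nonneg (geometric-nonneg n h) (^-nonneg n h)

  geometric-bound : ∀ n {K u} → 0ℚ ≤ K → 0ℚ ≤ u → K * (1ℚ - u) ≡ 1ℚ → geometric n u ≤ K
  geometric-bound n {K} {u} hK hu eq = subst₂ _≤_
    (begin
      K * (1ℚ - u ^ n)             ≡⟨ cong (K *_) (geometric-sum n u) ⟨
      K * ((1ℚ - u) * geometric n u) ≡⟨ ℚ.*-assoc K (1ℚ - u) (geometric n u) ⟨
      K * (1ℚ - u) * geometric n u ≡⟨ cong (_* geometric n u) eq ⟩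
      1ℚ * geometric n u           ≡⟨ ℚ.*-identityˡ (geometric n u) ⟩
      geometric n u                ∎)
    (ℚ.*-identityʳ K)
    (*-monoˡ K hK (≤-by (u ^ n) (^-nonneg n hu)
      (solve 1 (λ a → con 1ℚ := con 1ℚ :- a :+ a) refl (u ^ n))))
    where open ≡-Reasoning

  -- partial sums of - log (1 - u) = u + u² / 2 + u³ / 3 + ⋯
  logSum : ℕ → ℚ → ℚ
  logSum zero    u = 0ℚ
  logSum (suc n) u = logSum n u + u ^ suc n * 1/suc n

  logSum-lipschitz : ∀ {p q ρ} n → 0ℚ ≤ p → 0ℚ ≤ q → p ≤ ρ → q ≤ ρ →
                     ∣ logSum n p - logSum n q ∣ ≤ geometric n ρ * ∣ p - q ∣
  logSum-lipschitz {p} {q} zero hp hq pρ qρ = ℚ.≤-reflexive (sym (ℚ.*-zeroˡ ∣ p - q ∣))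
  logSum-lipschitz {p} {q} {ρ} (suc n) hp hq pρ qρ = ℚ.≤-trans
    (∣-∣-+ (logSum n p) (a * h) (logSum n q) (b * h))
    (subst (∣ logSum n p - logSum n q ∣ + ∣ a * h - b * h ∣ ≤_)
      (sym (ℚ.*-distribʳ-+ ∣ p - q ∣ (geometric n ρ) (ρ ^ n)))
      (ℚ.+-mono-≤ (logSum-lipschitz n hp hq pρ qρ) term))
    where
    a = p ^ suc n
    b = q ^ suc n
    h = 1/suc n
    N = fromℤ (+ suc n)
    eq₁ : ∣ a - b ∣ * h ≡ ∣ a * h - b * h ∣
    eq₁ = begin
      ∣ a - b ∣ * h      ≡⟨ cong (∣ a - b ∣ *_) (ℚ.0≤p⇒∣p∣≡p (1/suc-nonneg n)) ⟨
      ∣ a - b ∣ * ∣ h ∣  ≡⟨ ℚ.∣p*q∣≡∣p∣*∣q∣ (a - b) h ⟨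
      ∣ (a - b) * h ∣    ≡⟨ cong ∣_∣ (solve 3 (λ a b h → (a :- b) :* h := a :* h :- b :* h) refl a b h) ⟩
      ∣ a * h - b * h ∣  ∎
      where open ≡-Reasoning
    eq₂ : N * ρ ^ n * ∣ p - q ∣ * h ≡ ρ ^ n * ∣ p - q ∣
    eq₂ = begin
      N * ρ ^ n * ∣ p - q ∣ * h
        ≡⟨ solve 4 (λ N a d h → N :* a :* d :* h := N :* h :* (a :* d)) refl N (ρ ^ n) ∣ p - q ∣ h ⟩
      N * h * (ρ ^ n * ∣ p - q ∣)
        ≡⟨ cong (_* (ρ ^ n * ∣ p - q ∣)) (1/suc-inverse n) ⟩
      1ℚ * (ρ ^ n * ∣ p - q ∣)
        ≡⟨ ℚ.*-identityˡ (ρ ^ n * ∣ p - q ∣) ⟩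
      ρ ^ n * ∣ p - q ∣ ∎
      where open ≡-Reasoning
    term : ∣ a * h - b * h ∣ ≤ ρ ^ n * ∣ p - q ∣
    term = subst₂ _≤_ eq₁ eq₂ (*-monoʳ h (1/suc-nonneg n) (∣-∣-^ n hp hq pρ qρ))

  logSum-mono : ∀ k d {u} → 0ℚ ≤ u → logSum k u ≤ logSum (d ℕ.+ k) u
  logSum-mono k zero    h = ℚ.≤-refl
  logSum-mono k (suc d) {u} h = ℚ.≤-trans (logSum-mono k d h)
    (≤-by (u ^ suc (d ℕ.+ k) * 1/suc (d ℕ.+ k))
      (*-nonneg (^-nonneg (suc (d ℕ.+ k)) h) (1/suc-nonneg (d ℕ.+ k))) refl)

  logSum-tail : ∀ k d {u} → 0ℚ ≤ u → u ≤ 1ℚ →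
    logSum (d ℕ.+ k) u ≤ logSum k u + 1/suc k * (geometric (d ℕ.+ k) u - geometric k u)
  logSum-tail k zero {u} h h1 = ℚ.≤-reflexive (sym (trans
    (cong (λ z → logSum k u + 1/suc k * z) (ℚ.+-inverseʳ (geometric k u)))
    (trans (cong (λ z → logSum k u + z) (ℚ.*-zeroʳ (1/suc k))) (ℚ.+-identityʳ (logSum k u)))))
  logSum-tail k (suc d) {u} h h1 = subst (logSum (suc d ℕ.+ k) u ≤_) eq
    (ℚ.+-mono-≤ (logSum-tail k d h h1)
      (ℚ.≤-trans (*-monoˡ (u ^ suc j) (^-nonneg (suc j) h) (1/suc-antitone (ℕ.m≤n+m k d)))
                 (*-monoʳ (1/suc k) (1/suc-nonneg k) u^)))
    where
    j = d ℕ.+ k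
    u^ : u ^ suc j ≤ u ^ j
    u^ = subst (u * u ^ j ≤_) (ℚ.*-identityˡ (u ^ j)) (*-monoʳ (u ^ j) (^-nonneg j h) h1)
    eq : logSum k u + 1/suc k * (geometric j u - geometric k u) + u ^ j * 1/suc k
       ≡ logSum k u + 1/suc k * (geometric (suc j) u - geometric k u)
    eq = solve 5 (λ l h g g' a → l :+ h :* (g :- g') :+ a :* h := l :+ h :* (g :+ a :- g'))
      refl (logSum k u) (1/suc k) (geometric j u) (geometric k u) (u ^ j)

  logSum-cauchy-≤ : ∀ k d {K u} → 0ℚ ≤ K → 0ℚ ≤ u → K * (1ℚ - u) ≡ 1ℚ → u ≤ 1ℚ →
                    logSum (d ℕ.+ k) u ≤ logSum k u + K * 1/suc k
  logSum-cauchy-≤ k d {K} {u} hK hu eq u1 = ℚ.≤-trans (logSum-tail k d hu u1)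
    (ℚ.+-monoʳ-≤ (logSum k u) (subst (1/suc k * (g - g') ≤_) (ℚ.*-comm (1/suc k) K)
      (*-monoˡ (1/suc k) (1/suc-nonneg k) (ℚ.≤-trans
        (≤-by g' (geometric-nonneg k hu) (solve 2 (λ g g' → g := g :- g' :+ g') refl g g'))
        (geometric-bound (d ℕ.+ k) hK hu eq)))))
    where
    g = geometric (d ℕ.+ k) u
    g' = geometric k u

  logSum-cauchy : ∀ k l {K u} → 0ℚ ≤ K → 0ℚ ≤ u → K * (1ℚ - u) ≡ 1ℚ → u ≤ 1ℚ →
                  ∣ logSum k u - logSum l u ∣ ≤ K * 1/suc k + K * 1/suc l
  logSum-cauchy k l {K} {u} hK hu eq u1 =
    ∣-∣≤ (logSum k u) (logSum l u) (half k l)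
      (subst (λ e → logSum l u ≤ logSum k u + e) (ℚ.+-comm (K * 1/suc l) (K * 1/suc k)) (half l k))
    where
    err≥0 : ∀ k → 0ℚ ≤ K * 1/suc k
    err≥0 k = *-nonneg hK (1/suc-nonneg k)
    half : ∀ k l → logSum k u ≤ logSum l u + (K * 1/suc k + K * 1/suc l)
    half k l = by-cases (ℕ.≤-total k l)
      where
      by-cases : k ℕ.≤ l ⊎ l ℕ.≤ k → logSum k u ≤ logSum l u + (K * 1/suc k + K * 1/suc l)
      by-cases (inj₁ k≤l) = ℚ.≤-trans
        (subst (λ j → logSum k u ≤ logSum j u) (ℕ.m∸n+n≡m k≤l) (logSum-mono k (l ℕ.∸ k) hu))
        (≤-by (K * 1/suc k + K * 1/suc l) (+-nonneg (err≥0 k) (err≥0 l)) refl)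
      by-cases (inj₂ l≤k) = ℚ.≤-trans
        (subst (λ j → logSum j u ≤ logSum l u + K * 1/suc l) (ℕ.m∸n+n≡m l≤k)
          (logSum-cauchy-≤ l (k ℕ.∸ l) hK hu eq u1))
        (ℚ.+-monoʳ-≤ (logSum l u) (≤-by (K * 1/suc k) (err≥0 k)
          (ℚ.+-comm (K * 1/suc k) (K * 1/suc l))))

  logApprox : ℕ → ℚ → ℚ
  logApprox k x = logSum k (1ℚ - recip (1ℚ ⊔ x))

  Cauchy-log : ∀ {s} → Cauchy s → Cauchy (λ k → logApprox k (s k))
  Cauchy-log {s} hs = go (Cauchy-bounded {t} ht)
    where
    t : ℕ → ℚ
    t k = 1ℚ ⊔ s k
    ht : Cauchy t
    ht = Cauchy-⊔ {s} 1ℚ hs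
    u : ℕ → ℚ
    u k = 1ℚ - recip (t k)
    1≤t : ∀ k → 1ℚ ≤ t k
    1≤t k = ℚ.p≤p⊔q 1ℚ (s k)
    0<t : ∀ k → 0ℚ < t k
    0<t k = ℚ.<-≤-trans 0<1 (1≤t k)
    recip≤1 : ∀ k → recip (t k) ≤ 1ℚ
    recip≤1 k = recip-antitone {1ℚ} {t k} 0<1 (1≤t k)
    hu : Cauchy u
    hu = Small-≤ {λ k l → ∣ u k - u l ∣} {λ k l → ∣ recip (t k) - recip (t l) ∣} 0
      (λ k l _ _ → ℚ.≤-reflexive (trans
        (cong ∣_∣ (solve 2 (λ a b → (con 1ℚ :- a) :- (con 1ℚ :- b) := b :- a)
          refl (recip (t k)) (recip (t l))))
        (∣-∣-sym (recip (t l)) (recip (t k)))))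
      (Cauchy-recip {t} 1ℚ 0 0<1 (λ k _ → 1≤t k) ht)
    u≥0 : ∀ k → 0ℚ ≤ u k
    u≥0 k = sub-nonneg (recip≤1 k)
    u≤1 : ∀ k → u k ≤ 1ℚ
    u≤1 k = ≤-by (recip (t k)) (ℚ.<⇒≤ (recip-pos (0<t k)))
      (solve 1 (λ a → con 1ℚ := con 1ℚ :- a :+ a) refl (recip (t k)))
    go : ∃[ B ] ∃[ N ] (0ℚ < B × (∀ k → N ℕ.≤ k → ∣ t k ∣ ≤ B)) →
         Cauchy (λ k → logSum k (u k))
    go (B , N , hB , b) = Small-≤ {λ k l → ∣ logSum k (u k) - logSum l (u l) ∣}
      {λ k l → B * ∣ u k - u l ∣ + B * (1/suc k + 1/suc l)} N
      (λ k l hk hl → ℚ.≤-trans (∣-∣-tri (logSum k (u k)) (logSum k (u l)) (logSum l (u l)))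
        (ℚ.+-mono-≤ (first k l hk hl) (second k l hl)))
      (Small-+ {λ k l → B * ∣ u k - u l ∣} {λ k l → B * (1/suc k + 1/suc l)}
        (Small-* {λ k l → ∣ u k - u l ∣} B hB hu)
        (Small-* {λ k l → 1/suc k + 1/suc l} B hB Small-1/suc))
      where
      B≥0 = ℚ.<⇒≤ hB
      t≤B : ∀ k → N ℕ.≤ k → t k ≤ B
      t≤B k hk = ℚ.≤-trans (p≤∣p∣ (t k)) (b k hk)
      ρ = 1ℚ - recip B
      inv : ∀ K → 0ℚ < K → K * (1ℚ - (1ℚ - recip K)) ≡ 1ℚ
      inv K hK = trans
        (cong (K *_) (solve 1 (λ a → con 1ℚ :- (con 1ℚ :- a) := a) refl (recip K)))
        (recip-inverse hK)
      u≤ρ : ∀ k → N ℕ.≤ k → u k ≤ ρ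
      u≤ρ k hk = ℚ.+-monoʳ-≤ 1ℚ (ℚ.neg-antimono-≤ (recip-antitone (0<t k) (t≤B k hk)))
      first : ∀ k l → N ℕ.≤ k → N ℕ.≤ l → ∣ logSum k (u k) - logSum k (u l) ∣ ≤ B * ∣ u k - u l ∣
      first k l hk hl = ℚ.≤-trans
        (logSum-lipschitz {u k} {u l} {ρ} k (u≥0 k) (u≥0 l) (u≤ρ k hk) (u≤ρ l hl))
        (*-monoʳ ∣ u k - u l ∣ (ℚ.0≤∣p∣ (u k - u l))
          (geometric-bound k B≥0 (ℚ.≤-trans (u≥0 k) (u≤ρ k hk)) (inv B hB)))
      second : ∀ k l → N ℕ.≤ l → ∣ logSum k (u l) - logSum l (u l) ∣ ≤ B * (1/suc k + 1/suc l)
      second k l hl = ℚ.≤-trans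
        (logSum-cauchy k l {t l} {u l} (ℚ.<⇒≤ (0<t l)) (u≥0 l) (inv (t l) (0<t l)) (u≤1 l))
        (subst (_≤ B * (1/suc k + 1/suc l)) (ℚ.*-distribˡ-+ (t l) (1/suc k) (1/suc l))
          (*-monoʳ (1/suc k + 1/suc l) (+-nonneg (1/suc-nonneg k) (1/suc-nonneg l)) (t≤B l hl)))

-- Real numbers are Cauchy sequences of rationals; no quotient is taken, equality of reals being _≈_.
record ℝ : Set where
  constructor mkℝ
  field
    seq    : ℕ → ℚ
    cauchy : Rational.Cauchy seq

open ℝ public

infix 4 _<_ _≤_ _≈_
infixl 6 _+_
infixl 7 _*_

_<_ : ℝ → ℝ → Set
x < y = ∃[ ε ] ∃[ N ] (0ℚ ℚ.< ε × (∀ k → N ℕ.≤ k → seq x k ℚ.+ ε ℚ.≤ seq y k))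

_≤_ : ℝ → ℝ → Set
x ≤ y = ¬ (y < x)

_≈_ : ℝ → ℝ → Set
x ≈ y = x ≤ y × y ≤ x

fromℚ : ℚ → ℝ
fromℚ p = mkℝ (λ _ → p) (Rational.Cauchy-const p)

fromℤ : ℤ → ℝ
fromℤ z = fromℚ (z ℚ./ 1)

fromℕ : ℕ → ℝ
fromℕ n = fromℤ (+ n)

0ℝ 1ℝ 2ℝ : ℝ
0ℝ = fromℕ 0
1ℝ = fromℕ 1
2ℝ = fromℕ 2

_+_ : ℝ → ℝ → ℝ
x + y = mkℝ (λ k → seq x k ℚ.+ seq y k) (Rational.Cauchy-+ {seq x} {seq y} (cauchy x) (cauchy y))

_*_ : ℝ → ℝ → ℝ
x * y = mkℝ (λ k → seq x k ℚ.* seq y k) (Rational.Cauchy-* {seq x} {seq y} (cauchy x) (cauchy y))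

ℝ-rawSemiring : RawSemiring 0ℓ 0ℓ
ℝ-rawSemiring = record { Carrier = ℝ ; _≈_ = _≈_ ; _+_ = _+_ ; _*_ = _*_ ; 0# = 0ℝ ; 1# = 1ℝ }

open RawSemiringOps ℝ-rawSemiring public using (_^_; sum; product)

-- Only finitely many terms of seq x can vanish, and Rational.recip 0 = 0.
reciprocal : (x : ℝ) → 0ℝ < x → ℝ
reciprocal x (ε , N , 0<ε , h) = mkℝ (λ k → Rational.recip (seq x k))
  (Rational.Cauchy-recip {seq x} ε N 0<ε
    (λ k hk → subst (ℚ._≤ seq x k) (ℚ.+-identityˡ ε) (h k hk)) (cauchy x))

-- The distance to the nearest integer is 1-Lipschitz on ℚ, hence can be computed termwise.
∥_∥ : ℝ → ℝ
∥ x ∥ = mkℝ (λ k → Rational.∥ seq x k ∥) (Rational.Cauchy-∥∥ {seq x} (cauchy x))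

-- log⁺ x = max {0, log x}, which is log x for x ≥ 1.  Its k-th term is Σ_{1 ≤ j ≤ k} uʲ / j with
-- u = 1 - 1 / max {1, seq x k}, a partial sum of the series of - log (1 - u).
log⁺ : ℝ → ℝ
log⁺ x = mkℝ (λ k → Rational.logApprox k (seq x k)) (Rational.Cauchy-log {seq x} (cauchy x))

ℝ≥0 : Set
ℝ≥0 = Σ ℝ (0ℝ ≤_)

pointwise-nonneg : ∀ {x} → (∀ k → 0ℚ ℚ.≤ seq x k) → 0ℝ ≤ x
pointwise-nonneg {x} h (ε , N , 0<ε , x+ε≤0) =
  ℚ.<-irrefl refl (ℚ.<-≤-trans (ℚ.+-mono-≤-< (h N) 0<ε) (x+ε≤0 N ℕ.≤-refl))

-- The n-th root of max {0, x}; its k-th term is rounded down to a multiple of 1 / (k + 1).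
root : (n : ℕ) .{{_ : ℕ.NonZero n}} → ℝ → ℝ≥0
root (suc n) x = r , pointwise-nonneg {r} λ k →
    Rational.grid-nonneg k (Rational.search (suc n) k (x⁺ k) (Rational.searchBound k (x⁺ k)))
  where
  x⁺ : ℕ → ℚ
  x⁺ k = 0ℚ ℚ.⊔ seq x k
  r : ℝ
  r = mkℝ (λ k → Rational.rootBelow (suc n) k (x⁺ k))
    (Rational.Cauchy-root {x⁺} n (λ k → ℚ.p≤p⊔q 0ℚ (seq x k)) (Rational.Cauchy-⊔ {seq x} 0ℚ (cauchy x)))

<-≤-pos : ∀ x y → 0ℝ < x → x ≤ y → 0ℝ < y
<-≤-pos x y (ε , M , 0<ε , x≥ε) x≤y = go (cauchy y (½ ℚ.* (½ ℚ.* ε)) δ>0)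
  where
  open +-*-Solver using (solve; _:=_; _:+_; _:*_; _:-_; con)
  open Rational using (half-pos; halves; ≤-∣-∣)
  δ = ½ ℚ.* (½ ℚ.* ε)
  δ>0 = half-pos (half-pos 0<ε)
  go : ∃[ N ] (∀ k l → N ℕ.≤ k → N ℕ.≤ l → ℚ.∣ seq y k ℚ.- seq y l ∣ ℚ.≤ δ) → 0ℝ < y
  go (N , close) = by-cases (seq y K ℚ.≤? ½ ℚ.* ε)
    where
    K = M ℕ.⊔ N
    close-K : ∀ k → K ℕ.≤ k → ℚ.∣ seq y k ℚ.- seq y K ∣ ℚ.≤ δ
    close-K k hk = close k K (ℕ.m⊔n≤o⇒n≤o M N hk) (ℕ.m≤n⊔m M N)
    by-cases : Dec (seq y K ℚ.≤ ½ ℚ.* ε) → 0ℝ < y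
    by-cases (yes small) = contradiction
      (δ , K , δ>0 , λ k hk → ℚ.≤-trans
        (subst (seq y k ℚ.+ δ ℚ.≤_)
          (solve 1 (λ e → con ½ :* e :+ con ½ :* (con ½ :* e) :+ con ½ :* (con ½ :* e)
            := con 0ℚ :+ e) refl ε)
          (ℚ.+-monoˡ-≤ δ (ℚ.≤-trans (≤-∣-∣ (seq y k) (seq y K) (close-K k hk))
            (ℚ.+-monoˡ-≤ δ small))))
        (x≥ε k (ℕ.m⊔n≤o⇒m≤o M N hk)))
      x≤y
    by-cases (no ¬small) = δ , K , δ>0 , λ k hk →
      Rational.≤-by (seq y k ℚ.+ δ ℚ.- ½ ℚ.* ε)
        (Rational.sub-nonneg (ℚ.≤-trans (ℚ.<⇒≤ (ℚ.≰⇒> ¬small))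
          (≤-∣-∣ (seq y K) (seq y k)
            (subst (ℚ._≤ δ) (Rational.∣-∣-sym (seq y k) (seq y K)) (close-K k hk)))))
        (solve 2 (λ a e → a := con 0ℚ :+ con ½ :* (con ½ :* e)
            :+ (a :+ con ½ :* (con ½ :* e) :- con ½ :* e)) refl (seq y k) ε)

product-nonneg : ∀ {m} (x : Fin m → ℝ) k → (∀ i → 0ℚ ℚ.≤ seq (x i) k) → 0ℚ ℚ.≤ seq (product x) k
product-nonneg {zero}  x k h = Rational.0≤1
product-nonneg {suc m} x k h =
  Rational.*-nonneg (h zero) (product-nonneg (λ i → x (suc i)) k (λ i → h (suc i)))

product-≤-1 : ∀ {m} (x : Fin m → ℝ) k → (∀ i → 0ℚ ℚ.≤ seq (x i) k) → (∀ i → seq (x i) k ℚ.≤ 1ℚ) →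
              seq (product x) k ℚ.≤ 1ℚ
product-≤-1 {zero}  x k h h1 = ℚ.≤-refl
product-≤-1 {suc m} x k h h1 = subst (seq (product x) k ℚ.≤_) (ℚ.*-identityˡ 1ℚ)
  (Rational.*-mono (h zero) Rational.0≤1 (h1 zero)
    (product-≤-1 (λ i → x (suc i)) k (λ i → h (suc i)) (λ i → h1 (suc i))))

product-≤-factor : ∀ {m} (x : Fin m → ℝ) k →
  (∀ i → 0ℚ ℚ.≤ seq (x i) k) → (∀ i → seq (x i) k ℚ.≤ 1ℚ) →
  ∀ i → seq (product x) k ℚ.≤ seq (x i) k
product-≤-factor x k h h1 zero = subst (seq (product x) k ℚ.≤_) (ℚ.*-identityʳ (seq (x zero) k))
  (Rational.*-monoˡ (seq (x zero) k) (h zero)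
    (product-≤-1 (λ i → x (suc i)) k (λ i → h (suc i)) (λ i → h1 (suc i))))
product-≤-factor x k h h1 (suc i) = subst (seq (product x) k ℚ.≤_) (ℚ.*-identityˡ (seq (x (suc i)) k))
  (Rational.*-mono (h zero) (h (suc i)) (h1 zero)
    (product-≤-factor (λ i → x (suc i)) k (λ i → h (suc i)) (λ i → h1 (suc i)) i))

factor-pos : ∀ {m} (p : ℝ) (x : Fin m → ℝ) → 0ℝ < p * product (λ i → ∥ x i ∥) →
             ∀ i → 0ℝ < ∥ x i ∥
factor-pos {m} p x (ε , M , 0<ε , h) i = go (Rational.Cauchy-bounded {seq p} (cauchy p))
  where
  go : ∃[ B ] ∃[ N ] (0ℚ ℚ.< B × (∀ k → N ℕ.≤ k → ℚ.∣ seq p k ∣ ℚ.≤ B)) → 0ℝ < ∥ x i ∥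
  go (B , N , 0<B , b) = Rational.recip B ℚ.* ε , M ℕ.⊔ N ,
    Rational.*-pos (Rational.recip-pos 0<B) 0<ε , λ k hk →
      subst (ℚ._≤ seq ∥ x i ∥ k) (sym (ℚ.+-identityˡ (Rational.recip B ℚ.* ε)))
        (ℚ.*-cancelˡ-≤-pos B {{ℚ.positive 0<B}}
          (subst (ℚ._≤ B ℚ.* seq ∥ x i ∥ k) (sym (Rational.recip-scale 0<B ε))
            (ε≤ k (ℕ.m⊔n≤o⇒m≤o M N hk) (ℕ.m⊔n≤o⇒n≤o M N hk))))
    where
    ∥∥≥0 : ∀ k i → 0ℚ ℚ.≤ seq ∥ x i ∥ k
    ∥∥≥0 k i = ℚ.0≤∣p∣ (seq (x i) k ℚ.- Rational.fromℤ (round (seq (x i) k)))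
    ∥∥≤1 : ∀ k i → seq ∥ x i ∥ k ℚ.≤ 1ℚ
    ∥∥≤1 k i = ℚ.≤-trans (Rational.∥∥≤½ (seq (x i) k)) (Rational.≤-by ½ Rational.0≤½ refl)
    ε≤ : ∀ k → M ℕ.≤ k → N ℕ.≤ k → ε ℚ.≤ B ℚ.* seq ∥ x i ∥ k
    ε≤ k hM hN = ℚ.≤-trans (subst (ℚ._≤ seq p k ℚ.* Π) (ℚ.+-identityˡ ε) (h k hM))
      (ℚ.≤-trans
        (Rational.*-monoʳ Π (product-nonneg (λ i → ∥ x i ∥) k (∥∥≥0 k))
          (ℚ.≤-trans (Rational.p≤∣p∣ (seq p k)) (b k hN)))
        (Rational.*-monoˡ B (ℚ.<⇒≤ 0<B)
          (product-≤-factor (λ i → ∥ x i ∥) k (∥∥≥0 k) (∥∥≤1 k) i)))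
      where
      Π = seq (product (λ i → ∥ x i ∥)) k

-- non-increasing functions [0, +∞) → (0, 1]; antitonicity for _≤_ makes fun respect _≈_
record NonIncreasing : Set where
  field
    fun      : ℝ≥0 → ℝ
    positive : ∀ x → 0ℝ < fun x
    ≤1       : ∀ x → fun x ≤ 1ℝ
    antitone : ∀ x y → proj₁ x ≤ proj₁ y → fun y ≤ fun x

open NonIncreasing public

Matrix : ℕ → ℕ → Set
Matrix m n = Fin m → Fin n → ℝ

ℤⁿ∖0 : ℕ → Set
ℤⁿ∖0 n = Σ (Vec ℤ n) (λ q → q ≢ Vec.replicate n (+ 0))

row : ∀ {m n} → Matrix m n → Fin m → Vec ℤ n → ℝ
row L i q = sum (λ j → L i j * fromℤ (Vec.lookup q j))

-- q⁺ = max {1, |q|}.  The absolute value is essential: with max {1, q} in its place every q with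
-- q₁, …, qₙ ≤ 0 would satisfy ∏ ∥Lᵢ q∥ ≥ φ 1, which Dirichlet's theorem rules out for every L.
_⁺ : ℤ → ℝ
q ⁺ = fromℕ (1 ℕ.⊔ ℤ.∣ q ∣)

∏⁺ : ∀ {n} → Vec ℤ n → ℝ
∏⁺ q = product (λ j → Vec.lookup q j ⁺)

MultBadlyApproximable : ∀ {m n} .{{_ : ℕ.NonZero n}} → NonIncreasing → Matrix m n → Set
MultBadlyApproximable {m} {n} φ L = ∀ ((q , _) : ℤⁿ∖0 n) →
  fun φ (root n (∏⁺ q)) ≤ ∏⁺ q * product (λ i → ∥ row L i q ∥)

∥row∥-pos : ∀ {m n} .{{_ : ℕ.NonZero n}} (φ : NonIncreasing) (L : Matrix m n) →
            MultBadlyApproximable φ L → ∀ ((q , _) : ℤⁿ∖0 n) i → 0ℝ < ∥ row L i q ∥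
∥row∥-pos {n = n} φ L bad (q , q≢0) = factor-pos (∏⁺ q) (λ i → row L i q)
  (<-≤-pos (fun φ (root n (∏⁺ q))) (∏⁺ q * product (λ i → ∥ row L i q ∥))
    (positive φ (root n (∏⁺ q))) (bad (q , q≢0)))

term : ∀ {m n} .{{_ : ℕ.NonZero n}} (φ : NonIncreasing) (L : Matrix m n) →
       MultBadlyApproximable φ L → ℤⁿ∖0 n → ℝ
term φ L bad q = product (λ i → reciprocal ∥ row L i (proj₁ q) ∥ (∥row∥-pos φ L bad q i))

InBox : ∀ {n} → (Fin n → ℝ) → Vec ℤ n → Set
InBox T q = ∀ j → + 0 ℤ.≤ Vec.lookup q j × fromℤ (Vec.lookup q j) ≤ T j

-- qs lists the index set {q ∈ ℤⁿ ∖ {0} : 0 ≤ qⱼ ≤ Tⱼ} without repetition.  Comparison of reals being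
-- undecidable, the list cannot be computed from T, so sums over the set are sums over any such qs.
record Enumerates {n} (T : Fin n → ℝ) (qs : List (ℤⁿ∖0 n)) : Set where
  field
    unique   : Unique (List.map proj₁ qs)
    sound    : All (λ q → InBox T (proj₁ q)) qs
    complete : ∀ (q : ℤⁿ∖0 n) → InBox T (proj₁ q) → proj₁ q ∈ List.map proj₁ qs

sumOver : ∀ {A : Set} → (A → ℝ) → List A → ℝ
sumOver f = List.foldr (λ a s → f a + s) 0ℝ

geometricMean : ∀ {n} .{{_ : ℕ.NonZero n}} → (Fin n → ℝ) → ℝ≥0
geometricMean {n} T = root n (product T)

infixl 7 _/[_]_

_/[_]_ : ℝ → (φ : NonIncreasing) → ℝ≥0 → ℝ
x /[ φ ] y = x * reciprocal (fun φ y) (positive φ y)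

{-# OPTIONS --safe #-}
module Submission where

-- Write N = T₁ ⋯ Tₙ, K = φ(T̄) and sort the points q of the box by the vector k with ∥Lᵢ q∥ ≈ b ^ (- kᵢ); if
-- s = k₁ + ⋯ + kₘ, a point in class k contributes about b ^ s, and bad approximability gives b ^ s ≪ N / K.
-- The points of class k are lattice points (L q + p , q) in a box of volume about V = N b ^ (- s).  Divide this
-- box into b ^ d congruent subboxes, d = m + n, and each of these again, and so on, sides of q-coordinates
-- shrinking only down to length 1.  A subbox of volume below K contains at most one point, since the difference
-- of two points has coordinates whose product is at least K.
-- - If at every stage every box has an empty subbox, each stage gains a factor 1 - b ^ (- d), whence there are
--   ≪ (V / K) (1 - 1 / β) ^ u points with u ≈ log (V / K).
-- - If all subboxes of some box are hit, differences of points of opposite subboxes point into every orthant, so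
--   that every vector is within the size of the box of a lattice vector.  The orbit L q mod 1 then meets every
--   translate of the box, all translates hold about as many points as the box itself, and comparing with the
--   total number N of points shows that the box holds ≪ V of them.
-- Multiplying by b ^ s and summing over the ≪ (log (N / K)) ^ m classes gives N (log (N / K)) ^ m from the second
-- case.  In the first case the sum over k₁ is geometric and leaves (N / K) (log (N / K)) ^ (m - 1).
-- All of this is done for a rational matrix, an entrywise approximation of L, with integers over a common
-- denominator; finitely many inequalities between reals survive, up to a factor 2, a good enough approximation.

import Algebra.Bundles
import Algebra.Definitions.RawSemiring as RawSemiringOps
import Algebra.Properties.CommutativeSemigroup
import Algebra.Properties.Group
open import Data.Empty using (⊥)
open import Data.Fin.Base using (Fin; zero; suc; _↑ˡ_; _↑ʳ_; splitAt)
import Data.Fin.Properties as Fin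
open import Data.Integer.Base as ℤ using (ℤ; +_; -[1+_])
import Data.Integer.Properties as ℤ
open import Data.Integer.Solver using () renaming (module +-*-Solver to ℤ-Solver)
open import Data.List.Base as List using (List; []; _∷_)
open import Data.List.Membership.Propositional using (_∈_)
import Data.List.Membership.Propositional.Properties as ∈
import Data.List.Properties as List
open import Data.List.Relation.Unary.All as All using (All; []; _∷_)
import Data.List.Relation.Unary.All.Properties as All
open import Data.List.Relation.Unary.AllPairs as AllPairs using (AllPairs; []; _∷_)
import Data.List.Relation.Unary.AllPairs.Properties as AllPairs
open import Data.List.Relation.Unary.Any as Any using (here; there)
open import Data.List.Relation.Unary.Unique.Propositional using (Unique)
import Data.List.Relation.Unary.Unique.Propositional.Properties as Unique
open import Data.Nat.Base as ℕ using (ℕ; zero; suc; NonZero; _∸_)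
import Data.Nat.ListAction.Properties as ListAction
import Data.Nat.Properties as ℕ
open import Data.Nat.Solver using () renaming (module +-*-Solver to ℕ-Solver)
open import Data.Product.Base using (∃-syntax; _×_; _,_; proj₁; proj₂)
open import Data.Rational.Base as ℚ using (ℚ; 0ℚ; 1ℚ; ½)
import Data.Rational.Properties as ℚ
open import Data.Rational.Solver using () renaming (module +-*-Solver to ℚ-Solver)
open import Data.Sum.Base as Sum using (_⊎_; inj₁; inj₂; [_,_]′)
open import Data.Vec.Base as Vec using (Vec; []; _∷_)
import Data.Vec.Properties as Vec
open import Function.Base using (_∘_; const; id)
open import Relation.Binary.Definitions using (DecidableEquality; tri<; tri≈; tri>)
open import Relation.Binary.PropositionalEquality
open import Relation.Nullary using (yes; no; ¬?; contradiction)

-- The second term loses only m - 1 logarithms because of the factor (1 - 1 / β) ^ u: a plain bound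
-- ≪ V / K would give N / K for each of the ≪ (log (N / K)) ^ m classes. With the factor, the
-- contributions decay geometrically as s decreases, and a whole line of classes costs as much as
-- one. No basis and no successive minima of the lattice are needed: a stage either has an empty
-- subbox, which is the gain, or has none, which forces the lattice to be dense at the scale of the
-- box. Whether a subbox is empty is undecidable for real coordinates, but the proof branches on it
-- at every stage; this is why all counting is done with integers. After multiplication by a common
-- denominator `Q`, the K above corresponds to `Q ^ m` divided by `D`, with `D` of the size of 1 / φ
-- (T̄). The base b is finally 5. From 3 on, two points in opposite extreme subboxes differ by more
-- than the side of a subbox; from 5 on, the spacing of a grid exceeds the errors of two perturbed
-- grid points, and sums of translated points fit below the next power of b.

module Counting where
  open import Data.Integer.Base using (∣_∣)
  open import Data.List.Base using (_++_; length; map; filter; upTo; applyUpTo; cartesianProduct; cartesianProductWith)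
  open import Data.Nat.Base
  open import Data.Nat.DivMod
  open import Data.Nat.ListAction using (sum)
  open import Data.Nat.Properties
  open Algebra.Properties.CommutativeSemigroup +-commutativeSemigroup using () renaming (interchange to +-interchange)
  open Algebra.Properties.Group (Algebra.Bundles.AbelianGroup.group ℤ.+-0-abelianGroup) using ()
    renaming (∙-cancelˡ to +ℤ-cancelˡ)
  open RawSemiringOps +-*-rawSemiring using () renaming (product to ∏; sum to ∑) public
  open RawSemiringOps ℤ.+-*-rawSemiring using () renaming (sum to ∑ℤ) public

  -- Sums over lists, fibres of a key, boxes of vectors

  ∑ₗ : ∀ {I : Set} → List I → (I → ℕ) → ℕ
  ∑ₗ xs f = sum (map f xs)

  ∑ₗ-mono : ∀ {I : Set} {f g : I → ℕ} (xs : List I) → (∀ {x} → x ∈ xs → f x ≤ g x) → ∑ₗ xs f ≤ ∑ₗ xs g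
  ∑ₗ-mono []       h = z≤n
  ∑ₗ-mono (x ∷ xs) h = +-mono-≤ (h (here refl)) (∑ₗ-mono xs (h ∘ there))

  ∑ₗ-const : ∀ {I : Set} (xs : List I) c → ∑ₗ xs (const c) ≡ length xs * c
  ∑ₗ-const []       c = refl
  ∑ₗ-const (x ∷ xs) c = cong (λ s → c + s) (∑ₗ-const xs c)

  ∑ₗ-+ : ∀ {I : Set} (f g : I → ℕ) (xs : List I) → ∑ₗ xs (λ x → f x + g x) ≡ ∑ₗ xs f + ∑ₗ xs g
  ∑ₗ-+ f g []       = refl
  ∑ₗ-+ f g (x ∷ xs) = trans (cong (λ s → f x + g x + s) (∑ₗ-+ f g xs))
    (+-interchange (f x) (g x) (∑ₗ xs f) (∑ₗ xs g))

  ∑ₗ-*ʳ : ∀ {I : Set} (f : I → ℕ) c (xs : List I) → ∑ₗ xs (λ x → f x * c) ≡ ∑ₗ xs f * c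
  ∑ₗ-*ʳ f c []       = refl
  ∑ₗ-*ʳ f c (x ∷ xs) = trans (cong (λ s → f x * c + s) (∑ₗ-*ʳ f c xs)) (sym (*-distribʳ-+ c (f x) _))

  module _ {I K : Set} (_≟_ : DecidableEquality K) (key : I → K) where

    fibre : K → List I → List I
    fibre k = filter (λ x → key x ≟ k)

    private
      fibre-∷ : ∀ k x xs → length (fibre k xs) ≤ length (fibre k (x ∷ xs))
      fibre-∷ k x xs with key x ≟ k
      ... | yes _ = n≤1+n _
      ... | no  _ = ≤-refl

      fibre-here : ∀ x xs → length (fibre (key x) (x ∷ xs)) ≡ suc (length (fibre (key x) xs))
      fibre-here x xs = cong length (List.filter-accept (λ y → key y ≟ key x) refl)

      insert : ∀ (F : K → ℕ) x xs {ks} → key x ∈ ks →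
        F (key x) + ∑ₗ ks (λ k → length (fibre k xs) * F k) ≤ ∑ₗ ks (λ k → length (fibre k (x ∷ xs)) * F k)
      insert F x xs {k ∷ ks} (here refl) = begin
        F k + (length (fibre k xs) * F k + rest xs) ≡⟨ +-assoc (F k) _ _ ⟨
        suc (length (fibre k xs)) * F k + rest xs   ≤⟨ +-mono-≤ (≤-reflexive (cong (_* F k) (sym (fibre-here x xs))))
          (∑ₗ-mono ks λ {k′} _ → *-monoˡ-≤ (F k′) (fibre-∷ k′ x xs)) ⟩
        length (fibre k (x ∷ xs)) * F k + rest (x ∷ xs) ∎
        where
        open ≤-Reasoning
        rest : List I → ℕ
        rest ys = ∑ₗ ks (λ k → length (fibre k ys) * F k)
      insert F x xs {k ∷ ks} (there x∈ks) = begin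
        F (key x) + (length (fibre k xs) * F k + rest xs) ≡⟨ +-assoc (F (key x)) _ _ ⟨
        F (key x) + length (fibre k xs) * F k + rest xs   ≡⟨ cong (_+ rest xs) (+-comm (F (key x)) _) ⟩
        length (fibre k xs) * F k + F (key x) + rest xs   ≡⟨ +-assoc (length (fibre k xs) * F k) _ _ ⟩
        length (fibre k xs) * F k + (F (key x) + rest xs)
          ≤⟨ +-mono-≤ (*-monoˡ-≤ (F k) (fibre-∷ k x xs)) (insert F x xs x∈ks) ⟩
        length (fibre k (x ∷ xs)) * F k + rest (x ∷ xs) ∎
        where
        open ≤-Reasoning
        rest : List I → ℕ
        rest ys = ∑ₗ ks (λ k → length (fibre k ys) * F k)

    -- Only an inequality, since `ks` may repeat keys.
    ∑ₗ-fibres : ∀ (F : K → ℕ) ks xs → (∀ {x} → x ∈ xs → key x ∈ ks) →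
                ∑ₗ xs (F ∘ key) ≤ ∑ₗ ks (λ k → length (fibre k xs) * F k)
    ∑ₗ-fibres F ks []       h = z≤n
    ∑ₗ-fibres F ks (x ∷ xs) h =
      ≤-trans (+-monoʳ-≤ (F (key x)) (∑ₗ-fibres F ks xs (h ∘ there))) (insert F x xs (h (here refl)))

    length-fibres : ∀ ks xs c {B} → (∀ {x} → x ∈ xs → key x ∈ ks) →
                    (∀ {k} → k ∈ ks → length (fibre k xs) * c ≤ B) → length xs * c ≤ length ks * B
    length-fibres ks xs c {B} h bound = subst₂ _≤_ (∑ₗ-const xs c) (∑ₗ-const ks B)
      (≤-trans (∑ₗ-fibres (const c) ks xs h) (∑ₗ-mono ks bound))

    -- Deleting `k₀` from `ks` loses no element of `xs` and shortens the list of keys. The saved key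
    -- is the gain of a stage with an empty subbox.
    length-fibres-∅ : ∀ ks xs c {B k₀} → (∀ {x} → x ∈ xs → key x ∈ ks) → k₀ ∈ ks → fibre k₀ xs ≡ [] →
                      (∀ {k} → k ∈ ks → length (fibre k xs) * c ≤ B) →
                      length xs * c ≤ (length ks ∸ 1) * B
    length-fibres-∅ ks xs c {B} {k₀} h k₀∈ks empty bound = ≤-trans
      (length-fibres ks′ xs c keys (λ k∈ → bound (proj₁ (∈.∈-filter⁻ ≢k₀? k∈))))
      (*-monoˡ-≤ B (pred-mono-≤ (List.filter-notAll ≢k₀? ks (Any.map (λ { refl k≢k → k≢k refl }) k₀∈ks))))
      where
      ≢k₀? = λ k → ¬? (k ≟ k₀)
      ks′ = filter ≢k₀? ks
      keys : ∀ {x} → x ∈ xs → key x ∈ ks′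
      keys {x} x∈xs = ∈.∈-filter⁺ ≢k₀? (h x∈xs) λ eq → nothing (∈.∈-filter⁺ (λ y → key y ≟ k₀) x∈xs eq)
        where
        nothing : x ∈ fibre k₀ xs → ⊥
        nothing x∈fibre with () ← subst (x ∈_) empty x∈fibre

    pigeonhole : ∀ ks {xs} → AllPairs (λ x y → key x ≢ key y) xs → (∀ {x} → x ∈ xs → key x ∈ ks) →
                 length xs ≤ length ks
    pigeonhole ks {xs} distinct h = subst₂ _≤_ (*-identityʳ _) (*-identityʳ _)
      (length-fibres ks xs 1 h λ {k} _ → ≤-trans (≤-reflexive (*-identityʳ _))
        (atMostOne (fibre k xs) (All.all-filter (λ x → key x ≟ k) xs)
          (AllPairs.filter⁺ (λ x → key x ≟ k) distinct)))
      where
      atMostOne : ∀ {k} ys → All (λ x → key x ≡ k) ys → AllPairs (λ x y → key x ≢ key y) ys → length ys ≤ 1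
      atMostOne []           _              _               = z≤n
      atMostOne (_ ∷ [])     _              _               = ≤-refl
      atMostOne (_ ∷ _ ∷ _) (eq ∷ eq′ ∷ _) ((neq ∷ _) ∷ _) = contradiction (trans eq (sym eq′)) neq

  -- The head varies fastest, so that `∑ₗ-cartesianProductWith-≤` bounds a sum over the box by one
  -- line in the first coordinate at a time.
  box : ∀ {d} → (Fin d → ℕ) → List (Vec ℕ d)
  box {zero}  α = [] ∷ []
  box {suc d} α = cartesianProductWith (λ v x → x ∷ v) (box (α ∘ suc)) (upTo (α zero))

  ∈-box⁺ : ∀ {d} (α : Fin d → ℕ) v → (∀ j → Vec.lookup v j < α j) → v ∈ box α
  ∈-box⁺ α []      h = here refl
  ∈-box⁺ α (x ∷ v) h =
    ∈.∈-cartesianProductWith⁺ (λ v x → x ∷ v) (∈-box⁺ (α ∘ suc) v (h ∘ suc)) (∈.∈-upTo⁺ (h zero))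

  ∈-box⁻ : ∀ {d} (α : Fin d → ℕ) {v} → v ∈ box α → ∀ j → Vec.lookup v j < α j
  ∈-box⁻ {suc d} α v∈ j
    with ∈.∈-cartesianProductWith⁻ (λ v x → x ∷ v) (box (α ∘ suc)) (upTo (α zero)) v∈
  ... | v , x , v∈′ , x∈ , refl with j
  ...   | zero  = ∈.∈-upTo⁻ x∈
  ...   | suc i = ∈-box⁻ (α ∘ suc) v∈′ i

  box-unique : ∀ {d} (α : Fin d → ℕ) → Unique (box α)
  box-unique {zero}  α = [] ∷ []
  box-unique {suc d} α = Unique.cartesianProductWith⁺ (λ v x → x ∷ v) (λ { refl → refl , refl })
    (box-unique (α ∘ suc)) (Unique.upTo⁺ (α zero))

  module _ {I J : Set} {K : Set} (f : I → J → K) where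

    ∑ₗ-cartesianProductWith-≤ : ∀ (F : K → ℕ) B xs ys → (∀ x → ∑ₗ ys (F ∘ f x) ≤ B) →
      ∑ₗ (cartesianProductWith f xs ys) F ≤ length xs * B
    ∑ₗ-cartesianProductWith-≤ F B []       ys h = z≤n
    ∑ₗ-cartesianProductWith-≤ F B (x ∷ xs) ys h = begin
      sum (map F (map (f x) ys ++ rest))         ≡⟨ cong sum (List.map-++ F (map (f x) ys) rest) ⟩
      sum (map F (map (f x) ys) ++ map F rest)   ≡⟨ ListAction.sum-++ (map F (map (f x) ys)) (map F rest) ⟩
      sum (map F (map (f x) ys)) + ∑ₗ rest F     ≡⟨ cong (λ l → sum l + ∑ₗ rest F) (List.map-∘ ys) ⟨
      ∑ₗ ys (F ∘ f x) + ∑ₗ rest F                ≤⟨ +-mono-≤ (h x) (∑ₗ-cartesianProductWith-≤ F B xs ys h) ⟩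
      B + length xs * B                          ∎
      where
      open ≤-Reasoning
      rest = cartesianProductWith f xs ys

    length-cartesianProductWith : ∀ xs ys → length (cartesianProductWith f xs ys) ≡ length xs * length ys
    length-cartesianProductWith []       ys = refl
    length-cartesianProductWith (x ∷ xs) ys = trans (List.length-++ (map (f x) ys))
      (cong₂ _+_ (List.length-map (f x) ys) (length-cartesianProductWith xs ys))

  length-box : ∀ {d} (α : Fin d → ℕ) → length (box α) ≡ ∏ α
  length-box {zero}  α = refl
  length-box {suc d} α = begin
    length (box α)                                    ≡⟨ length-cartesianProductWith _ (box (α ∘ suc)) (upTo (α zero)) ⟩
    length (box (α ∘ suc)) * length (upTo (α zero))   ≡⟨ cong₂ _*_ (length-box (α ∘ suc)) (List.length-upTo (α zero)) ⟩
    ∏ (α ∘ suc) * α zero                              ≡⟨ *-comm (∏ (α ∘ suc)) (α zero) ⟩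
    ∏ α                                               ∎
    where open ≡-Reasoning

  ∏-const : ∀ d a → ∏ {d} (const a) ≡ a ^ d
  ∏-const zero    a = refl
  ∏-const (suc d) a = cong (a *_) (∏-const d a)

  ∏-^ : ∀ {d} b (f : Fin d → ℕ) → ∏ (λ j → b ^ f j) ≡ b ^ ∑ f
  ∏-^ {zero}  b f = refl
  ∏-^ {suc d} b f = trans (cong (b ^ f zero *_) (∏-^ b (f ∘ suc))) (sym (^-distribˡ-+-* b (f zero) (∑ (f ∘ suc))))

  ∏-mono : ∀ {d} {f g : Fin d → ℕ} → (∀ j → f j ≤ g j) → ∏ f ≤ ∏ g
  ∏-mono {zero}  h = ≤-refl
  ∏-mono {suc d} h = *-mono-≤ (h zero) (∏-mono (h ∘ suc))

  ∑-mono : ∀ {d} {f g : Fin d → ℕ} → (∀ j → f j ≤ g j) → ∑ f ≤ ∑ g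
  ∑-mono {zero}  h = ≤-refl
  ∑-mono {suc d} h = +-mono-≤ (h zero) (∑-mono (h ∘ suc))

  -- On a line in the first coordinate `H` runs through consecutive arguments, shifted by the sum
  -- `c` of the other coordinates. For geometric weights such a line costs a constant instead of a
  -- factor `a`: this is the saved logarithm.
  ∑ₗ-cube-≤ : ∀ {m m′} → m ≡ suc m′ → ∀ a B (H : ℕ → ℕ) → (∀ c → ∑ₗ (upTo a) (λ k → H (k + c)) ≤ B) →
              ∑ₗ (box {m} (const a)) (H ∘ Vec.sum) ≤ a ^ m′ * B
  ∑ₗ-cube-≤ {m′ = m′} refl a B H h = ≤-trans
    (∑ₗ-cartesianProductWith-≤ _ (H ∘ Vec.sum) B (box {m′} (const a)) (upTo a) (h ∘ Vec.sum))
    (≤-reflexive (cong (_* B) (trans (length-box {m′} (const a)) (∏-const m′ a))))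

  ∣+-+∣≤ : ∀ p q {B} → p ≤ q + B → q ≤ p + B → ∣ + p ℤ.- + q ∣ ≤ B
  ∣+-+∣≤ p q {B} h h′ with ≤-total p q
  ... | inj₁ p≤q = subst (_≤ B) (sym (trans (cong ∣_∣ (ℤ.m-n≡m⊖n p q)) (ℤ.∣⊖∣-≤ p≤q))) (m≤n+o⇒m∸n≤o q p h′)
  ... | inj₂ q≤p = subst (_≤ B) (sym (trans (cong ∣_∣ (trans (ℤ.m-n≡m⊖n p q) (ℤ.⊖-≥ q≤p))) refl)) (m≤n+o⇒m∸n≤o p q h)

  term≤∑ : ∀ {d} (f : Fin d → ℕ) j → f j ≤ ∑ f
  term≤∑ f zero    = m≤m+n (f zero) _
  term≤∑ f (suc j) = ≤-trans (term≤∑ (f ∘ suc) j) (m≤n+m _ (f zero))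

  -- Bernoulli's inequality 1 - v / B ≤ (1 - 1 / B) ^ v with B = `suc β`, cleared of denominators;
  -- for v > B truncated subtraction makes it trivial.
  bernoulli : ∀ β v → suc β ^ v * (suc β ∸ v) ≤ suc β * β ^ v
  bernoulli β zero    = ≤-reflexive (*-comm 1 (suc β))
  bernoulli β (suc v) = begin
    suc β * suc β ^ v * (β ∸ v)       ≡⟨ solve 3 (λ a p t → a :* p :* t := p :* (a :* t)) refl (suc β) (suc β ^ v) (β ∸ v) ⟩
    suc β ^ v * (suc β * (β ∸ v))     ≤⟨ *-monoʳ-≤ (suc β ^ v) step ⟩
    suc β ^ v * (β * (suc β ∸ v))     ≡⟨ solve 3 (λ a p t → p :* (a :* t) := a :* (p :* t)) refl β (suc β ^ v) (suc β ∸ v) ⟩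
    β * (suc β ^ v * (suc β ∸ v))     ≤⟨ *-monoʳ-≤ β (bernoulli β v) ⟩
    β * (suc β * β ^ v)               ≡⟨ solve 3 (λ a c p → a :* (c :* p) := c :* (a :* p)) refl β (suc β) (β ^ v) ⟩
    suc β * β ^ suc v                 ∎
    where
    open ≤-Reasoning
    open ℕ-Solver
    step : suc β * (β ∸ v) ≤ β * (suc β ∸ v)
    step with v ≤? β
    ... | yes v≤β = begin
      (β ∸ v) + β * (β ∸ v)   ≤⟨ +-monoˡ-≤ (β * (β ∸ v)) (m∸n≤m β v) ⟩
      β + β * (β ∸ v)         ≡⟨ *-suc β (β ∸ v) ⟨
      β * suc (β ∸ v)         ≡⟨ cong (β *_) (+-∸-assoc 1 v≤β) ⟨
      β * (suc β ∸ v)         ∎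
    ... | no v≰β = ≤-trans (≤-reflexive (trans (cong (suc β *_) (m≤n⇒m∸n≡0 (≰⇒≥ v≰β))) (*-zeroʳ β))) z≤n

  ^-distribʳ-* : ∀ u m n → (m * n) ^ u ≡ m ^ u * n ^ u
  ^-distribʳ-* zero    m n = refl
  ^-distribʳ-* (suc u) m n = trans (cong (m * n *_) (^-distribʳ-* u m n))
    (solve 4 (λ m n p q → m :* n :* (p :* q) := m :* p :* (n :* q)) refl m n (m ^ u) (n ^ u))
    where open ℕ-Solver

  module _ {K : Set} {P : K → Set} {X : Set} where

    collect : ∀ ks → (∀ {k} → k ∈ ks → X ⊎ P k) → X ⊎ (∀ {k} → k ∈ ks → P k)
    collect []       f = inj₂ λ ()
    collect (k ∷ ks) f with f (here refl) | collect ks (f ∘ there)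
    ... | inj₁ x | _       = inj₁ x
    ... | inj₂ p | inj₁ x  = inj₁ x
    ... | inj₂ p | inj₂ ps = inj₂ λ { (here refl) → p ; (there k∈) → ps k∈ }

  -- Dichotomy for a subdivided cell: few points, or a lattice dense at the scale of the cell

  Cell : ∀ {d} {I : Set} → ℕ → (I → Fin d → ℤ) → (Fin d → ℤ) → (Fin d → ℕ) → I → Set
  Cell b X c e a = ∀ j → ∃[ x ] (X a j ≡ c j ℤ.+ + x × x < b ^ e j)

  -- `K` / `D` bounds from below the volume of a cell with two points. `Z` marks the coordinates in
  -- which the two points must differ, so that the cell has a side longer than 1 there; this ends
  -- the repeated division.
  Separated : ∀ {d} {I : Set} → ℕ → (I → Fin d → ℤ) → (Fin d → Set) → ℕ → ℕ → I → I → Set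
  Separated {d} b X Z K D a a′ = ∀ (e : Fin d → ℕ) → (∀ j → ∣ X a j ℤ.- X a′ j ∣ < b ^ e j) →
                                 K ≤ D * b ^ ∑ e × (∀ j → Z j → 0 < e j)

  -- The tolerance b * b ^ (e j ∸ 1) is b ^ e j, except that it is b when e j = 0.
  Dense : ∀ {d} → ℕ → ((Fin d → ℤ) → Set) → (Fin d → Set) → (Fin d → ℕ) → Set
  Dense {d} b G Z e = ∀ (y : Fin d → ℤ) → (∀ j → Z j ⊎ y j ≡ + 0) →
                      ∃[ v ] (G v × (∀ j → ∣ y j ℤ.- v j ∣ ≤ b * b ^ (e j ∸ 1)))

  -- M ≤ b ^ d (V / K) (1 - 1 / β) ^ u whenever b ^ u ≤ b ^ d (V / K), where V = D b ^ s and β = 1 + β′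
  Bounded : (b d β′ K D s M : ℕ) → Set
  Bounded b d β′ K D s M = ∀ u → K * b ^ u ≤ D * b ^ s * b ^ d →
    M * (K * suc β′ ^ u) ≤ D * b ^ s * b ^ d * β′ ^ u

  module Dichotomy (b d : ℕ) (3≤b : 3 ≤ b) {I : Set} (X : I → Fin d → ℤ)
    (G : (Fin d → ℤ) → Set) (G-0 : G (const (+ 0)))
    (G-+ : ∀ {v w} → G v → G w → G (λ j → v j ℤ.+ w j))
    (G-X : ∀ a a′ → G (λ j → X a j ℤ.- X a′ j))
    (Z : Fin d → Set) (z₀ : Fin d) (Z-z₀ : Z z₀) (K D : ℕ) where

    private instance
      b≢0 : NonZero b
      b≢0 = >-nonZero (≤-trans (s≤s z≤n) 3≤b)

    private
      -- One stage has at most b ^ d subcells and lowers `u` by at most `d`. One empty subcell pays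
      -- for this as soon as d / β ≤ b ^ (- d).
      β′ : ℕ
      β′ = d * b ^ d

      Dense-mono : ∀ {e e′} → (∀ j → e′ j ≤ e j) → Dense b G Z e′ → Dense b G Z e
      Dense-mono e′≤e dense y y≡0 = let v , v∈G , close = dense y y≡0 in
        v , v∈G , λ j → ≤-trans (close j) (*-monoʳ-≤ b (^-monoʳ-≤ b (∸-monoˡ-≤ 1 (e′≤e j))))

    private
      difference : ∀ c x x′ → (c ℤ.+ + x) ℤ.- (c ℤ.+ + x′) ≡ + x ℤ.- + x′
      difference c x x′ = solve 3 (λ c x x′ → (c :+ x) :- (c :+ x′) := x :- x′) refl c (+ x) (+ x′)
        where open ℤ-Solver

      same-cell : ∀ {c e a a′} → Cell b X c e a → Cell b X c e a′ → ∀ j → ∣ X a j ℤ.- X a′ j ∣ < b ^ e j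
      same-cell {c} {e} {a} {a′} h h′ j with h j | h′ j
      ... | x , eq , x< | x′ , eq′ , x′< = subst (λ n → suc n ≤ b ^ e j) (sym abs)
        (m<n⇒m≤1+n′ (∣+-+∣≤ x x′ (bound x<) (bound x′<)))
        where
        abs : ∣ X a j ℤ.- X a′ j ∣ ≡ ∣ + x ℤ.- + x′ ∣
        abs = cong ∣_∣ (trans (cong₂ ℤ._-_ eq eq′) (difference (c j) x x′))
        bound : ∀ {x y} → x < b ^ e j → x ≤ y + (b ^ e j ∸ 1)
        bound {x} {y} x< = ≤-trans (pred-mono-≤ x<) (m≤n+m (b ^ e j ∸ 1) y)
        m<n⇒m≤1+n′ : ∀ {n} → n ≤ b ^ e j ∸ 1 → suc n ≤ b ^ e j
        m<n⇒m≤1+n′ n≤ = ≤-trans (s≤s n≤) (≤-reflexive (m+[n∸m]≡n (m^n>0 b (e j))))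

    -- Coordinates with e j = 0 are not divided, the others into b parts.
    module Subdivision (c : Fin d → ℤ) (e : Fin d → ℕ) where

      e⁻ : Fin d → ℕ
      e⁻ j = e j ∸ 1

      private instance
        u≢0 : ∀ {j} → NonZero (b ^ e⁻ j)
        u≢0 {j} = m^n≢0 b (e⁻ j)

      width : Fin d → ℕ
      width j = e j ∸ e⁻ j

      digits : Fin d → ℕ
      digits j = b ^ width j

      -- For points of the cell the absolute value is the offset from the corner.
      digit : I → Fin d → ℕ
      digit a j = ∣ X a j ℤ.- c j ∣ / b ^ e⁻ j

      key : I → Vec ℕ d
      key a = Vec.tabulate (digit a)

      corner : Vec ℕ d → Fin d → ℤ
      corner k j = c j ℤ.+ + (Vec.lookup k j * b ^ e⁻ j)

      width-+ : ∀ j → width j + e⁻ j ≡ e j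
      width-+ j = m∸n+n≡m (m∸n≤m (e j) 1)

      width≤1 : ∀ j → width j ≤ 1
      width≤1 j with e j
      ... | zero  = z≤n
      ... | suc i = ≤-reflexive (m+n∸n≡m 1 i)

      ∑-width : ∑ width + ∑ e⁻ ≡ ∑ e
      ∑-width = go width e⁻ e width-+
        where
        go : ∀ {d} (f g h : Fin d → ℕ) → (∀ j → f j + g j ≡ h j) → ∑ f + ∑ g ≡ ∑ h
        go {zero}  f g h eq = refl
        go {suc d} f g h eq = trans (+-interchange (f zero) (∑ (f ∘ suc)) (g zero) (∑ (g ∘ suc)))
          (cong₂ _+_ (eq zero) (go (f ∘ suc) (g ∘ suc) (h ∘ suc) (eq ∘ suc)))

      A : ℕ
      A = length (box digits)

      A≡ : A ≡ b ^ ∑ width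
      A≡ = trans (length-box digits) (∏-^ b width)

      A-volume : b ^ ∑ e ≡ A * b ^ ∑ e⁻
      A-volume = trans (cong (b ^_) (sym ∑-width))
        (trans (^-distribˡ-+-* b (∑ width) (∑ e⁻)) (cong (_* b ^ ∑ e⁻) (sym A≡)))

      A≤ : A ≤ b ^ d
      A≤ = subst₂ _≤_ (sym (length-box digits)) (∏-const d b)
        (∏-mono {d} {digits} {const b} λ j → ≤-trans (^-monoʳ-≤ b (width≤1 j)) (≤-reflexive (*-identityʳ b)))

      offset : ∀ {a} → Cell b X c e a → ∀ j → ∃[ x ] (X a j ≡ c j ℤ.+ + x × x < b ^ e j × digit a j ≡ x / b ^ e⁻ j)
      offset {a} h j = let x , eq , x< = h j in x , eq , x< ,
        cong (λ v → ∣ v ∣ / b ^ e⁻ j) (trans (cong (ℤ._- c j) eq)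
          (solve 2 (λ c x → (c :+ x) :- c := x) refl (c j) (+ x)))
        where open ℤ-Solver

      key∈ : ∀ {a} → Cell b X c e a → key a ∈ box digits
      key∈ {a} h = ∈-box⁺ digits (key a) λ j → subst (_< digits j) (sym (Vec.lookup∘tabulate (digit a) j)) (bound j)
        where
        bound : ∀ j → digit a j < digits j
        bound j with offset h j
        ... | x , _ , x< , eq = subst (_< digits j) (sym eq) (m<n*o⇒m/o<n
          (subst (x <_) (trans (cong (b ^_) (sym (width-+ j))) (^-distribˡ-+-* b (width j) (e⁻ j))) x<))

      subcell : ∀ {a} → Cell b X c e a → Cell b X (corner (key a)) e⁻ a
      subcell {a} h j with offset h j
      ... | x , eq , x< , digit≡ = x % b ^ e⁻ j , trans eq (trans
          (cong (λ n → c j ℤ.+ + n) (trans (m≡m%n+[m/n]*n x (b ^ e⁻ j)) (+-comm (x % b ^ e⁻ j) _)))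
          (trans (cong (λ n → c j ℤ.+ (+ n ℤ.+ + (x % b ^ e⁻ j))) (cong (_* b ^ e⁻ j)
            (sym (trans (Vec.lookup∘tabulate (digit a) j) digit≡))))
          (sym (ℤ.+-assoc (c j) (+ (Vec.lookup (key a) j * b ^ e⁻ j)) (+ (x % b ^ e⁻ j))))))
        , m%n<n x (b ^ e⁻ j)

      -- When every subcell is hit, y moves towards 0 on subtracting the difference of a point in an extreme
      -- subcell and a point in the opposite one, chosen by the signs of the coordinates of y.
      module _ (hit : ∀ {k} → k ∈ box digits → ∃[ a ] (Cell b X c e a × key a ≡ k)) where

        private
          -- The last part where `y` is positive, the first one elsewhere and on undivided sides.
          -- The digits for y and for - y describe opposite subcells, so that their points differ in
          -- the direction of y.
          top : ℕ → ℤ → ℕ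
          top (suc _) (+ suc _) = b ∸ 1
          top _       _         = 0

          top< : ∀ n y → top n y < b ^ (n ∸ (n ∸ 1))
          top< zero    y         = ≤-refl
          top< (suc n) (+ suc _) = subst (b ∸ 1 <_)
            (sym (trans (cong (b ^_) (m+n∸n≡m 1 n)) (*-identityʳ b)))
            (≤-reflexive (m+[n∸m]≡n {1} {b} (≤-trans (s≤s z≤n) 3≤b)))
          top< (suc n) (+ zero)  = m^n>0 b (suc n ∸ n)
          top< (suc n) -[1+ _ ]  = m^n>0 b (suc n ∸ n)

          corner-point : ∀ (y : Fin d → ℤ) → ∃[ a ] (∀ j → ∃[ x ] (X a j ≡ c j ℤ.+ + x ×
            top (e j) (y j) * b ^ e⁻ j ≤ x × x < suc (top (e j) (y j)) * b ^ e⁻ j × x < b ^ e j))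
          corner-point y with hit (∈-box⁺ digits k λ j →
              subst (_< digits j) (sym (Vec.lookup∘tabulate t j)) (top< (e j) (y j)))
            where
            t = λ j → top (e j) (y j)
            k = Vec.tabulate t
          ... | a , cell , key≡ = a , λ j → point j (offset cell j)
            where
            digit≡ : ∀ j → digit a j ≡ top (e j) (y j)
            digit≡ j = trans (sym (Vec.lookup∘tabulate (digit a) j))
              (trans (cong (λ k → Vec.lookup k j) key≡) (Vec.lookup∘tabulate (λ j → top (e j) (y j)) j))
            point : ∀ j → ∃[ x ] (X a j ≡ c j ℤ.+ + x × x < b ^ e j × digit a j ≡ x / b ^ e⁻ j) → _
            point j (x , eq , x< , x/≡) = x , eq ,
              subst (λ t → t * b ^ e⁻ j ≤ x) t≡ (m/n*n≤m x (b ^ e⁻ j)) ,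
              subst (λ t → x < suc t * b ^ e⁻ j) t≡
                (subst (_< suc (x / b ^ e⁻ j) * b ^ e⁻ j) (sym (m≡m%n+[m/n]*n x (b ^ e⁻ j)))
                  (+-monoˡ-< (x / b ^ e⁻ j * b ^ e⁻ j) (m%n<n x (b ^ e⁻ j)))) , x<
              where
              t≡ : x / b ^ e⁻ j ≡ top (e j) (y j)
              t≡ = trans (sym x/≡) (digit≡ j)

          -- For y > 0 the points lie in the last and in the first part, so their difference is
          -- between (b - 2) u and b u, where b - 2 ≥ 1. Subtracting it takes y from at most (b + H
          -- + 1) u to at most (b + H) u, and not below - b u. Negative y is symmetric; for y = 0
          -- both points lie in the first part.
          shift : ∀ {H} n y x⁺ x⁻ → let u = b ^ (n ∸ 1) ; t⁺ = top n y ; t⁻ = top n (ℤ.- y) in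
            (n ≡ 0 → y ≡ + 0) → ∣ y ∣ ≤ suc (b + H) * u →
            t⁺ * u ≤ x⁺ → x⁺ < suc t⁺ * u → x⁺ < b ^ n →
            t⁻ * u ≤ x⁻ → x⁻ < suc t⁻ * u → x⁻ < b ^ n →
            ∣ y ℤ.- (+ x⁺ ℤ.- + x⁻) ∣ ≤ (b + H) * u
          shift {H} n y x⁺ x⁻ inactive y≤ x⁺≥ x⁺<t x⁺< x⁻≥ x⁻<t x⁻< = go n y inactive y≤ x⁺≥ x⁺<t x⁻≥ x⁻<t
            where
            b′ : suc (b ∸ 1) ≡ b
            b′ = m+[n∸m]≡n {1} {b} (≤-trans (s≤s z≤n) 3≤b)
            b≤ : ∀ u → b * u ≤ (b + H) * u
            b≤ u = *-monoˡ-≤ u (m≤m+n b H)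
            u≤ : ∀ u → 1 * u ≤ (b + H) * u
            u≤ u = *-monoˡ-≤ u (≤-trans (≤-trans (s≤s z≤n) 3≤b) (m≤m+n b H))
            far : ∀ p q r u → p ≤ suc (b + H) * u → q < 1 * u → (b ∸ 1) * u ≤ r → r < suc (b ∸ 1) * u →
                  ∣ + (p + q) ℤ.- + r ∣ ≤ (b + H) * u
            far p q r u p≤ q< r≥ r< = ∣+-+∣≤ (p + q) r
              (begin
                p + q                              ≤⟨ +-mono-≤ p≤ (<⇒≤ q<) ⟩
                suc (b + H) * u + 1 * u            ≡⟨ solve 2 (λ B u → (con 1 :+ B) :* u :+ con 1 :* u := con 2 :* u :+ B :* u) refl (b + H) u ⟩
                2 * u + (b + H) * u                ≤⟨ +-monoˡ-≤ ((b + H) * u) (≤-trans (*-monoˡ-≤ u (∸-monoˡ-≤ {3} {b} 1 3≤b)) r≥) ⟩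
                r + (b + H) * u                    ∎)
              (begin
                r                     ≤⟨ <⇒≤ r< ⟩
                suc (b ∸ 1) * u       ≡⟨ cong (_* u) b′ ⟩
                b * u                 ≤⟨ b≤ u ⟩
                (b + H) * u           ≤⟨ m≤n+m _ (p + q) ⟩
                p + q + (b + H) * u   ∎)
              where
              open ≤-Reasoning
              open ℕ-Solver
            still : ∀ u → x⁺ < 1 * u → x⁻ < 1 * u → ∣ + 0 ℤ.- (+ x⁺ ℤ.- + x⁻) ∣ ≤ (b + H) * u
            still u h h′ = subst (_≤ (b + H) * u)
              (cong ∣_∣ (solve 2 (λ p q → q :- p := con (+ 0) :- (p :- q)) refl (+ x⁺) (+ x⁻)))
              (≤-trans (∣+-+∣≤ x⁻ x⁺ (≤-trans (<⇒≤ h′) (m≤n+m (1 * u) x⁺)) (≤-trans (<⇒≤ h) (m≤n+m (1 * u) x⁻))) (u≤ u))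
              where open ℤ-Solver
            go : ∀ n y → let u = b ^ (n ∸ 1) ; t⁺ = top n y ; t⁻ = top n (ℤ.- y) in
              (n ≡ 0 → y ≡ + 0) → ∣ y ∣ ≤ suc (b + H) * u →
              t⁺ * u ≤ x⁺ → x⁺ < suc t⁺ * u → t⁻ * u ≤ x⁻ → x⁻ < suc t⁻ * u →
              ∣ y ℤ.- (+ x⁺ ℤ.- + x⁻) ∣ ≤ (b + H) * u
            go zero y inactive _ _ x⁺< _ x⁻< rewrite inactive refl = still 1 x⁺< x⁻<
            go (suc n) (+ zero)  _ _  _   x⁺< _   x⁻< = still (b ^ n) x⁺< x⁻<
            go (suc n) (+ suc p) _ y≤ x⁺≥ x⁺< _   x⁻< = subst (_≤ (b + H) * b ^ n)
              (cong ∣_∣ (solve 3 (λ y p q → (y :+ q) :- p := y :- (p :- q)) refl (+ suc p) (+ x⁺) (+ x⁻)))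
              (far (suc p) x⁻ x⁺ (b ^ n) y≤ x⁻< x⁺≥ x⁺<)
              where open ℤ-Solver
            go (suc n) -[1+ p ]  _ y≤ _   x⁺< x⁻≥ x⁻< = subst (_≤ (b + H) * b ^ n)
              (trans (sym (ℤ.∣-i∣≡∣i∣ (+ (suc p + x⁺) ℤ.- + x⁻)))
                (cong ∣_∣ (solve 3 (λ y p q → :- ((y :+ p) :- q) := (:- y) :- (p :- q)) refl (+ suc p) (+ x⁺) (+ x⁻))))
              (far (suc p) x⁺ x⁻ (b ^ n) y≤ x⁺< x⁻≥ x⁻<)
              where open ℤ-Solver

        -- `H` counts the remaining steps. One difference of two points lowers the bound in all
        -- coordinates at once, until the tolerance of `Dense` is reached.
        approximate : ∀ H y → (∀ j → e j ≡ 0 → y j ≡ + 0) → (∀ j → ∣ y j ∣ ≤ (b + H) * b ^ e⁻ j) →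
          ∃[ v ] (G v × (∀ j → ∣ y j ℤ.- v j ∣ ≤ b * b ^ e⁻ j))
        approximate zero y _ y≤ = const (+ 0) , G-0 , λ j →
          subst₂ _≤_ (cong ∣_∣ (sym (ℤ.+-identityʳ (y j)))) (cong (_* b ^ e⁻ j) (+-identityʳ b)) (y≤ j)
        approximate (suc H) y y≡0 y≤ = step (corner-point y) (corner-point (λ j → ℤ.- y j))
          where
          step : _ → _ → _
          step (a⁺ , p⁺) (a⁻ , p⁻) =
            let v , v∈G , close = approximate H (λ j → y j ℤ.- w j)
                  (λ j ej≡0 → trans (cong₂ ℤ._-_ (y≡0 j ej≡0) (w≡0 j ej≡0)) refl) smaller
            in (λ j → v j ℤ.+ w j) , G-+ v∈G (G-X a⁺ a⁻) , λ j → subst (_≤ b * b ^ e⁻ j)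
                 (cong ∣_∣ (solve 3 (λ y w v → (y :- w) :- v := y :- (v :+ w)) refl (y j) (w j) (v j))) (close j)
            where
            open ℤ-Solver
            w : Fin d → ℤ
            w j = X a⁺ j ℤ.- X a⁻ j
            w≡ : ∀ j → w j ≡ + proj₁ (p⁺ j) ℤ.- + proj₁ (p⁻ j)
            w≡ j = trans (cong₂ ℤ._-_ (proj₁ (proj₂ (p⁺ j))) (proj₁ (proj₂ (p⁻ j))))
              (difference (c j) (proj₁ (p⁺ j)) (proj₁ (p⁻ j)))
            smaller : ∀ j → ∣ y j ℤ.- w j ∣ ≤ (b + H) * b ^ e⁻ j
            smaller j with p⁺ j | p⁻ j | w≡ j
            ... | x⁺ , _ , x⁺≥ , x⁺<t , x⁺< | x⁻ , _ , x⁻≥ , x⁻<t , x⁻< | eq =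
              subst (λ i → ∣ y j ℤ.- i ∣ ≤ (b + H) * b ^ e⁻ j) (sym eq)
                (shift (e j) (y j) x⁺ x⁻ (y≡0 j)
                  (subst (λ B → ∣ y j ∣ ≤ B * b ^ e⁻ j) (+-suc b H) (y≤ j)) x⁺≥ x⁺<t x⁺< x⁻≥ x⁻<t x⁻<)
            w≡0 : ∀ j → e j ≡ 0 → w j ≡ + 0
            w≡0 j ej≡0 with p⁺ j | p⁻ j | w≡ j
            ... | x⁺ , _ , _ , _ , x⁺< | x⁻ , _ , _ , _ , x⁻< | eq = trans eq
              (cong₂ (λ p q → + p ℤ.- + q) (n<1⇒n≡0 (subst (λ n → x⁺ < b ^ n) ej≡0 x⁺<))
                (n<1⇒n≡0 (subst (λ n → x⁻ < b ^ n) ej≡0 x⁻<)))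

        dense : (∀ j → Z j → 0 < e j) → Dense b G Z e
        dense active y y≡0 = approximate H y
          (λ j ej≡0 → zero-coordinate j ej≡0 (y≡0 j))
          (λ j → ≤-trans (∣y∣≤ j) (≤-trans (m≤n+m H b) (m≤m*n (b + H) (b ^ e⁻ j))))
          where
          -- Enough steps for every coordinate, as all parts have length at least 1.
          H = ∑ (λ j → ∣ y j ∣)
          ∣y∣≤ : ∀ j → ∣ y j ∣ ≤ H
          ∣y∣≤ = term≤∑ (λ j → ∣ y j ∣)
          zero-coordinate : ∀ j → e j ≡ 0 → Z j ⊎ y j ≡ + 0 → y j ≡ + 0
          zero-coordinate j ej≡0 (inj₂ yj≡0) = yj≡0
          zero-coordinate j ej≡0 (inj₁ z)    with () ← subst (0 <_) ej≡0 (active j z)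

    private
      β : ℕ
      β = suc β′

      -- For A > 0: (A - 1) / A ≤ 1 - b ^ (- d) ≤ 1 - v / β ≤ (1 - 1 / β) ^ v, by the choice of
      -- `β′`.
      bernoulli-gain : ∀ A v → A ≤ b ^ d → v ≤ d → (A ∸ 1) * β ^ v ≤ A * β′ ^ v
      bernoulli-gain A v A≤ v≤d = *-cancelˡ-≤ β (begin
        β * ((A ∸ 1) * β ^ v)     ≡⟨ solve 3 (λ x y z → x :* (y :* z) := y :* x :* z) refl β (A ∸ 1) (β ^ v) ⟩
        (A ∸ 1) * β * β ^ v       ≤⟨ *-monoˡ-≤ (β ^ v) loss ⟩
        A * (β ∸ v) * β ^ v       ≡⟨ solve 3 (λ x y z → x :* y :* z := x :* (z :* y)) refl A (β ∸ v) (β ^ v) ⟩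
        A * (β ^ v * (β ∸ v))     ≤⟨ *-monoʳ-≤ A (bernoulli β′ v) ⟩
        A * (β * β′ ^ v)          ≡⟨ solve 3 (λ x y z → x :* (y :* z) := y :* (x :* z)) refl A β (β′ ^ v) ⟩
        β * (A * β′ ^ v)          ∎)
        where
        open ≤-Reasoning
        open ℕ-Solver
        loss : (A ∸ 1) * β ≤ A * (β ∸ v)
        loss = subst₂ _≤_ (sym (*-distribʳ-∸ β A 1)) (sym (*-distribˡ-∸ A β v))
          (∸-monoʳ-≤ (A * β) (begin
            A * v         ≤⟨ *-mono-≤ A≤ v≤d ⟩
            b ^ d * d     ≡⟨ *-comm (b ^ d) d ⟩
            β′            ≤⟨ n≤1+n β′ ⟩
            β             ≡⟨ *-identityˡ β ⟨
            1 * β         ∎))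

    private
      1≤β′ : 1 ≤ β′
      1≤β′ = *-mono-≤ {1} {d} (0<Fin z₀) (m^n>0 b d)
        where
        0<Fin : ∀ {n} → Fin n → 0 < n
        0<Fin zero    = s≤s z≤n
        0<Fin (suc _) = s≤s z≤n

      -- β ≤ b β′ turns the condition on `u` in `Bounded` into the bound for a single point.
      bounded-1 : ∀ (e : Fin d → ℕ) {M} → M ≤ 1 → Bounded b d (d * b ^ d) K D (∑ e) M
      bounded-1 e {M} M≤1 u h = begin
        M * (K * β ^ u)                    ≤⟨ *-monoˡ-≤ (K * β ^ u) M≤1 ⟩
        1 * (K * β ^ u)                    ≡⟨ *-identityˡ (K * β ^ u) ⟩
        K * β ^ u                          ≤⟨ *-monoʳ-≤ K (^-monoˡ-≤ u β≤) ⟩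
        K * (b * β′) ^ u                   ≡⟨ cong (K *_) (^-distribʳ-* u b β′) ⟩
        K * (b ^ u * β′ ^ u)               ≡⟨ *-assoc K (b ^ u) (β′ ^ u) ⟨
        K * b ^ u * β′ ^ u                 ≤⟨ *-monoˡ-≤ (β′ ^ u) h ⟩
        D * b ^ ∑ e * b ^ d * β′ ^ u       ∎
        where
        open ≤-Reasoning
        β≤ : β ≤ b * β′
        β≤ = begin
          1 + β′     ≤⟨ +-monoˡ-≤ β′ 1≤β′ ⟩
          β′ + β′    ≡⟨ cong (λ t → β′ + t) (*-identityˡ β′) ⟨
          2 * β′     ≤⟨ *-monoˡ-≤ β′ (≤-trans (s≤s (s≤s z≤n)) 3≤b) ⟩
          b * β′     ∎

      module Step (c : Fin d → ℤ) (e : Fin d → ℕ) (K≤ : K ≤ D * b ^ ∑ e) (xs : List I)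
                  (cells : ∀ {a} → a ∈ xs → Cell b X c e a) where
        open Subdivision c e
        open ≤-Reasoning
        open ℕ-Solver

        infixr 5 _at_
        _at_ : Vec ℕ d → List I → List I
        k at ys = fibre (Vec.≡-dec _≟_) key k ys

        -- A subcell is smaller by a factor of up to b ^ d, so its bound is used with v = u - d,
        -- truncated at 0. The other w ≤ d powers of 1 - 1 / β are paid by the empty subcell.
        bound-step : ∀ {k₀} → k₀ ∈ box digits → k₀ at xs ≡ [] →
          (∀ {k} → k ∈ box digits → Bounded b d (d * b ^ d) K D (∑ e⁻) (length (k at xs))) → Bounded b d (d * b ^ d) K D (∑ e) (length xs)
        bound-step {k₀} k₀∈ empty bound u h = begin
          length xs * (K * β ^ u)                  ≡⟨ cong (λ w → length xs * (K * β ^ w)) (sym v+w) ⟩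
          length xs * (K * β ^ (v + w))            ≡⟨ cong (λ p → length xs * (K * p)) (^-distribˡ-+-* β v w) ⟩
          length xs * (K * (β ^ v * β ^ w))        ≡⟨ solve 4 (λ l K p q → l :* (K :* (p :* q)) := l :* (K :* p) :* q)
                                                        refl (length xs) K (β ^ v) (β ^ w) ⟩
          length xs * (K * β ^ v) * β ^ w          ≤⟨ *-monoˡ-≤ (β ^ w) (length-fibres-∅ (Vec.≡-dec _≟_) key (box digits) xs (K * β ^ v)
                                                        (λ x∈ → key∈ (cells x∈)) k₀∈ empty (λ k∈ → bound k∈ v h′)) ⟩
          (A ∸ 1) * (V * β′ ^ v) * β ^ w           ≡⟨ solve 4 (λ a V p q → a :* (V :* p) :* q := (a :* q) :* (V :* p))
                                                        refl (A ∸ 1) V (β′ ^ v) (β ^ w) ⟩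
          (A ∸ 1) * β ^ w * (V * β′ ^ v)           ≤⟨ *-monoˡ-≤ (V * β′ ^ v) (bernoulli-gain A w A≤ w≤d) ⟩
          A * β′ ^ w * (V * β′ ^ v)                ≡⟨ solve 6 (λ a q D g B p → a :* q :* (D :* g :* B :* p) := D :* (a :* g) :* B :* (p :* q))
                                                        refl A (β′ ^ w) D (b ^ ∑ e⁻) (b ^ d) (β′ ^ v) ⟩
          D * (A * b ^ ∑ e⁻) * b ^ d * (β′ ^ v * β′ ^ w)
            ≡⟨ cong₂ (λ g p → D * g * b ^ d * p) (sym A-volume) (trans (sym (^-distribˡ-+-* β′ v w)) (cong (β′ ^_) v+w)) ⟩
          D * b ^ ∑ e * b ^ d * β′ ^ u             ∎
          where
          v = u ∸ d
          w = u ∸ v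
          V = D * b ^ ∑ e⁻ * b ^ d
          v+w : v + w ≡ u
          v+w = m+[n∸m]≡n (m∸n≤m u d)
          w≤d : w ≤ d
          w≤d = m≤n+o⇒m∸n≤o u v (≤-trans (m≤n+m∸n u d) (≤-reflexive (+-comm d (u ∸ d))))
          volume≤ : D * b ^ ∑ e ≤ V
          volume≤ = begin
            D * b ^ ∑ e            ≡⟨ cong (D *_) A-volume ⟩
            D * (A * b ^ ∑ e⁻)     ≤⟨ *-monoʳ-≤ D (*-monoˡ-≤ (b ^ ∑ e⁻) A≤) ⟩
            D * (b ^ d * b ^ ∑ e⁻) ≡⟨ solve 3 (λ D B g → D :* (B :* g) := D :* g :* B) refl D (b ^ d) (b ^ ∑ e⁻) ⟩
            V                      ∎
          h′ : K * b ^ v ≤ V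
          h′ with d ≤? u
          ... | yes d≤u = *-cancelʳ-≤ (K * b ^ v) V (b ^ d) {{m^n≢0 b d}} (begin
            K * b ^ v * b ^ d      ≡⟨ *-assoc K (b ^ v) (b ^ d) ⟩
            K * (b ^ v * b ^ d)    ≡⟨ cong (K *_) (^-distribˡ-+-* b v d) ⟨
            K * b ^ (v + d)        ≡⟨ cong (λ w → K * b ^ w) (m∸n+n≡m d≤u) ⟩
            K * b ^ u              ≤⟨ h ⟩
            D * b ^ ∑ e * b ^ d    ≤⟨ *-monoˡ-≤ (b ^ d) volume≤ ⟩
            V * b ^ d              ∎)
          -- Here v = 0, and the premise says that the subcell has volume at least K / D up to b ^
          -- d. The cell itself does, as it contains two points; the factor b ^ d in `Bounded` is
          -- there to absorb this.
          ... | no d≰u = begin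
            K * b ^ v      ≡⟨ cong (λ w → K * b ^ w) (m≤n⇒m∸n≡0 (≰⇒≥ d≰u)) ⟩
            K * 1          ≡⟨ *-identityʳ K ⟩
            K              ≤⟨ ≤-trans K≤ volume≤ ⟩
            V              ∎

        empty-or-hit : ∀ k → (k at xs ≡ []) ⊎ (∃[ a ] (Cell b X c e a × key a ≡ k))
        empty-or-hit k with k at xs in eq
        ... | []    = inj₁ refl
        ... | a ∷ _ = let a∈xs , key≡ = ∈.∈-filter⁻ (λ x → Vec.≡-dec _≟_ (key x) k) {xs = xs} (subst (a ∈_) (sym eq) (here refl))
                      in inj₂ (a , cells a∈xs , key≡)

    -- Induction on a bound `f` for the logarithms of the sides. Two points in a cell keep its side
    -- at `z₀` longer than 1, which excludes f = 0. Density of one subcell passes to the cell. If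
    -- all subcells are bounded instead, the cell is bounded when one of them is empty and dense
    -- when all are hit.
    dichotomy : ∀ f c e xs → (∀ j → e j ≤ f) → AllPairs (Separated b X Z K D) xs → (∀ {a} → a ∈ xs → Cell b X c e a) →
                Dense b G Z e ⊎ Bounded b d (d * b ^ d) K D (∑ e) (length xs)
    dichotomy f c e []       _ _ _ = inj₂ (bounded-1 e z≤n)
    dichotomy f c e (_ ∷ []) _ _ _ = inj₂ (bounded-1 e ≤-refl)
    dichotomy f c e xs@(a ∷ a′ ∷ _) e≤ sep@((sep-aa′ ∷ _) ∷ _) cells
      with sep-aa′ e (same-cell {c} {e} {a} {a′} (cells (here refl)) (cells (there (here refl))))
    ... | K≤ , active = go f e≤
      where
      open Subdivision c e
      open Step c e K≤ xs cells
      go : ∀ f → (∀ j → e j ≤ f) → Dense b G Z e ⊎ Bounded b d (d * b ^ d) K D (∑ e) (length xs)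
      go zero    e≤ with () ← ≤-trans (active z₀ Z-z₀) (e≤ z₀)
      go (suc f) e≤ with collect {P = λ k → Bounded b d (d * b ^ d) K D (∑ e⁻) (length (k at xs))} (box digits) (λ {k} _ → dichotomy f (corner k) e⁻ (k at xs)
           (λ j → ∸-monoˡ-≤ 1 (e≤ j))
           (AllPairs.filter⁺ (λ x → Vec.≡-dec _≟_ (key x) k) sep)
           (λ a∈ → let a∈xs , key≡ = ∈.∈-filter⁻ (λ x → Vec.≡-dec _≟_ (key x) k) {xs = xs} a∈ in
             subst (λ k → Cell b X (corner k) e⁻ _) key≡ (subcell (cells a∈xs))))
      ... | inj₁ dense⁻  = inj₁ (Dense-mono (λ j → m∸n≤m (e j) 1) dense⁻)
      ... | inj₂ bounds with collect {P = λ k → ∃[ a ] (Cell b X c e a × key a ≡ k)}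
                               {X = ∃[ k ] (k ∈ box digits × k at xs ≡ [])} (box digits)
                               (λ {k} k∈ → Sum.map₁ (λ empty → k , k∈ , empty) (empty-or-hit k))
      ...   | inj₁ (k₀ , k₀∈ , empty) = inj₂ (bound-step k₀∈ empty bounds)
      ...   | inj₂ hit                = inj₁ (dense hit active)

  -- Integer sums and products; perturbed grids modulo `Q`

  lookup-ext : ∀ {A : Set} {n} (u v : Vec A n) → (∀ j → Vec.lookup u j ≡ Vec.lookup v j) → u ≡ v
  lookup-ext u v h = trans (sym (Vec.tabulate∘lookup u)) (trans (Vec.tabulate-cong h) (Vec.tabulate∘lookup v))

  sum-lookup : ∀ {d} (v : Vec ℕ d) → Vec.sum v ≡ ∑ (Vec.lookup v)
  sum-lookup Vec.[]       = refl
  sum-lookup (x Vec.∷ v)  = cong (λ s → x + s) (sum-lookup v)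

  ∑-+ : ∀ {d} (f g : Fin d → ℕ) → ∑ (λ j → f j + g j) ≡ ∑ f + ∑ g
  ∑-+ {zero}  f g = refl
  ∑-+ {suc d} f g = trans (cong (λ s → f zero + g zero + s) (∑-+ (f ∘ suc) (g ∘ suc)))
    (+-interchange (f zero) (g zero) (∑ (f ∘ suc)) (∑ (g ∘ suc)))

  ∑-const : ∀ d a → ∑ {d} (const a) ≡ d * a
  ∑-const zero    a = refl
  ∑-const (suc d) a = cong (λ s → a + s) (∑-const d a)

  ∑-cong : ∀ {d} {f g : Fin d → ℕ} → (∀ j → f j ≡ g j) → ∑ f ≡ ∑ g
  ∑-cong {zero}  h = refl
  ∑-cong {suc d} h = cong₂ _+_ (h zero) (∑-cong (h ∘ suc))

  ∏-cong : ∀ {d} {f g : Fin d → ℕ} → (∀ j → f j ≡ g j) → ∏ f ≡ ∏ g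
  ∏-cong {zero}  h = refl
  ∏-cong {suc d} h = cong₂ _*_ (h zero) (∏-cong (h ∘ suc))

  ∑-split : ∀ n {m} (f : Fin (n + m) → ℕ) → ∑ f ≡ ∑ (λ j → f (j ↑ˡ m)) + ∑ (λ i → f (n ↑ʳ i))
  ∑-split zero    f = refl
  ∑-split (suc n) f = trans (cong (λ s → f zero + s) (∑-split n (f ∘ suc))) (sym (+-assoc (f zero) _ _))

  ∏-* : ∀ {d} (f g : Fin d → ℕ) → ∏ (λ j → f j * g j) ≡ ∏ f * ∏ g
  ∏-* {zero}  f g = refl
  ∏-* {suc d} f g = trans (cong (λ s → f zero * g zero * s) (∏-* (f ∘ suc) (g ∘ suc)))
    (solve 4 (λ a b p q → a :* b :* (p :* q) := a :* p :* (b :* q)) refl (f zero) (g zero) (∏ (f ∘ suc)) (∏ (g ∘ suc)))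
    where open ℕ-Solver

  ∏-zero : ∀ {d} (f : Fin d → ℕ) i → f i ≡ 0 → ∏ f ≡ 0
  ∏-zero f zero    eq = cong (_* ∏ (f ∘ suc)) eq
  ∏-zero f (suc i) eq = trans (cong (λ s → f zero * s) (∏-zero (f ∘ suc) i eq)) (*-zeroʳ (f zero))

  unique-keys : ∀ {I K : Set} (key : I → K) {xs} → Unique xs →
    (∀ {x y} → x ∈ xs → y ∈ xs → key x ≡ key y → x ≡ y) → AllPairs (λ x y → key x ≢ key y) xs
  unique-keys key []           inj = []
  unique-keys key (x∉xs ∷ xs!) inj =
    All.tabulate (λ y∈xs eq → All.lookup x∉xs y∈xs (inj (here refl) (there y∈xs) eq))
    ∷ unique-keys key xs! (λ x∈ y∈ → inj (there x∈) (there y∈))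

  ∑ℤ-+ : ∀ {n} (a v w : Fin n → ℤ) →
    ∑ℤ (λ j → a j ℤ.* (v j ℤ.+ w j)) ≡ ∑ℤ (λ j → a j ℤ.* v j) ℤ.+ ∑ℤ (λ j → a j ℤ.* w j)
  ∑ℤ-+ {zero}  a v w = refl
  ∑ℤ-+ {suc n} a v w = trans (cong (λ s → a zero ℤ.* (v zero ℤ.+ w zero) ℤ.+ s) (∑ℤ-+ (a ∘ suc) (v ∘ suc) (w ∘ suc)))
    (solve 5 (λ a v w s t → a :* (v :+ w) :+ (s :+ t) := a :* v :+ s :+ (a :* w :+ t)) refl (a zero) (v zero) (w zero) _ _)
    where open ℤ-Solver

  ∑ℤ-neg : ∀ {n} (a v : Fin n → ℤ) → ∑ℤ (λ j → a j ℤ.* (ℤ.- v j)) ≡ ℤ.- ∑ℤ (λ j → a j ℤ.* v j)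
  ∑ℤ-neg {zero}  a v = refl
  ∑ℤ-neg {suc n} a v = trans (cong (λ s → a zero ℤ.* (ℤ.- v zero) ℤ.+ s) (∑ℤ-neg (a ∘ suc) (v ∘ suc)))
    (solve 3 (λ a v s → a :* (:- v) :+ (:- s) := :- (a :* v :+ s)) refl (a zero) (v zero) _)
    where open ℤ-Solver

  ∑ℤ-cong : ∀ {n} {f g : Fin n → ℤ} → (∀ j → f j ≡ g j) → ∑ℤ f ≡ ∑ℤ g
  ∑ℤ-cong {zero}  h = refl
  ∑ℤ-cong {suc n} h = cong₂ ℤ._+_ (h zero) (∑ℤ-cong (h ∘ suc))

  ∑ℤ-zero : ∀ {n} (a : Fin n → ℤ) → ∑ℤ (λ j → a j ℤ.* + 0) ≡ + 0
  ∑ℤ-zero {zero}  a = refl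
  ∑ℤ-zero {suc n} a = cong₂ ℤ._+_ (ℤ.*-zeroʳ (a zero)) (∑ℤ-zero (a ∘ suc))

  ∣-∣-△ : ∀ x y z → ∣ x ℤ.- z ∣ ≤ ∣ x ℤ.- y ∣ + ∣ y ℤ.- z ∣
  ∣-∣-△ x y z = subst (λ i → ∣ i ∣ ≤ ∣ x ℤ.- y ∣ + ∣ y ℤ.- z ∣)
    (solve 3 (λ x y z → (x :- y) :+ (y :- z) := x :- z) refl x y z) (ℤ.∣i+j∣≤∣i∣+∣j∣ (x ℤ.- y) (y ℤ.- z))
    where open ℤ-Solver

  shifted : ∀ x B → ∣ x ∣ ≤ B → + ∣ + B ℤ.+ x ∣ ≡ + B ℤ.+ x × ∣ + B ℤ.+ x ∣ ≤ B + B
  shifted (+ p)     B h = refl , +-monoʳ-≤ B h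
  shifted -[1+ p ] B h rewrite ℤ.⊖-≥ h = refl , ≤-trans (m∸n≤m B (suc p)) (m≤m+n B B)

  -- The grid of spacing b B fits into one period `Q`, and the perturbations 2 B are too small to
  -- bridge the gap at its end; so congruent perturbed points are equal. Then two grid points are at
  -- most 4 B apart, less than the spacing. A grid with a single point needs no room.
  perturbed-≤ : ∀ {b B P Q g g′ : ℕ} {w w′ r : ℤ} → 5 ≤ b → 0 < B → P * (b * B) ≤ Q ⊎ P ≤ 1 →
    ∣ + (g * (b * B)) ℤ.- w ∣ ≤ B + B → ∣ + (g′ * (b * B)) ℤ.- w′ ∣ ≤ B + B →
    w ℤ.- w′ ≡ r ℤ.* + Q → g < P → g < g′ → g′ < P → ⊥
  perturbed-≤ {P = P} {g′ = g′} 5≤b 0<B (inj₂ P≤1) _ _ _ _ g<g′ g′<P =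
    contradiction (≤-trans g′<P P≤1) (≤⇒≯ (≤-trans (s≤s z≤n) g<g′))
  perturbed-≤ {b} {B} {P} {Q} {g} {g′} {w} {w′} {r} 5≤b 0<B (inj₁ PbB≤Q) close close′ cong-Q g<P g<g′ g′<P =
    contradiction bB≤ (<⇒≱ 4B<bB)
    where
    open ≤-Reasoning
    y = g * (b * B)
    y′ = g′ * (b * B)
    4B<bB : (B + B) + (B + B) < b * B
    4B<bB = begin-strict
      (B + B) + (B + B)       <⟨ m<n+m ((B + B) + (B + B)) 0<B ⟩
      B + ((B + B) + (B + B)) ≡⟨ solve 1 (λ B → B :+ ((B :+ B) :+ (B :+ B)) := con 5 :* B) refl B ⟩
      5 * B                   ≤⟨ *-monoˡ-≤ B 5≤b ⟩
      b * B                   ∎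
      where open ℕ-Solver
    Δy≡ : ∣ + y ℤ.- + y′ ∣ ≡ (g′ ∸ g) * (b * B)
    Δy≡ = trans (cong ∣_∣ (ℤ.m-n≡m⊖n y y′)) (trans (ℤ.∣⊖∣-≤ (*-monoˡ-≤ (b * B) (<⇒≤ g<g′))) (sym (*-distribʳ-∸ (b * B) g′ g)))
    w-w′<Q : ∣ w ℤ.- w′ ∣ < Q
    w-w′<Q = begin-strict
      ∣ w ℤ.- w′ ∣                                             ≤⟨ ∣-∣-△ w (+ y) w′ ⟩
      ∣ w ℤ.- + y ∣ + ∣ + y ℤ.- w′ ∣                           ≤⟨ +-mono-≤
        (≤-trans (≤-reflexive (ℤ.∣i-j∣≡∣j-i∣ w (+ y))) close)
        (≤-trans (∣-∣-△ (+ y) (+ y′) w′) (+-monoʳ-≤ ∣ + y ℤ.- + y′ ∣ close′)) ⟩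
      (B + B) + (∣ + y ℤ.- + y′ ∣ + (B + B))                   ≡⟨ solve 2 (λ u v → u :+ (v :+ u) := v :+ (u :+ u)) refl (B + B) ∣ + y ℤ.- + y′ ∣ ⟩
      ∣ + y ℤ.- + y′ ∣ + ((B + B) + (B + B))                   <⟨ +-monoʳ-< ∣ + y ℤ.- + y′ ∣ 4B<bB ⟩
      ∣ + y ℤ.- + y′ ∣ + b * B                                 ≡⟨ cong (_+ b * B) Δy≡ ⟩
      (g′ ∸ g) * (b * B) + b * B                               ≤⟨ +-monoˡ-≤ (b * B) (*-monoˡ-≤ (b * B) (m∸n≤m g′ g)) ⟩
      g′ * (b * B) + b * B                                     ≡⟨ +-comm (g′ * (b * B)) (b * B) ⟩
      suc g′ * (b * B)                                         ≤⟨ *-monoˡ-≤ (b * B) g′<P ⟩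
      P * (b * B)                                              ≤⟨ PbB≤Q ⟩
      Q                                                        ∎
      where open ℕ-Solver
    r≡0 : ∀ k → ∣ r ∣ ≡ k → ∣ r ∣ ≡ 0
    r≡0 zero    eq = eq
    r≡0 (suc k) eq = contradiction w-w′<Q (≤⇒≯ (begin
      Q              ≤⟨ m≤m+n Q (k * Q) ⟩
      suc k * Q      ≡⟨ cong (_* Q) eq ⟨
      ∣ r ∣ * Q      ≡⟨ ℤ.abs-* r (+ Q) ⟨
      ∣ r ℤ.* + Q ∣  ≡⟨ cong ∣_∣ cong-Q ⟨
      ∣ w ℤ.- w′ ∣   ∎))
    w≡w′ : w ≡ w′
    w≡w′ = ℤ.i-j≡0⇒i≡j w w′ (trans cong-Q (cong (ℤ._* + Q) (ℤ.∣i∣≡0⇒i≡0 {r} (r≡0 ∣ r ∣ refl))))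
    bB≤ : b * B ≤ (B + B) + (B + B)
    bB≤ = begin
      b * B                            ≡⟨ *-identityˡ (b * B) ⟨
      1 * (b * B)                      ≤⟨ *-monoˡ-≤ (b * B) (m<n⇒0<n∸m g<g′) ⟩
      (g′ ∸ g) * (b * B)               ≡⟨ Δy≡ ⟨
      ∣ + y ℤ.- + y′ ∣                 ≤⟨ ∣-∣-△ (+ y) w (+ y′) ⟩
      ∣ + y ℤ.- w ∣ + ∣ w ℤ.- + y′ ∣   ≤⟨ +-mono-≤ close (≤-trans
        (≤-reflexive (trans (cong (λ w → ∣ w ℤ.- + y′ ∣) w≡w′) (ℤ.∣i-j∣≡∣j-i∣ w′ (+ y′)))) close′) ⟩
      (B + B) + (B + B)                ∎

  perturbed-injective : ∀ {b B P Q g g′ : ℕ} {w w′ r : ℤ} → 5 ≤ b → 0 < B → P * (b * B) ≤ Q ⊎ P ≤ 1 →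
    ∣ + (g * (b * B)) ℤ.- w ∣ ≤ B + B → ∣ + (g′ * (b * B)) ℤ.- w′ ∣ ≤ B + B →
    w ℤ.- w′ ≡ r ℤ.* + Q → g < P → g′ < P → g ≡ g′
  perturbed-injective {b} {B} {P} {Q} {g} {g′} {w} {w′} {r} 5≤b 0<B room close close′ cong-Q g<P g′<P with <-cmp g g′
  ... | tri≈ _ g≡g′ _ = g≡g′
  ... | tri< g<g′ _ _ = contradiction (perturbed-≤ {g = g} {g′} {w} {w′} {r} 5≤b 0<B room close close′ cong-Q g<P g<g′ g′<P) id
  ... | tri> _ _ g′<g = contradiction (perturbed-≤ {g = g′} {g} {w′} {w} {ℤ.- r} 5≤b 0<B room close′ close
    (trans (solve 2 (λ w w′ → w′ :- w := :- (w :- w′)) refl w w′)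
      (trans (cong ℤ.-_ cong-Q) (ℤ.neg-distribˡ-* r (+ Q)))) g′<P g′<g g<P) id
    where open ℤ-Solver

  -- Integer logarithms and the contribution of one class

  module Logarithm (b : ℕ) (2≤b : 2 ≤ b) where

    private
      lg-spec : ∀ x → ∃[ h ] (suc x < b ^ suc h × b ^ h ≤ suc x)
      lg-spec zero    = 0 , ≤-trans 2≤b (≤-reflexive (sym (*-identityʳ b))) , ≤-refl
      lg-spec (suc x) with lg-spec x
      ... | h , x< , x≥ with 2 + x <? b ^ suc h
      ...   | yes x+1< = h , x+1< , m≤n⇒m≤1+n x≥
      ...   | no  x+1≮ = suc h , ≤-trans (s≤s x<)
        (≤-trans (+-mono-≤ (m^n>0 b {{>-nonZero (≤-trans (s≤s z≤n) 2≤b)}} (suc h)) (m≤m+n (b ^ suc h) 0))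
          (*-monoˡ-≤ (b ^ suc h) 2≤b)) , ≮⇒≥ x+1≮

    -- The integer part of the logarithm to base `b`, with value 0 at 0.
    lg : ℕ → ℕ
    lg x = proj₁ (lg-spec (pred x))

    ^-cancelʳ-< : ∀ {x y} → b ^ x < b ^ y → x < y
    ^-cancelʳ-< {x} {y} lt with x <? y
    ... | yes x<y = x<y
    ... | no  x≮y = contradiction lt (≤⇒≯ (^-monoʳ-≤ b {{>-nonZero (≤-trans (s≤s z≤n) 2≤b)}} (≮⇒≥ x≮y)))

    x<b^[1+lg] : ∀ x → x < b ^ suc (lg x)
    x<b^[1+lg] zero    = ≤-trans (s≤s z≤n) (proj₁ (proj₂ (lg-spec 0)))
    x<b^[1+lg] (suc x) = proj₁ (proj₂ (lg-spec x))

    b^lg≤x : ∀ {x} → 0 < x → b ^ lg x ≤ x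
    b^lg≤x {suc x} _ = proj₂ (proj₂ (lg-spec x))

    lg≤ : ∀ x {y} → x ≤ b ^ y → lg x ≤ y
    lg≤ zero    _  = z≤n
    lg≤ (suc x) {y} x≤ = ≤-pred (^-cancelʳ-< (≤-<-trans (b^lg≤x (s≤s z≤n)) (≤-<-trans x≤
      (^-monoʳ-< b 2≤b {y} (n<1+n y)))))


  module _ {b n m s F T M : ℕ} {{_ : NonZero b}} where

    -- b ^ F is the number of disjoint translates, at least b ^ s up to the factor b ^ (m * 3).
    -- Together they have room for b ^ (n + T) points, so the contribution M b ^ s of the class is ≪
    -- N = b ^ T.
    dense-class : s ≤ m * 3 + F → b ^ F * M ≤ b ^ (n + T) → M * b ^ s ≤ b ^ (m * 3 + n) * b ^ T
    dense-class s≤ dense = begin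
      M * b ^ s                       ≤⟨ *-monoʳ-≤ M (^-monoʳ-≤ b s≤) ⟩
      M * b ^ (m * 3 + F)             ≡⟨ cong (M *_) (^-distribˡ-+-* b (m * 3) F) ⟩
      M * (b ^ (m * 3) * b ^ F)       ≡⟨ solve 3 (λ M x y → M :* (x :* y) := x :* (y :* M)) refl M (b ^ (m * 3)) (b ^ F) ⟩
      b ^ (m * 3) * (b ^ F * M)       ≤⟨ *-monoʳ-≤ (b ^ (m * 3)) dense ⟩
      b ^ (m * 3) * b ^ (n + T)       ≡⟨ ^-distribˡ-+-* b (m * 3) (n + T) ⟨
      b ^ (m * 3 + (n + T))           ≡⟨ cong (b ^_) (+-assoc (m * 3) n T) ⟨
      b ^ (m * 3 + n + T)             ≡⟨ ^-distribˡ-+-* b (m * 3 + n) T ⟩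
      b ^ (m * 3 + n) * b ^ T         ∎
      where
      open ≤-Reasoning
      open ℕ-Solver

  module _ {b d m β′ K D s g E R T M : ℕ} {{_ : NonZero b}} where

    -- Meant as M b ^ s ≪ D N (1 - 1 / β) ^ (R + m - s). As g + s = m E and K ≤ b ^ (m E + m), the
    -- quotient D V / K is at least b ^ (R + m - s), so u = R + m - s is admissible in `Bounded`.
    -- Since K ≥ b ^ (m E) = b ^ g b ^ s, cancelling b ^ g leaves b ^ s on the left and N on the
    -- right.
    bounded-class : g + s ≡ m * E → b ^ (m * E) ≤ K → K ≤ b ^ (m * E + m) → b ^ R ≤ D * b ^ T → s ≤ R + m →
      Bounded b d β′ K D (T + (m * 2 + g)) M →
      M * b ^ s * suc β′ ^ (R + m) ≤ b ^ (m * 2 + d) * (D * b ^ T) * (β′ ^ (R + m ∸ s) * suc β′ ^ s)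
    bounded-class g+s K≥ K≤ b^R≤ s≤ bounded = begin
      M * b ^ s * suc β′ ^ (R + m)                ≡⟨ cong (λ x → M * b ^ s * suc β′ ^ x) (m∸n+n≡m s≤) ⟨
      M * b ^ s * suc β′ ^ (u + s)                ≡⟨ cong (M * b ^ s *_) (^-distribˡ-+-* (suc β′) u s) ⟩
      M * b ^ s * (suc β′ ^ u * suc β′ ^ s)       ≡⟨ *-assoc (M * b ^ s) (suc β′ ^ u) (suc β′ ^ s) ⟨
      M * b ^ s * suc β′ ^ u * suc β′ ^ s         ≤⟨ *-monoˡ-≤ (suc β′ ^ s) cancelled ⟩
      C * (D * N) * β′ ^ u * suc β′ ^ s           ≡⟨ *-assoc (C * (D * N)) (β′ ^ u) (suc β′ ^ s) ⟩
      C * (D * N) * (β′ ^ u * suc β′ ^ s)         ∎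
      where
      open ≤-Reasoning
      open ℕ-Solver
      u = R + m ∸ s
      N = b ^ T
      C = b ^ (m * 2 + d)
      V = b ^ (T + (m * 2 + g))
      V≡ : V ≡ N * (b ^ (m * 2) * b ^ g)
      V≡ = trans (^-distribˡ-+-* b T (m * 2 + g)) (cong (N *_) (^-distribˡ-+-* b (m * 2) g))
      exponents : m * E + m + u ≡ R + (m * 2 + g)
      exponents = begin-equality
        m * E + m + u               ≡⟨ cong (λ x → x + m + u) g+s ⟨
        g + s + m + u               ≡⟨ solve 4 (λ g s m u → g :+ s :+ m :+ u := g :+ m :+ (s :+ u)) refl g s m u ⟩
        g + m + (s + u)             ≡⟨ cong (λ x → g + m + x) (m+[n∸m]≡n s≤) ⟩
        g + m + (R + m)             ≡⟨ solve 3 (λ g m R → g :+ m :+ (R :+ m) := R :+ (m :* con 2 :+ g)) refl g m R ⟩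
        R + (m * 2 + g)             ∎
      premise : K * b ^ u ≤ D * V * b ^ d
      premise = begin
        K * b ^ u                                  ≤⟨ *-monoˡ-≤ (b ^ u) K≤ ⟩
        b ^ (m * E + m) * b ^ u                    ≡⟨ ^-distribˡ-+-* b (m * E + m) u ⟨
        b ^ (m * E + m + u)                        ≡⟨ cong (b ^_) exponents ⟩
        b ^ (R + (m * 2 + g))                      ≡⟨ trans (^-distribˡ-+-* b R _) (cong (b ^ R *_) (^-distribˡ-+-* b (m * 2) g)) ⟩
        b ^ R * (b ^ (m * 2) * b ^ g)              ≤⟨ *-monoˡ-≤ _ b^R≤ ⟩
        D * N * (b ^ (m * 2) * b ^ g)              ≡⟨ *-assoc D N _ ⟩
        D * (N * (b ^ (m * 2) * b ^ g))            ≡⟨ cong (D *_) V≡ ⟨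
        D * V                                      ≤⟨ m≤m*n (D * V) (b ^ d) {{m^n≢0 b d}} ⟩
        D * V * b ^ d                              ∎
      cancelled : M * b ^ s * suc β′ ^ u ≤ C * (D * N) * β′ ^ u
      cancelled = *-cancelʳ-≤ _ _ (b ^ g) {{m^n≢0 b g}} (begin
        M * b ^ s * suc β′ ^ u * b ^ g             ≡⟨ solve 4 (λ M x y z → M :* x :* y :* z := M :* (z :* x :* y)) refl M (b ^ s) (suc β′ ^ u) (b ^ g) ⟩
        M * (b ^ g * b ^ s * suc β′ ^ u)           ≡⟨ cong (λ x → M * (x * suc β′ ^ u)) (trans (sym (^-distribˡ-+-* b g s)) (cong (b ^_) g+s)) ⟩
        M * (b ^ (m * E) * suc β′ ^ u)             ≤⟨ *-monoʳ-≤ M (*-monoˡ-≤ (suc β′ ^ u) K≥) ⟩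
        M * (K * suc β′ ^ u)                       ≤⟨ bounded u premise ⟩
        D * V * b ^ d * β′ ^ u                     ≡⟨ cong (λ x → D * x * b ^ d * β′ ^ u) V≡ ⟩
        D * (N * (b ^ (m * 2) * b ^ g)) * b ^ d * β′ ^ u
          ≡⟨ solve 6 (λ D N x y z w → D :* (N :* (x :* y)) :* z :* w := x :* z :* (D :* N) :* w :* y) refl D N (b ^ (m * 2)) (b ^ g) (b ^ d) (β′ ^ u) ⟩
        b ^ (m * 2) * b ^ d * (D * N) * β′ ^ u * b ^ g
          ≡⟨ cong (λ x → x * (D * N) * β′ ^ u * b ^ g) (^-distribˡ-+-* b (m * 2) d) ⟨
        C * (D * N) * β′ ^ u * b ^ g               ∎)

  ∏-pos : ∀ {d} (f : Fin d → ℕ) → (∀ j → 0 < f j) → 0 < ∏ f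
  ∏-pos {zero}  f h = s≤s z≤n
  ∏-pos {suc d} f h = *-mono-≤ (h zero) (∏-pos (f ∘ suc) (h ∘ suc))

  ∏⁻-pos : ∀ {d} (f : Fin d → ℕ) → 0 < ∏ f → ∀ i → 0 < f i
  ∏⁻-pos f h i with f i in eq
  ... | suc _ = s≤s z≤n
  ... | zero  = contradiction (subst (0 <_) (∏-zero f i eq) h) λ ()

  *⁻-pos : ∀ x y → 0 < x * y → 0 < x × 0 < y
  *⁻-pos (suc x) (suc y) _ = s≤s z≤n , s≤s z≤n
  *⁻-pos (suc x) zero    h = contradiction (subst (0 <_) (*-zeroʳ x) h) λ ()

  -- Summation over the classes

  telescope : ∀ (F V : ℕ → ℕ) a → (∀ k → F k + V k ≤ V (suc k)) → sum (applyUpTo F a) + V 0 ≤ V a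
  telescope F V zero    h = ≤-refl
  telescope F V (suc a) h = begin
    F 0 + S + V 0     ≡⟨ solve 3 (λ f s v → f :+ s :+ v := s :+ (f :+ v)) refl (F 0) S (V 0) ⟩
    S + (F 0 + V 0)   ≤⟨ +-monoʳ-≤ S (h 0) ⟩
    S + V 1           ≤⟨ telescope (F ∘ suc) (V ∘ suc) a (h ∘ suc) ⟩
    V (suc a)         ∎
    where
    open ≤-Reasoning
    open ℕ-Solver
    S = sum (applyUpTo (F ∘ suc) a)

  -- β ^ P (1 - 1 / β) ^ (P - s) for β = `suc β′`. The cube of classes contains vectors with sum
  -- above `P`; the value 0 there keeps the sums bounded.
  weight : (β′ P s : ℕ) → ℕ
  weight β′ P s with s ≤? P
  ... | yes _ = β′ ^ (P ∸ s) * suc β′ ^ s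
  ... | no  _ = 0

  weight≡ : ∀ {β′ P s} → s ≤ P → weight β′ P s ≡ β′ ^ (P ∸ s) * suc β′ ^ s
  weight≡ {β′} {P} {s} s≤P with s ≤? P
  ... | yes _   = refl
  ... | no  s≰P = contradiction s≤P s≰P

  module _ (β′ P : ℕ) where

    private
      -- A primitive of the weight: up to s = P its increment is the weight because β - β′ = 1, and
      -- beyond it is constant.
      V : ℕ → ℕ
      V s = suc β′ ^ (s ⊓ suc P) * β′ ^ (suc P ∸ s)

      weight-V : ∀ s → weight β′ P s + V s ≤ V (suc s)
      weight-V s with s ≤? P
      ... | yes s≤P = ≤-reflexive (begin
        β′ ^ (P ∸ s) * suc β′ ^ s + suc β′ ^ (s ⊓ suc P) * β′ ^ (suc P ∸ s)
          ≡⟨ cong₂ (λ x y → β′ ^ (P ∸ s) * suc β′ ^ s + suc β′ ^ x * β′ ^ y) (m≤n⇒m⊓n≡m (m≤n⇒m≤1+n s≤P)) (+-∸-assoc 1 s≤P) ⟩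
        β′ ^ (P ∸ s) * suc β′ ^ s + suc β′ ^ s * (β′ * β′ ^ (P ∸ s))
          ≡⟨ solve 3 (λ p q β → p :* q :+ q :* (β :* p) := (con 1 :+ β) :* q :* p) refl (β′ ^ (P ∸ s)) (suc β′ ^ s) β′ ⟩
        suc β′ ^ suc s * β′ ^ (P ∸ s)
          ≡⟨ cong (λ x → suc β′ ^ suc x * β′ ^ (P ∸ s)) (m≤n⇒m⊓n≡m s≤P) ⟨
        V (suc s) ∎)
        where
        open ≡-Reasoning
        open ℕ-Solver
      ... | no s≰P = ≤-reflexive (cong₂ (λ x y → suc β′ ^ x * β′ ^ y)
        (trans (m≥n⇒m⊓n≡n P<s) (cong suc (sym (m≥n⇒m⊓n≡n (<⇒≤ P<s)))))
        (trans (m≤n⇒m∸n≡0 P<s) (sym (m≤n⇒m∸n≡0 (<⇒≤ P<s)))))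
        where P<s = ≰⇒> s≰P

      V≤ : ∀ s → V s ≤ suc β′ ^ suc P
      V≤ s = begin
        suc β′ ^ (s ⊓ suc P) * β′ ^ (suc P ∸ s)       ≤⟨ *-monoʳ-≤ (suc β′ ^ (s ⊓ suc P)) (^-monoˡ-≤ (suc P ∸ s) (n≤1+n β′)) ⟩
        suc β′ ^ (s ⊓ suc P) * suc β′ ^ (suc P ∸ s)   ≡⟨ ^-distribˡ-+-* (suc β′) (s ⊓ suc P) (suc P ∸ s) ⟨
        suc β′ ^ (s ⊓ suc P + (suc P ∸ s))            ≡⟨ cong (suc β′ ^_) (m⊓n+n∸m≡n s (suc P)) ⟩
        suc β′ ^ suc P                                ∎
        where open ≤-Reasoning

    ∑-weight : ∀ a c → ∑ₗ (upTo a) (λ k → weight β′ P (k + c)) ≤ suc β′ ^ suc P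
    ∑-weight a c = begin
      sum (map F (upTo a))         ≡⟨ cong sum (List.map-upTo F a) ⟩
      sum (applyUpTo F a)          ≤⟨ m≤m+n _ (V c) ⟩
      sum (applyUpTo F a) + V c    ≤⟨ telescope F (λ k → V (k + c)) a (λ k → weight-V (k + c)) ⟩
      V (a + c)                    ≤⟨ V≤ (a + c) ⟩
      suc β′ ^ suc P               ∎
      where
      open ≤-Reasoning
      F = λ k → weight β′ P (k + c)

  -- After multiplication by β ^ P, the `X` part is paid once per class, but the `Y` part only once
  -- per line in the first coordinate, where the weights sum to at most β ^ (P + 1).
  ∑-classes : ∀ {I : Set} {m m′} b β′ P X Y → m ≡ suc m′ → (key : I → Vec ℕ m) (qs : List I) →
    (∀ {q} → q ∈ qs → key q ∈ box (const (suc P))) →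
    (∀ k → length (fibre (Vec.≡-dec _≟_) key k qs) * b ^ Vec.sum k * suc β′ ^ P ≤
           X * suc β′ ^ P + Y * weight β′ P (Vec.sum k)) →
    ∑ₗ qs (λ q → b ^ Vec.sum (key q)) ≤ X * suc P ^ m + Y * suc β′ * suc P ^ m′
  ∑-classes {m = m} {m′} b β′ P X Y m≡ key qs key∈ bound = *-cancelʳ-≤ _ _ B {{m^n≢0 (suc β′) P}} (begin
    ∑ₗ qs (λ q → b ^ Vec.sum (key q)) * B
      ≤⟨ *-monoˡ-≤ B (∑ₗ-fibres (Vec.≡-dec _≟_) key (λ k → b ^ Vec.sum k) cube qs key∈) ⟩
    ∑ₗ cube F * B
      ≡⟨ ∑ₗ-*ʳ F B cube ⟨
    ∑ₗ cube (λ k → F k * B)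
      ≤⟨ ∑ₗ-mono cube (λ {k} _ → ≤-trans (bound k) (+-monoʳ-≤ (X * B) (≤-reflexive (*-comm Y (W k))))) ⟩
    ∑ₗ cube (λ k → X * B + W k * Y)
      ≡⟨ ∑ₗ-+ (const (X * B)) (λ k → W k * Y) cube ⟩
    ∑ₗ cube (const (X * B)) + ∑ₗ cube (λ k → W k * Y)
      ≡⟨ cong₂ _+_ (trans (∑ₗ-const cube (X * B)) (cong (_* (X * B)) (trans (length-box {m} (const (suc P))) (∏-const m (suc P)))))
           (∑ₗ-*ʳ W Y cube) ⟩
    suc P ^ m * (X * B) + ∑ₗ cube W * Y
      ≤⟨ +-monoʳ-≤ (suc P ^ m * (X * B)) (*-monoˡ-≤ Y (∑ₗ-cube-≤ m≡ (suc P) (suc β′ ^ suc P) (weight β′ P) (∑-weight β′ P (suc P)))) ⟩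
    suc P ^ m * (X * B) + suc P ^ m′ * (suc β′ * B) * Y
      ≡⟨ solve 6 (λ p X B p′ β Y → p :* (X :* B) :+ p′ :* (β :* B) :* Y := (X :* p :+ Y :* β :* p′) :* B)
           refl (suc P ^ m) X B (suc P ^ m′) (suc β′) Y ⟩
    (X * suc P ^ m + Y * suc β′ * suc P ^ m′) * B ∎)
    where
    open ≤-Reasoning
    open ℕ-Solver
    B = suc β′ ^ P
    cube = box {m} (const (suc P))
    F W : Vec ℕ m → ℕ
    F k = length (fibre (Vec.≡-dec _≟_) key k qs) * b ^ Vec.sum k
    W k = weight β′ P (Vec.sum k)

  collect-constants : ∀ {S C₁ C₂ D N B T c ρ p m m′} {{_ : NonZero c}} → m′ ≤ m → N ≤ B * T → p ≤ c * ρ →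
    S ≤ C₁ * N * p ^ m + C₂ * (D * N) * p ^ m′ →
    S ≤ c ^ m * B * (C₁ + C₂) * (T * ρ ^ m + D * T * ρ ^ m′)
  collect-constants {S} {C₁} {C₂} {D} {N} {B} {T} {c} {ρ} {p} {m} {m′} m′≤m N≤ p≤ S≤ = begin
    S ≤⟨ S≤ ⟩
    C₁ * N * p ^ m + C₂ * (D * N) * p ^ m′
      ≤⟨ +-mono-≤ (*-mono-≤ (*-monoʳ-≤ C₁ N≤) (power m ≤-refl)) (*-mono-≤ (*-monoʳ-≤ C₂ (*-monoʳ-≤ D N≤)) (power m′ m′≤m)) ⟩
    C₁ * (B * T) * (c ^ m * ρ ^ m) + C₂ * (D * (B * T)) * (c ^ m * ρ ^ m′)
      ≡⟨ solve 8 (λ c₁ B T x r c₂ D r′ → c₁ :* (B :* T) :* (x :* r) :+ c₂ :* (D :* (B :* T)) :* (x :* r′)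
           := x :* B :* (c₁ :* (T :* r) :+ c₂ :* (D :* T :* r′))) refl C₁ B T (c ^ m) (ρ ^ m) C₂ D (ρ ^ m′) ⟩
    c ^ m * B * (C₁ * (T * ρ ^ m) + C₂ * (D * T * ρ ^ m′))
      ≤⟨ *-monoʳ-≤ (c ^ m * B) (≤-trans (m≤m+n _ (C₁ * (D * T * ρ ^ m′) + C₂ * (T * ρ ^ m)))
           (≤-reflexive (solve 4 (λ p q x y → p :* x :+ q :* y :+ (p :* y :+ q :* x) := (p :+ q) :* (x :+ y)) refl C₁ C₂ (T * ρ ^ m) (D * T * ρ ^ m′)))) ⟩
    c ^ m * B * ((C₁ + C₂) * (T * ρ ^ m + D * T * ρ ^ m′))
      ≡⟨ *-assoc (c ^ m * B) (C₁ + C₂) (T * ρ ^ m + D * T * ρ ^ m′) ⟨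
    c ^ m * B * (C₁ + C₂) * (T * ρ ^ m + D * T * ρ ^ m′) ∎
    where
    open ≤-Reasoning
    open ℕ-Solver
    power : ∀ x → x ≤ m → p ^ x ≤ c ^ m * ρ ^ x
    power x x≤m = begin
      p ^ x               ≤⟨ ^-monoˡ-≤ x p≤ ⟩
      (c * ρ) ^ x         ≡⟨ ^-distribʳ-* x c ρ ⟩
      c ^ x * ρ ^ x       ≤⟨ *-monoˡ-≤ (ρ ^ x) (^-monoʳ-≤ c x≤m) ⟩
      c ^ m * ρ ^ x       ∎

  -- The orbit of a rational matrix as a set of lattice points

  module Orbit (b n m : ℕ) (5≤b : 5 ≤ b) (i₀ : Fin m) (Q : ℕ) (0<Q : 0 < Q)
    (A : Fin m → Fin n → ℤ) (z : Vec ℤ n → Fin m → ℤ)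
    (lattice : ∀ q i → ∃[ p ] z q i ≡ ∑ℤ (λ j → A i j ℤ.* Vec.lookup q j) ℤ.+ p ℤ.* + Q)
    (D : ℕ) where

    private
      d = n + m

      instance
        b≢0 : NonZero b
        b≢0 = >-nonZero (≤-trans (s≤s z≤n) 5≤b)
        Q≢0 : NonZero Q
        Q≢0 = >-nonZero 0<Q

      K = Q ^ m
      0<K : 0 < K
      0<K = m^n>0 Q m

    X : Vec ℤ n → Fin d → ℤ
    X q j = [ Vec.lookup q , z q ]′ (splitAt n j)

    -- The lattice of all (q , A q + p Q), of covolume `K`. Modulo `Q` the last m coordinates are
    -- determined by the first n.
    G : (Fin d → ℤ) → Set
    G v = ∀ i → ∃[ p ] v (n ↑ʳ i) ≡ ∑ℤ (λ j → A i j ℤ.* v (j ↑ˡ m)) ℤ.+ p ℤ.* + Q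

    G-+ : ∀ {v w} → G v → G w → G (λ j → v j ℤ.+ w j)
    G-+ {v} {w} hv hw i with hv i | hw i
    ... | p , eq | p′ , eq′ = p ℤ.+ p′ , trans (cong₂ ℤ._+_ eq eq′)
      (trans (solve 5 (λ s t p p′ Q → (s :+ p :* Q) :+ (t :+ p′ :* Q) := (s :+ t) :+ (p :+ p′) :* Q) refl
          (∑ℤ (λ j → A i j ℤ.* v (j ↑ˡ m))) (∑ℤ (λ j → A i j ℤ.* w (j ↑ˡ m))) p p′ (+ Q))
        (cong (ℤ._+ (p ℤ.+ p′) ℤ.* + Q) (sym (∑ℤ-+ (A i) (λ j → v (j ↑ˡ m)) (λ j → w (j ↑ˡ m))))))
      where open ℤ-Solver

    G-neg : ∀ {v} → G v → G (λ j → ℤ.- v j)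
    G-neg {v} hv i with hv i
    ... | p , eq = ℤ.- p , trans (cong ℤ.-_ eq)
      (trans (solve 3 (λ s p Q → :- (s :+ p :* Q) := (:- s) :+ (:- p) :* Q) refl
          (∑ℤ (λ j → A i j ℤ.* v (j ↑ˡ m))) p (+ Q))
        (cong (ℤ._+ (ℤ.- p) ℤ.* + Q) (sym (∑ℤ-neg (A i) (λ j → v (j ↑ˡ m))))))
      where open ℤ-Solver

    X-q : ∀ q j → X q (j ↑ˡ m) ≡ Vec.lookup q j
    X-q q j = cong [ Vec.lookup q , z q ]′ (Fin.splitAt-↑ˡ n j m)

    X-z : ∀ q i → X q (n ↑ʳ i) ≡ z q i
    X-z q i = cong [ Vec.lookup q , z q ]′ (Fin.splitAt-↑ʳ n m i)

    G-X : ∀ q → G (X q)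
    G-X q i with lattice q i
    ... | p , eq = p , trans (X-z q i) (trans eq
      (cong (ℤ._+ p ℤ.* + Q) (∑ℤ-cong λ j → cong (A i j ℤ.*_) (sym (X-q q j)))))

    Z : Fin d → Set
    Z j = ∃[ i ] j ≡ n ↑ʳ i

    infix 4 _#_
    -- Bad approximability of q - q′ in integers; 1 / `D` plays the part of φ, and `K` accounts for
    -- scaling m rows by `Q`.
    _#_ : Vec ℤ n → Vec ℤ n → Set
    q # q′ = K ≤ D * (∏ (λ j → 1 ⊔ ∣ Vec.lookup q j ℤ.- Vec.lookup q′ j ∣) * ∏ (λ i → ∣ z q i ℤ.- z q′ i ∣))

    -- max {1, |Δq|} ≤ b ^ e also holds for e = 0, so sides of q-coordinates may have length 1. A
    -- side of length 1 in a z-coordinate would force the product to vanish, against 0 < K.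
    #⇒Separated : ∀ {q q′} → q # q′ → Separated b X Z K D q q′
    #⇒Separated {q} {q′} apart e close = K≤ , λ { j (i , refl) → active i }
      where
      open ≤-Reasoning
      Δq : Fin n → ℕ
      Δq j = ∣ Vec.lookup q j ℤ.- Vec.lookup q′ j ∣
      Δz : Fin m → ℕ
      Δz i = ∣ z q i ℤ.- z q′ i ∣
      Δq< : ∀ j → Δq j < b ^ e (j ↑ˡ m)
      Δq< j = subst₂ (λ x y → ∣ x ℤ.- y ∣ < b ^ e (j ↑ˡ m)) (X-q q j) (X-q q′ j) (close (j ↑ˡ m))
      Δz< : ∀ i → Δz i < b ^ e (n ↑ʳ i)
      Δz< i = subst₂ (λ x y → ∣ x ℤ.- y ∣ < b ^ e (n ↑ʳ i)) (X-z q i) (X-z q′ i) (close (n ↑ʳ i))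
      K≤ : K ≤ D * b ^ ∑ e
      K≤ = begin
        K                                           ≤⟨ apart ⟩
        D * (∏ (λ j → 1 ⊔ Δq j) * ∏ Δz)             ≤⟨ *-monoʳ-≤ D (*-mono-≤
          (∏-mono (λ j → ⊔-lub (m^n>0 b (e (j ↑ˡ m))) (<⇒≤ (Δq< j)))) (∏-mono (λ i → <⇒≤ (Δz< i)))) ⟩
        D * (∏ (λ j → b ^ e (j ↑ˡ m)) * ∏ (λ i → b ^ e (n ↑ʳ i)))
          ≡⟨ cong (D *_) (cong₂ _*_ (∏-^ b (λ j → e (j ↑ˡ m))) (∏-^ b (λ i → e (n ↑ʳ i)))) ⟩
        D * (b ^ ∑ (λ j → e (j ↑ˡ m)) * b ^ ∑ (λ i → e (n ↑ʳ i)))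
          ≡⟨ cong (D *_) (^-distribˡ-+-* b (∑ (λ j → e (j ↑ˡ m))) (∑ (λ i → e (n ↑ʳ i)))) ⟨
        D * b ^ (∑ (λ j → e (j ↑ˡ m)) + ∑ (λ i → e (n ↑ʳ i)))
          ≡⟨ cong (λ s → D * b ^ s) (∑-split n e) ⟨
        D * b ^ ∑ e                                 ∎
      active : ∀ i → 0 < e (n ↑ʳ i)
      active i with e (n ↑ʳ i) | Δz< i
      ... | suc _ | _   = s≤s z≤n
      ... | zero  | Δ<1 = contradiction (begin
        1                                   ≤⟨ 0<K ⟩
        K                                   ≤⟨ apart ⟩
        D * (∏ (λ j → 1 ⊔ Δq j) * ∏ Δz)     ≡⟨ cong (λ p → D * (∏ (λ j → 1 ⊔ Δq j) * p)) (∏-zero Δz i (n<1⇒n≡0 Δ<1)) ⟩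
        D * (∏ (λ j → 1 ⊔ Δq j) * 0)        ≡⟨ cong (D *_) (*-zeroʳ (∏ (λ j → 1 ⊔ Δq j))) ⟩
        D * 0                               ≡⟨ *-zeroʳ D ⟩
        0                                   ∎) λ ()

    module Class (τ : Fin n → ℕ) (0<τ : ∀ j → 0 < τ j) (κ : Fin m → ℕ) (xs : List (Vec ℤ n)) (xs! : Unique xs)
      (q≥0 : ∀ {q} → q ∈ xs → ∀ j → + 0 ℤ.≤ Vec.lookup q j)
      (q< : ∀ {q} → q ∈ xs → ∀ j → ∣ Vec.lookup q j ∣ < b ^ τ j)
      (z< : ∀ {q} → q ∈ xs → ∀ i → ∣ z q i ∣ < b ^ κ i) where

      -- The values of z i range over both signs, an interval of length about 2 b ^ κ i, which is
      -- covered by the next power of `b`.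
      e : Fin d → ℕ
      e j = [ τ , suc ∘ κ ]′ (splitAt n j)

      corner : Fin d → ℤ
      corner j = [ const (+ 0) , (λ i → ℤ.- (+ (b ^ κ i))) ]′ (splitAt n j)

      2b^<b^ : ∀ x → b ^ x + b ^ x < b ^ suc x
      2b^<b^ x = begin-strict
        b ^ x + b ^ x           <⟨ m<m+n (b ^ x + b ^ x) (m^n>0 b x) ⟩
        b ^ x + b ^ x + b ^ x   ≡⟨ solve 1 (λ p → p :+ p :+ p := con 3 :* p) refl (b ^ x) ⟩
        3 * b ^ x               ≤⟨ *-monoˡ-≤ (b ^ x) (≤-trans (s≤s (s≤s (s≤s z≤n))) 5≤b) ⟩
        b * b ^ x               ∎
        where
        open ≤-Reasoning
        open ℕ-Solver

      cell : ∀ {q} → q ∈ xs → Cell b X corner e q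
      cell {q} q∈ j with splitAt n j
      ... | inj₁ j′ = ∣ Vec.lookup q j′ ∣ ,
        trans (sym (ℤ.0≤i⇒+∣i∣≡i (q≥0 q∈ j′))) (sym (ℤ.+-identityˡ _)) , q< q∈ j′
      ... | inj₂ i with shifted (z q i) (b ^ κ i) (<⇒≤ (z< q∈ i))
      ...   | eq , ≤2b = ∣ + (b ^ κ i) ℤ.+ z q i ∣ ,
        trans (solve 2 (λ z B → z := (:- B) :+ (B :+ z)) refl (z q i) (+ (b ^ κ i)))
          (cong (λ x → ℤ.- (+ (b ^ κ i)) ℤ.+ x) (sym eq)) , ≤-trans (s≤s ≤2b) (2b^<b^ (κ i))
        where open ℤ-Solver

      ∑-e : ∑ e ≡ ∑ τ + ∑ (suc ∘ κ)
      ∑-e = trans (∑-split n e) (cong₂ _+_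
        (∑-cong (λ j → cong [ τ , suc ∘ κ ]′ (Fin.splitAt-↑ˡ n j m)))
        (∑-cong (λ i → cong [ τ , suc ∘ κ ]′ (Fin.splitAt-↑ʳ n m i))))

      dense-or-bounded : AllPairs _#_ xs → Dense b G Z e ⊎ Bounded b d (d * b ^ d) K D (∑ e) (length xs)
      dense-or-bounded apart = Dichotomy.dichotomy b d (≤-trans (s≤s (s≤s (s≤s z≤n))) 5≤b) X G
        (λ i → + 0 , sym (trans (ℤ.+-identityʳ _) (∑ℤ-zero (A i))))
        (λ {v} {w} → G-+ {v} {w}) (λ q q′ → G-+ {X q} {λ j → ℤ.- X q′ j} (G-X q) (G-neg {X q′} (G-X q′)))
        Z (n ↑ʳ i₀) (i₀ , refl) K D (∑ e) corner e xs (term≤∑ e) (AllPairs.map #⇒Separated apart) cell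

      -- Density provides a lattice vector `v g` near each grid point (0 , g b ^ (2 + κ)). The
      -- translates of the class by these vectors are disjoint, even when only the q-parts of their
      -- points are recorded, and all q-parts lie in one box of b ^ (n + ∑ τ) points.
      count-dense : ∀ E → b ^ E ≤ Q → Dense b G Z e →
                    b ^ ∑ (λ i → E ∸ (2 + κ i)) * length xs ≤ b ^ (n + ∑ τ)
      count-dense E b^E≤Q dense = subst₂ _≤_
        (trans (length-cartesianProductWith _,_ (box free) xs)
          (cong (_* length xs) (trans (length-box free) (∏-^ b (λ i → E ∸ (2 + κ i))))))
        (trans (length-box (λ j → b ^ suc (τ j)))
          (trans (∏-^ b (suc ∘ τ)) (cong (b ^_) (trans (∑-+ (const 1) τ)
            (cong (_+ ∑ τ) (trans (∑-const n 1) (*-identityʳ n)))))))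
        (pigeonhole (Vec.≡-dec _≟_) key (box (λ j → b ^ suc (τ j)))
          (unique-keys key (Unique.cartesianProduct⁺ (box-unique free) xs!) key-injective)
          (λ {p} p∈ → ∈-box⁺ _ (key p) (λ j → subst (_< b ^ suc (τ j))
            (sym (Vec.lookup∘tabulate (λ j → ∣ shift (proj₁ p) (proj₂ p) j ∣) j)) (shift< (proj₂ (members p∈)) j))))
        where
        -- As many grid points of spacing b ^ (2 + κ i) as fit into b ^ E ≤ Q, and a single one if
        -- the spacing exceeds b ^ E.
        free : Fin m → ℕ
        free i = b ^ (E ∸ (2 + κ i))
        y : Vec ℕ m → Fin d → ℤ
        y g j = [ const (+ 0) , (λ i → + (Vec.lookup g i * b ^ (2 + κ i))) ]′ (splitAt n j)
        y-ok : ∀ g j → Z j ⊎ y g j ≡ + 0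
        y-ok g j with splitAt n j in eq
        ... | inj₁ _ = inj₂ refl
        ... | inj₂ i = inj₁ (i , sym (Fin.splitAt⁻¹-↑ʳ eq))
        v : Vec ℕ m → Fin d → ℤ
        v g = proj₁ (dense (y g) (y-ok g))
        v∈G : ∀ g → G (v g)
        v∈G g = proj₁ (proj₂ (dense (y g) (y-ok g)))
        W : Vec ℕ m → Vec ℤ n → Fin d → ℤ
        W g q j = v g j ℤ.+ X q j
        v-q≤ : ∀ g j → ∣ v g (j ↑ˡ m) ∣ ≤ b ^ τ j
        v-q≤ g j = begin
          ∣ v g (j ↑ˡ m) ∣                         ≡⟨ ℤ.∣-i∣≡∣i∣ (v g (j ↑ˡ m)) ⟨
          ∣ ℤ.- v g (j ↑ˡ m) ∣                     ≡⟨ cong ∣_∣ (ℤ.+-identityˡ (ℤ.- v g (j ↑ˡ m))) ⟨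
          ∣ + 0 ℤ.- v g (j ↑ˡ m) ∣                 ≡⟨ cong (λ y → ∣ y ℤ.- v g (j ↑ˡ m) ∣) (cong [ _ , _ ]′ (Fin.splitAt-↑ˡ n j m)) ⟨
          ∣ y g (j ↑ˡ m) ℤ.- v g (j ↑ˡ m) ∣        ≤⟨ proj₂ (proj₂ (dense (y g) (y-ok g))) (j ↑ˡ m) ⟩
          b * b ^ (e (j ↑ˡ m) ∸ 1)                 ≡⟨ cong (λ x → b * b ^ (x ∸ 1)) (cong [ τ , _ ]′ (Fin.splitAt-↑ˡ n j m)) ⟩
          b ^ suc (τ j ∸ 1)                        ≡⟨ cong (b ^_) (m+[n∸m]≡n (0<τ j)) ⟩
          b ^ τ j                                  ∎
          where open ≤-Reasoning
        -- Adding 2 b ^ τ j makes the entries non-negative; they are then at most 4 b ^ τ j, less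
        -- than b ^ (1 + τ j) as b ≥ 5.
        shift : Vec ℕ m → Vec ℤ n → Fin n → ℤ
        shift g q j = + (b ^ τ j + b ^ τ j) ℤ.+ W g q (j ↑ˡ m)
        W-q≤ : ∀ {g q} → q ∈ xs → ∀ j → ∣ W g q (j ↑ˡ m) ∣ ≤ b ^ τ j + b ^ τ j
        W-q≤ {g} {q} q∈ j = ≤-trans (ℤ.∣i+j∣≤∣i∣+∣j∣ (v g (j ↑ˡ m)) (X q (j ↑ˡ m)))
          (+-mono-≤ (v-q≤ g j) (subst (λ x → ∣ x ∣ ≤ b ^ τ j) (sym (X-q q j)) (<⇒≤ (q< q∈ j))))
        shift< : ∀ {g q} → q ∈ xs → ∀ j → ∣ shift g q j ∣ < b ^ suc (τ j)
        shift< {g} {q} q∈ j = ≤-trans (s≤s (proj₂ (shifted (W g q (j ↑ˡ m)) (b ^ τ j + b ^ τ j) (W-q≤ {g} q∈ j)))) (begin-strict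
          (b ^ τ j + b ^ τ j) + (b ^ τ j + b ^ τ j)             <⟨ m<n+m _ (m^n>0 b (τ j)) ⟩
          b ^ τ j + ((b ^ τ j + b ^ τ j) + (b ^ τ j + b ^ τ j)) ≡⟨ solve 1 (λ B → B :+ ((B :+ B) :+ (B :+ B)) := con 5 :* B) refl (b ^ τ j) ⟩
          5 * b ^ τ j                                           ≤⟨ *-monoˡ-≤ (b ^ τ j) 5≤b ⟩
          b ^ suc (τ j)                                         ∎)
          where
          open ≤-Reasoning
          open ℕ-Solver
        key : _ → Vec ℕ n
        key (g , q) = Vec.tabulate (λ j → ∣ shift g q j ∣)
        members : ∀ {g q} → (g , q) ∈ cartesianProduct (box free) xs → g ∈ box free × q ∈ xs
        members p∈ = ∈.∈-cartesianProduct⁻ (box free) xs p∈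
        W-z : ∀ {g q} → q ∈ xs → ∀ i →
          ∣ + (Vec.lookup g i * (b * b ^ suc (κ i))) ℤ.- W g q (n ↑ʳ i) ∣ ≤ b ^ suc (κ i) + b ^ suc (κ i)
        W-z {g} {q} q∈ i = begin
          ∣ Y ℤ.- (V ℤ.+ X q (n ↑ʳ i)) ∣       ≡⟨ cong ∣_∣ (solve 3 (λ Y V x → Y :- (V :+ x) := (Y :- V) :- x) refl Y V (X q (n ↑ʳ i))) ⟩
          ∣ (Y ℤ.- V) ℤ.- X q (n ↑ʳ i) ∣       ≤⟨ ℤ.∣i-j∣≤∣i∣+∣j∣ (Y ℤ.- V) (X q (n ↑ʳ i)) ⟩
          ∣ Y ℤ.- V ∣ + ∣ X q (n ↑ʳ i) ∣       ≤⟨ +-mono-≤ close (≤-trans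
            (≤-trans (≤-reflexive (cong ∣_∣ (X-z q i))) (<⇒≤ (z< q∈ i))) (^-monoʳ-≤ b (n≤1+n (κ i)))) ⟩
          b ^ suc (κ i) + b ^ suc (κ i)        ∎
          where
          open ≤-Reasoning
          open ℤ-Solver
          Y = + (Vec.lookup g i * b ^ (2 + κ i))
          V = v g (n ↑ʳ i)
          close : ∣ Y ℤ.- V ∣ ≤ b ^ suc (κ i)
          close = subst₂ (λ x y → ∣ x ℤ.- V ∣ ≤ b * b ^ (y ∸ 1))
            (cong [ _ , _ ]′ (Fin.splitAt-↑ʳ n m i)) (cong [ τ , suc ∘ κ ]′ (Fin.splitAt-↑ʳ n m i))
            (proj₂ (proj₂ (dense (y g) (y-ok g))) (n ↑ʳ i))
        -- Equal q-parts make the z-parts congruent modulo `Q`. These are within 2 b ^ (1 + κ i) of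
        -- multiples of b ^ (2 + κ i), so g = g′, and cancelling `v g` leaves q = q′.
        key-injective : ∀ {p p′} → p ∈ cartesianProduct (box free) xs → p′ ∈ cartesianProduct (box free) xs →
                        key p ≡ key p′ → p ≡ p′
        key-injective {g , q} {g′ , q′} p∈ p′∈ key≡ = by-target g≡g′ W≡
          where
          q∈ = proj₂ (members p∈)
          q′∈ = proj₂ (members p′∈)
          W≡ : ∀ j → W g q (j ↑ˡ m) ≡ W g′ q′ (j ↑ˡ m)
          W≡ j = +ℤ-cancelˡ (+ B) _ _ (trans (sym (proj₁ (shifted (W g q (j ↑ˡ m)) B (W-q≤ {g} q∈ j))))
              (trans (cong +_ abs≡) (proj₁ (shifted (W g′ q′ (j ↑ˡ m)) B (W-q≤ {g′} q′∈ j)))))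
            where
            B = b ^ τ j + b ^ τ j
            abs≡ : ∣ shift g q j ∣ ≡ ∣ shift g′ q′ j ∣
            abs≡ = trans (sym (Vec.lookup∘tabulate (λ j → ∣ shift g q j ∣) j))
              (trans (cong (λ k → Vec.lookup k j) key≡) (Vec.lookup∘tabulate (λ j → ∣ shift g′ q′ j ∣) j))
          Δ∈ : ∀ i → ∃[ r ] W g q (n ↑ʳ i) ℤ.- W g′ q′ (n ↑ʳ i) ≡ r ℤ.* + Q
          Δ∈ i =
            let p , eq = G-+ {v g} {X q} (v∈G g) (G-X q) i
                p′ , eq′ = G-+ {v g′} {X q′} (v∈G g′) (G-X q′) i
            in p ℤ.- p′ , trans (cong₂ ℤ._-_ eq
              (trans eq′ (cong (ℤ._+ p′ ℤ.* + Q) (∑ℤ-cong λ j → cong (A i j ℤ.*_) (sym (W≡ j))))))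
            (solve 4 (λ s p p′ Q → (s :+ p :* Q) :- (s :+ p′ :* Q) := (p :- p′) :* Q) refl
              (∑ℤ (λ j → A i j ℤ.* W g q (j ↑ˡ m))) p p′ (+ Q))
            where open ℤ-Solver
          room : ∀ i → free i * (b * b ^ suc (κ i)) ≤ Q ⊎ free i ≤ 1
          room i with 2 + κ i ≤? E
          ... | yes ≤E = inj₁ (≤-trans (≤-reflexive (trans (sym (^-distribˡ-+-* b (E ∸ (2 + κ i)) (2 + κ i)))
                                         (cong (b ^_) (m∸n+n≡m ≤E)))) b^E≤Q)
          ... | no  ≰E = inj₂ (≤-reflexive (cong (b ^_) (m≤n⇒m∸n≡0 (≰⇒≥ ≰E))))
          g≡g′ : g ≡ g′
          g≡g′ = lookup-ext g g′ λ i → perturbed-injective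
            {w = W g q (n ↑ʳ i)} {W g′ q′ (n ↑ʳ i)} {proj₁ (Δ∈ i)} 5≤b (m^n>0 b (suc (κ i))) (room i)
            (W-z {g} {q} q∈ i) (W-z {g′} {q′} q′∈ i) (proj₂ (Δ∈ i))
            (∈-box⁻ free (proj₁ (members p∈)) i) (∈-box⁻ free (proj₁ (members p′∈)) i)
          by-target : ∀ {g′} → g ≡ g′ → (∀ j → W g q (j ↑ˡ m) ≡ W g′ q′ (j ↑ˡ m)) → (g , q) ≡ (g′ , q′)
          by-target refl W≡ = cong (g ,_) (lookup-ext q q′ λ j → trans (sym (X-q q j))
            (trans (+ℤ-cancelˡ (v g (j ↑ˡ m)) _ _ (W≡ j)) (X-q q′ j)))

      class-dichotomy : AllPairs _#_ xs → ∀ E → b ^ E ≤ Q →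
        b ^ ∑ (λ i → E ∸ (2 + κ i)) * length xs ≤ b ^ (n + ∑ τ) ⊎
        Bounded b d (d * b ^ d) K D (∑ τ + ∑ (λ i → suc (κ i))) (length xs)
      class-dichotomy apart E b^E≤Q = Sum.map (count-dense E b^E≤Q)
        (subst (λ s → Bounded b d (d * b ^ d) K D s (length xs)) ∑-e) (dense-or-bounded apart)

    -- Choice of the scales and the bound for the whole sum

    module Core (m′ : ℕ) (m≡ : m ≡ suc m′) (t : Fin n → ℕ) (0<t : ∀ j → 0 < t j) where

      private
        2≤b : 2 ≤ b
        2≤b = ≤-trans (s≤s (s≤s z≤n)) 5≤b

      open Logarithm b 2≤b

      private
        E = lg Q
        τ : Fin n → ℕ
        τ j = suc (lg (t j))
        N = b ^ ∑ τ
        R = lg (D * N)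
        P = R + m
        β′ = d * b ^ d

      -- The entry kᵢ of the class vector: Q / |z q i| is 1 / ∥Lᵢ q∥, so this is about its
      -- logarithm.
      exponent : Vec ℤ n → Fin m → ℕ
      exponent q i = E ∸ lg ∣ z q i ∣

      key : Vec ℤ n → Vec ℕ m
      key q = Vec.tabulate (exponent q)

      private
        b^Em≤Q^m : b ^ (m * E) ≤ Q ^ m
        b^Em≤Q^m = ≤-trans (≤-reflexive (trans (cong (b ^_) (*-comm m E)) (sym (^-*-assoc b E m))))
          (^-monoˡ-≤ m (b^lg≤x 0<Q))

        Q^m≤b^ : Q ^ m ≤ b ^ (m * E + m)
        Q^m≤b^ = ≤-trans (^-monoˡ-≤ m (<⇒≤ (x<b^[1+lg] Q)))
          (≤-reflexive (trans (^-*-assoc b (suc E) m) (cong (b ^_) (trans (*-comm (suc E) m) (trans (*-suc m E) (+-comm m (m * E)))))))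

        N≤ : N ≤ b ^ n * ∏ t
        N≤ = begin
          b ^ ∑ τ                        ≡⟨ ∏-^ b τ ⟨
          ∏ (λ j → b * b ^ lg (t j))     ≤⟨ ∏-mono (λ j → *-monoʳ-≤ b (b^lg≤x (0<t j))) ⟩
          ∏ (λ j → b * t j)              ≡⟨ ∏-* (const b) t ⟩
          ∏ {n} (const b) * ∏ t          ≡⟨ cong (_* ∏ t) (∏-const n b) ⟩
          b ^ n * ∏ t                    ∎
          where open ≤-Reasoning

      module _ (qs : List (Vec ℤ n)) (qs! : Unique qs)
        (q≥0 : ∀ {q} → q ∈ qs → ∀ j → + 0 ℤ.≤ Vec.lookup q j)
        (q≤t : ∀ {q} → q ∈ qs → ∀ j → ∣ Vec.lookup q j ∣ ≤ t j)
        (z≤Q : ∀ {q} → q ∈ qs → ∀ i → ∣ z q i ∣ ≤ Q)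
        (z-large : ∀ {q} → q ∈ qs → Q ^ m ≤ D * (∏ (λ j → 1 ⊔ ∣ Vec.lookup q j ∣) * ∏ (λ i → ∣ z q i ∣)))
        (apart : AllPairs _#_ qs) where

        private
          module Member {q} (q∈ : q ∈ qs) where
            h : Fin m → ℕ
            h i = lg ∣ z q i ∣
            positive : 0 < D × 0 < ∏ (λ i → ∣ z q i ∣)
            positive = let 0<D , rest = *⁻-pos D _ (≤-trans (m^n>0 Q m) (z-large q∈)) in
              0<D , proj₂ (*⁻-pos (∏ (λ j → 1 ⊔ ∣ Vec.lookup q j ∣)) _ rest)
            0<z : ∀ i → 0 < ∣ z q i ∣
            0<z = ∏⁻-pos (λ i → ∣ z q i ∣) (proj₂ positive)
            h≤E : ∀ i → h i ≤ E
            h≤E i = ≤-pred (^-cancelʳ-< (≤-<-trans (b^lg≤x (0<z i)) (≤-<-trans (z≤Q q∈ i) (x<b^[1+lg] Q))))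
            0<DN : 0 < D * N
            0<DN = *-mono-≤ (proj₁ positive) (m^n>0 b (∑ τ))
            b^R≤ : b ^ R ≤ D * N
            b^R≤ = b^lg≤x 0<DN
            q<b^τ : ∀ j → ∣ Vec.lookup q j ∣ < b ^ τ j
            q<b^τ j = ≤-<-trans (q≤t q∈ j) (x<b^[1+lg] (t j))
            ∑-exponent : ∑ (exponent q) + ∑ h ≡ m * E
            ∑-exponent = trans (sym (∑-+ (exponent q) h)) (trans (∑-cong (λ i → m∸n+n≡m (h≤E i))) (∑-const m E))
            -- With k the exponents of q, b ^ (∑ k) b ^ (∑ h) ≤ Q ^ m, and `z-large` bounds Q ^ m by
            -- D N ∏ |z q i|. `P` exceeds R = lg (D N) by m because each of the m numbers |z q i| is
            -- only known to be below b ^ (1 + h i).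
            ∑-exponent≤P : ∑ (exponent q) ≤ P
            ∑-exponent≤P = ≤-pred (^-cancelʳ-< (*-cancelʳ-< (b ^ ∑ h) (b ^ ∑ (exponent q)) (b ^ suc P) (begin-strict
              b ^ ∑ (exponent q) * b ^ ∑ h             ≡⟨ trans (sym (^-distribˡ-+-* b (∑ (exponent q)) (∑ h))) (cong (b ^_) ∑-exponent) ⟩
              b ^ (m * E)                              ≤⟨ b^Em≤Q^m ⟩
              Q ^ m                                    ≤⟨ z-large q∈ ⟩
              D * (∏ (λ j → 1 ⊔ ∣ Vec.lookup q j ∣) * ∏ (λ i → ∣ z q i ∣))
                ≤⟨ *-monoʳ-≤ D (*-mono-≤ (∏-mono (λ j → ⊔-lub (m^n>0 b (τ j)) (<⇒≤ (q<b^τ j)))) (∏-mono (λ i → <⇒≤ (x<b^[1+lg] ∣ z q i ∣)))) ⟩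
              D * (∏ (λ j → b ^ τ j) * ∏ (λ i → b ^ suc (h i)))
                ≡⟨ cong₂ (λ x y → D * (x * y)) (∏-^ b τ) (trans (∏-^ b (suc ∘ h)) (cong (b ^_)
                     (trans (∑-+ (const 1) h) (cong (_+ ∑ h) (trans (∑-const m 1) (*-identityʳ m)))))) ⟩
              D * (N * b ^ (m + ∑ h))                  ≡⟨ cong (λ x → D * (N * x)) (^-distribˡ-+-* b m (∑ h)) ⟩
              D * (N * (b ^ m * b ^ ∑ h))              ≡⟨ solve 4 (λ D N x y → D :* (N :* (x :* y)) := D :* N :* (x :* y)) refl D N (b ^ m) (b ^ ∑ h) ⟩
              D * N * (b ^ m * b ^ ∑ h)                <⟨ *-monoˡ-< (b ^ m * b ^ ∑ h) {{m*n≢0 (b ^ m) (b ^ ∑ h) {{m^n≢0 b m}} {{m^n≢0 b (∑ h)}}}} (x<b^[1+lg] (D * N)) ⟩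
              b ^ suc R * (b ^ m * b ^ ∑ h)            ≡⟨ *-assoc (b ^ suc R) (b ^ m) (b ^ ∑ h) ⟨
              b ^ suc R * b ^ m * b ^ ∑ h              ≡⟨ cong (_* b ^ ∑ h) (^-distribˡ-+-* b (suc R) m) ⟨
              b ^ suc P * b ^ ∑ h                      ∎)))
              where
              open ≤-Reasoning
              open ℕ-Solver

        Q≤b^*z : ∀ {q} → q ∈ qs → ∀ i → Q ≤ b ^ suc (exponent q i) * ∣ z q i ∣
        Q≤b^*z {q} q∈ i = begin
          Q                                    ≤⟨ <⇒≤ (x<b^[1+lg] Q) ⟩
          b ^ suc E                            ≡⟨ cong (λ x → b ^ suc x) (m∸n+n≡m (h≤E i)) ⟨
          b ^ (suc (exponent q i) + h i)       ≡⟨ ^-distribˡ-+-* b (suc (exponent q i)) (h i) ⟩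
          b ^ suc (exponent q i) * b ^ h i     ≤⟨ *-monoʳ-≤ (b ^ suc (exponent q i)) (b^lg≤x (0<z i)) ⟩
          b ^ suc (exponent q i) * ∣ z q i ∣   ∎
          where
          open Member q∈
          open ≤-Reasoning

        key∈ : ∀ {q} → q ∈ qs → key q ∈ box (const (suc P))
        key∈ {q} q∈ = ∈-box⁺ _ (key q) λ i → s≤s (≤-trans (≤-reflexive (Vec.lookup∘tabulate (exponent q) i))
          (≤-trans (term≤∑ (exponent q) i) (Member.∑-exponent≤P q∈)))

        private
          fib : Vec ℕ m → List (Vec ℤ n)
          fib k = fibre (Vec.≡-dec _≟_) key k qs

          fib⁻ : ∀ {k q} → q ∈ fib k → q ∈ qs × key q ≡ k
          fib⁻ {k} q∈ = ∈.∈-filter⁻ (λ x → Vec.≡-dec _≟_ (key x) k) q∈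

          C₁ = b ^ (m * 3 + n)
          C₂ = b ^ (m * 2 + d)

          -- The member `q₀` is needed to know that `D` is positive and that s ≤ P. In this class lg
          -- |z q i| = g i, hence |z q i| < b ^ (1 + g i) and κ i = 1 + g i.
          class-bound′ : ∀ k {q₀} → q₀ ∈ fib k →
            length (fib k) * b ^ Vec.sum k ≤ C₁ * N ⊎
            length (fib k) * b ^ Vec.sum k * suc β′ ^ P ≤ C₂ * (D * N) * weight β′ P (Vec.sum k)
          class-bound′ k {q₀} q₀∈ = Sum.map
            (dense-class {b} {n} {m} {s} {∑ f} {∑ τ} {M} s≤)
            (λ bounded → ≤-trans (bounded-class {b} {d} {m} {β′} {K} {D} {s} {∑ g} {E} {R} {∑ τ} {M} ∑g+s b^Em≤Q^m Q^m≤b^ b^R≤ s≤P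
                (subst (λ x → Bounded b d β′ K D (∑ τ + x) M) ∑-2+g bounded))
              (≤-reflexive (cong (λ x → C₂ * (D * N) * x) (sym (weight≡ {β′} {P} s≤P)))))
            (Class.class-dichotomy τ (λ _ → s≤s z≤n) (λ i → suc (g i)) (fib k)
              (Unique.filter⁺ (λ x → Vec.≡-dec _≟_ (key x) k) qs!)
              (λ q∈ → q≥0 (proj₁ (fib⁻ q∈)))
              (λ q∈ j → Member.q<b^τ (proj₁ (fib⁻ q∈)) j)
              (λ {q} q∈ i → subst (λ x → ∣ z q i ∣ < b ^ suc x) (lg-z≡ q∈ i) (x<b^[1+lg] ∣ z q i ∣))
              (AllPairs.filter⁺ (λ x → Vec.≡-dec _≟_ (key x) k) apart) E (b^lg≤x 0<Q))
            where
            open Member (proj₁ (fib⁻ q₀∈)) using (∑-exponent≤P; ∑-exponent; b^R≤)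
            exponent≡ : ∀ {q} → q ∈ fib k → ∀ i → exponent q i ≡ Vec.lookup k i
            exponent≡ {q} q∈ i = trans (sym (Vec.lookup∘tabulate (exponent q) i)) (cong (λ k → Vec.lookup k i) (proj₂ (fib⁻ q∈)))
            g : Fin m → ℕ
            g i = E ∸ Vec.lookup k i
            lg-z≡ : ∀ {q} → q ∈ fib k → ∀ i → lg ∣ z q i ∣ ≡ g i
            lg-z≡ q∈ i = trans (sym (m∸[m∸n]≡n (Member.h≤E (proj₁ (fib⁻ q∈)) i))) (cong (E ∸_) (exponent≡ q∈ i))
            s = Vec.sum k
            M = length (fib k)
            s≡ : s ≡ ∑ (Vec.lookup k)
            s≡ = sum-lookup k
            s≡′ : s ≡ ∑ (exponent q₀)
            s≡′ = trans s≡ (∑-cong (λ i → sym (exponent≡ q₀∈ i)))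
            k≡ : ∀ i → Vec.lookup k i ≡ E ∸ g i
            k≡ i = trans (sym (exponent≡ q₀∈ i)) (cong (E ∸_) (lg-z≡ q₀∈ i))
            s≤P : s ≤ P
            s≤P = ≤-trans (≤-reflexive s≡′) ∑-exponent≤P
            ∑g+s : ∑ g + s ≡ m * E
            ∑g+s = trans (+-comm (∑ g) s) (trans (cong₂ _+_ s≡′ (∑-cong (λ i → sym (lg-z≡ q₀∈ i)))) ∑-exponent)
            ∑-2+g : ∑ (λ i → 2 + g i) ≡ m * 2 + ∑ g
            ∑-2+g = trans (∑-+ (const 2) g) (cong (_+ ∑ g) (∑-const m 2))
            -- The logarithm of the number of translates: 3 is 2 from the grid spacing b ^ (2 + κ i)
            -- and 1 from κ i = 1 + g i.
            f : Fin m → ℕ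
            f i = E ∸ (3 + g i)
            s≤ : s ≤ m * 3 + ∑ f
            s≤ = begin
              s                        ≡⟨ s≡ ⟩
              ∑ (Vec.lookup k)         ≤⟨ ∑-mono (λ i → ≤-trans (m≤n+m∸n (Vec.lookup k i) 3) (≤-reflexive (cong (λ x → 3 + x)
                                            (trans (cong (_∸ 3) (k≡ i)) (trans (∸-+-assoc E (g i) 3) (cong (E ∸_) (+-comm (g i) 3))))))) ⟩
              ∑ (λ i → 3 + f i)        ≡⟨ ∑-+ (const 3) f ⟩
              ∑ {m} (const 3) + ∑ f    ≡⟨ cong (_+ ∑ f) (∑-const m 3) ⟩
              m * 3 + ∑ f              ∎
              where open ≤-Reasoning

          Goal : ℕ → ℕ → Set
          Goal s M = M * b ^ s * suc β′ ^ P ≤ C₁ * N * suc β′ ^ P + C₂ * (D * N) * weight β′ P s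

          class-bound : ∀ k → Goal (Vec.sum k) (length (fib k))
          class-bound k = by-cases (fib k) refl
            where
            by-cases : ∀ xs → fib k ≡ xs → Goal (Vec.sum k) (length (fib k))
            by-cases []      eq = subst (Goal (Vec.sum k) ∘ length) (sym eq) z≤n
            by-cases (q ∷ _) eq =
              [ (λ h → ≤-trans (*-monoˡ-≤ (suc β′ ^ P) h) (m≤m+n (C₁ * N * suc β′ ^ P) (C₂ * (D * N) * weight β′ P (Vec.sum k))))
              , (λ h → ≤-trans h (m≤n+m (C₂ * (D * N) * weight β′ P (Vec.sum k)) (C₁ * N * suc β′ ^ P))) ]′
              (class-bound′ k {q} (subst (q ∈_) (sym eq) (here refl)))

        -- N ≤ b ^ n ∏ t gives R ≤ n + ρ, so every kᵢ takes at most P + 1 ≤ (2 + d) ρ values. `ρ`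
        -- stands for log (T̄ / φ (T̄)) up to constants.
        ∑-bound : ∀ ρ → 0 < ρ → D * ∏ t ≤ b ^ ρ →
          ∑ₗ qs (λ q → b ^ ∑ (exponent q)) ≤
          (2 + d) ^ m * b ^ n * (b ^ (m * 3 + n) + b ^ (m * 2 + d) * suc (d * b ^ d)) * (∏ t * ρ ^ m + D * ∏ t * ρ ^ m′)
        ∑-bound ρ 0<ρ D∏t≤ = collect-constants {C₁ = C₁} {C₂ * suc β′} {D} {N} {b ^ n} {∏ t} {2 + d} {ρ} {suc P} {m} {m′}
          (≤-trans (n≤1+n m′) (≤-reflexive (sym m≡))) N≤ sucP≤
          (≤-trans (∑ₗ-mono qs λ {q} _ → ≤-reflexive (cong (b ^_) (sym (sum-key q))))
            (≤-trans (∑-classes b β′ P (C₁ * N) (C₂ * (D * N)) m≡ key qs key∈ class-bound)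
              (≤-reflexive (cong (λ x → C₁ * N * suc P ^ m + x * suc P ^ m′)
                (solve 3 (λ c y β → c :* y :* β := c :* β :* y) refl C₂ (D * N) (suc β′))))))
          where
          open ≤-Reasoning
          open ℕ-Solver
          sum-key : ∀ q → Vec.sum (key q) ≡ ∑ (exponent q)
          sum-key q = trans (sum-lookup (key q)) (∑-cong (Vec.lookup∘tabulate (exponent q)))
          R≤ : R ≤ n + ρ
          R≤ = lg≤ (D * N) (begin
            D * N                 ≤⟨ *-monoʳ-≤ D N≤ ⟩
            D * (b ^ n * ∏ t)     ≡⟨ solve 3 (λ D B T → D :* (B :* T) := B :* (D :* T)) refl D (b ^ n) (∏ t) ⟩
            b ^ n * (D * ∏ t)     ≤⟨ *-monoʳ-≤ (b ^ n) D∏t≤ ⟩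
            b ^ n * b ^ ρ         ≡⟨ ^-distribˡ-+-* b n ρ ⟨
            b ^ (n + ρ)           ∎)
          sucP≤ : suc P ≤ (2 + d) * ρ
          sucP≤ = begin
            suc (R + m)         ≤⟨ s≤s (+-monoˡ-≤ m R≤) ⟩
            suc (n + ρ + m)     ≡⟨ solve 3 (λ n r m → con 1 :+ (n :+ r :+ m) := r :+ (con 1 :+ (n :+ m))) refl n ρ m ⟩
            ρ + suc d           ≤⟨ +-monoʳ-≤ ρ (m≤m*n (suc d) ρ {{>-nonZero 0<ρ}}) ⟩
            ρ + suc d * ρ       ∎

open import Defs using (module Rational)

-- From integers to a matrix of rationals

module RationalCase where
  open import Data.Rational.Base
  open import Data.Rational.Properties
  open Rational hiding (∣-∣-+; ∣-∣-*)
  open ℚ-Solver using (solve; _:=_; _:+_; _:*_; _:-_; :-_; con)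
  open ℕ-Solver using () renaming (_:=_ to _≋_; _:+_ to _⊞_; _:*_ to _⊠_)
  open Counting using (∏; ∑; ∑ℤ; ∑ₗ; ∏-^; ∑-+; ∑-const; module Logarithm)
  open RawSemiringOps +-*-rawSemiring using (_^_) renaming (sum to ∑ℚ; product to ∏ℚ) public

  ι : ℕ → ℚ
  ι n = fromℤ (+ n)

  fromℤ-+ : ∀ x y → fromℤ (x ℤ.+ y) ≡ fromℤ x + fromℤ y
  fromℤ-+ x y = trans (cong fromℤ (sym (cong₂ ℤ._+_ (ℤ.*-identityʳ x) (ℤ.*-identityʳ y))))
    (sym (cong₂ _+_ (fromℤ-mkℚ x) (fromℤ-mkℚ y)))

  fromℤ-* : ∀ x y → fromℤ (x ℤ.* y) ≡ fromℤ x * fromℤ y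
  fromℤ-* x y = sym (cong₂ _*_ (fromℤ-mkℚ x) (fromℤ-mkℚ y))

  fromℤ-minus : ∀ x y → fromℤ (x ℤ.- y) ≡ fromℤ x - fromℤ y
  fromℤ-minus x y = trans (fromℤ-+ x (ℤ.- y)) (cong (λ p → fromℤ x + p) (fromℤ-neg y))

  fromℤ-≤⁻ : ∀ {x y} → fromℤ x ≤ fromℤ y → x ℤ.≤ y
  fromℤ-≤⁻ {x} {y} h with subst₂ _≤_ (fromℤ-mkℚ x) (fromℤ-mkℚ y) h
  ... | *≤* h′ = subst₂ ℤ._≤_ (ℤ.*-identityʳ x) (ℤ.*-identityʳ y) h′

  ι-+ : ∀ a b → ι (a ℕ.+ b) ≡ ι a + ι b
  ι-+ a b = trans (cong fromℤ (ℤ.pos-+ a b)) (fromℤ-+ (+ a) (+ b))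

  ι-* : ∀ a b → ι (a ℕ.* b) ≡ ι a * ι b
  ι-* a b = trans (cong fromℤ (ℤ.pos-* a b)) (fromℤ-* (+ a) (+ b))

  ι-mono : ∀ {a b} → a ℕ.≤ b → ι a ≤ ι b
  ι-mono h = fromℤ-mono (ℤ.+≤+ h)

  ι-≤⁻ : ∀ {a b} → ι a ≤ ι b → a ℕ.≤ b
  ι-≤⁻ h = ℤ.drop‿+≤+ (fromℤ-≤⁻ h)

  ι-nonneg : ∀ a → 0ℚ ≤ ι a
  ι-nonneg a = ι-mono {0} {a} ℕ.z≤n

  ι-pos : ∀ {a} → 0 ℕ.< a → 0ℚ < ι a
  ι-pos {a} h = <-≤-trans 0<1 (ι-mono {1} {a} h)

  ι-^ : ∀ a n → ι (a ℕ.^ n) ≡ ι a ^ n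
  ι-^ a zero    = refl
  ι-^ a (suc n) = trans (ι-* a (a ℕ.^ n)) (cong (ι a *_) (ι-^ a n))

  ι-∏ : ∀ {d} (f : Fin d → ℕ) → ι (∏ f) ≡ ∏ℚ (ι ∘ f)
  ι-∏ {zero}  f = refl
  ι-∏ {suc d} f = trans (ι-* (f zero) (∏ (f ∘ suc))) (cong (ι (f zero) *_) (ι-∏ (f ∘ suc)))

  ι-∣∣ : ∀ x → ι ℤ.∣ x ∣ ≡ ∣ fromℤ x ∣
  ι-∣∣ (+ n)    = sym (0≤p⇒∣p∣≡p (ι-nonneg n))
  ι-∣∣ -[1+ n ] = trans (sym (0≤p⇒∣p∣≡p (ι-nonneg (suc n)))) (trans (sym (∣-p∣≡∣p∣ (ι (suc n))))
    (cong ∣_∣ (sym (fromℤ-neg (+ suc n)))))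

  ∏ℚ-cong : ∀ {d} {f g : Fin d → ℚ} → (∀ i → f i ≡ g i) → ∏ℚ f ≡ ∏ℚ g
  ∏ℚ-cong {zero}  h = refl
  ∏ℚ-cong {suc d} h = cong₂ _*_ (h zero) (∏ℚ-cong (h ∘ suc))

  ∑ℚ-cong : ∀ {d} {f g : Fin d → ℚ} → (∀ i → f i ≡ g i) → ∑ℚ f ≡ ∑ℚ g
  ∑ℚ-cong {zero}  h = refl
  ∑ℚ-cong {suc d} h = cong₂ _+_ (h zero) (∑ℚ-cong (h ∘ suc))

  ∏ℚ-nonneg : ∀ {d} {f : Fin d → ℚ} → (∀ i → 0ℚ ≤ f i) → 0ℚ ≤ ∏ℚ f
  ∏ℚ-nonneg {zero}  h = 0≤1
  ∏ℚ-nonneg {suc d} h = *-nonneg (h zero) (∏ℚ-nonneg (h ∘ suc))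

  ∏ℚ-mono : ∀ {d} {f g : Fin d → ℚ} → (∀ i → 0ℚ ≤ f i) → (∀ i → f i ≤ g i) → ∏ℚ f ≤ ∏ℚ g
  ∏ℚ-mono {zero}  h h′ = ≤-refl
  ∏ℚ-mono {suc d} h h′ = *-mono (h zero) (≤-trans (∏ℚ-nonneg (h ∘ suc)) (∏ℚ-mono (h ∘ suc) (h′ ∘ suc)))
    (h′ zero) (∏ℚ-mono (h ∘ suc) (h′ ∘ suc))

  ∏ℚ-scale : ∀ {d} c (f : Fin d → ℚ) → ∏ℚ (λ i → c * f i) ≡ c ^ d * ∏ℚ f
  ∏ℚ-scale {zero}  c f = refl
  ∏ℚ-scale {suc d} c f = trans (cong (c * f zero *_) (∏ℚ-scale c (f ∘ suc)))
    (solve 4 (λ c x p y → c :* x :* (p :* y) := c :* p :* (x :* y)) refl c (f zero) (c ^ d) (∏ℚ (f ∘ suc)))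

  ∑ℚ-*ˡ : ∀ {d} c (f : Fin d → ℚ) → ∑ℚ (λ i → c * f i) ≡ c * ∑ℚ f
  ∑ℚ-*ˡ {zero}  c f = sym (*-zeroʳ c)
  ∑ℚ-*ˡ {suc d} c f = trans (cong (λ s → c * f zero + s) (∑ℚ-*ˡ c (f ∘ suc))) (sym (*-distribˡ-+ c (f zero) (∑ℚ (f ∘ suc))))

  ∑ℚ-minus : ∀ {d} (f g : Fin d → ℚ) → ∑ℚ (λ i → f i - g i) ≡ ∑ℚ f - ∑ℚ g
  ∑ℚ-minus {zero}  f g = refl
  ∑ℚ-minus {suc d} f g = trans (cong (λ s → f zero - g zero + s) (∑ℚ-minus (f ∘ suc) (g ∘ suc)))
    (solve 4 (λ a b c d → (a :- b) :+ (c :- d) := (a :+ c) :- (b :+ d)) refl (f zero) (g zero) (∑ℚ (f ∘ suc)) (∑ℚ (g ∘ suc)))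

  fromℤ-∑ : ∀ {d} (f : Fin d → ℤ) → fromℤ (∑ℤ f) ≡ ∑ℚ (fromℤ ∘ f)
  fromℤ-∑ {zero}  f = refl
  fromℤ-∑ {suc d} f = trans (fromℤ-+ (f zero) (∑ℤ (f ∘ suc))) (cong (λ s → fromℤ (f zero) + s) (fromℤ-∑ (f ∘ suc)))

  denominator-* : ∀ p → ∃[ d ] ∃[ a ] (0 ℕ.< d × fromℤ a ≡ ι d * p)
  denominator-* p@(mkℚ a d-1 c) = suc d-1 , a , ℕ.s≤s ℕ.z≤n , sym (begin
    ι (suc d-1) * p                           ≡⟨ cong (ι (suc d-1) *_) (sym (↥p/↧p≡p p)) ⟩
    ι (suc d-1) * (a / suc d-1)               ≡⟨ cong (ι (suc d-1) *_) a/d ⟩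
    ι (suc d-1) * (1/suc d-1 * fromℤ a)       ≡⟨ *-assoc (ι (suc d-1)) (1/suc d-1) (fromℤ a) ⟨
    ι (suc d-1) * 1/suc d-1 * fromℤ a         ≡⟨ cong (_* fromℤ a) (1/suc-inverse d-1) ⟩
    1ℚ * fromℤ a                              ≡⟨ *-identityˡ (fromℤ a) ⟩
    fromℤ a                                   ∎)
    where
    open ≡-Reasoning
    a/d : a / suc d-1 ≡ 1/suc d-1 * fromℤ a
    a/d = sym (trans (cong₂ _*_ (1/suc-mkℚ d-1) (fromℤ-mkℚ a))
      (cong₂ (λ x y → (x / suc y)) (ℤ.*-identityˡ a) (ℕ.*-identityʳ d-1)))

  common-denominator : ∀ {n} (x : Fin n → ℚ) → ∃[ d ] (0 ℕ.< d × ∀ j → ∃[ a ] fromℤ a ≡ ι d * x j)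
  common-denominator {zero}  x = 1 , ℕ.s≤s ℕ.z≤n , λ ()
  common-denominator {suc n} x with denominator-* (x zero) | common-denominator (x ∘ suc)
  ... | d , a , 0<d , eq | d′ , 0<d′ , as = d ℕ.* d′ , ℕ.*-mono-≤ 0<d 0<d′ , λ where
    zero    → + d′ ℤ.* a , trans (fromℤ-* (+ d′) a) (trans (cong (ι d′ *_) eq)
      (trans (solve 3 (λ d′ d x → d′ :* (d :* x) := d :* d′ :* x) refl (ι d′) (ι d) (x zero)) (cong (_* x zero) (sym (ι-* d d′)))))
    (suc j) → let a′ , eq′ = as j in + d ℤ.* a′ , trans (fromℤ-* (+ d) a′) (trans (cong (ι d *_) eq′)
      (trans (sym (*-assoc (ι d) (ι d′) (x (suc j)))) (cong (_* x (suc j)) (sym (ι-* d d′)))))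

  common-denominator₂ : ∀ {m n} (x : Fin m → Fin n → ℚ) → ∃[ d ] (0 ℕ.< d × ∀ i j → ∃[ a ] fromℤ a ≡ ι d * x i j)
  common-denominator₂ {zero}  x = 1 , ℕ.s≤s ℕ.z≤n , λ ()
  common-denominator₂ {suc m} x with common-denominator (x zero) | common-denominator₂ (x ∘ suc)
  ... | d , 0<d , as | d′ , 0<d′ , as′ = d ℕ.* d′ , ℕ.*-mono-≤ 0<d 0<d′ , λ where
    zero    j → let a , eq = as j in + d′ ℤ.* a , trans (fromℤ-* (+ d′) a) (trans (cong (ι d′ *_) eq)
      (trans (solve 3 (λ d′ d x → d′ :* (d :* x) := d :* d′ :* x) refl (ι d′) (ι d) (x zero j)) (cong (_* x zero j) (sym (ι-* d d′)))))
    (suc i) j → let a , eq = as′ i j in + d ℤ.* a , trans (fromℤ-* (+ d) a) (trans (cong (ι d *_) eq)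
      (trans (sym (*-assoc (ι d) (ι d′) (x (suc i) j))) (cong (_* x (suc i) j) (sym (ι-* d d′)))))

  rowℚ : ∀ {n} → (Fin n → ℚ) → Vec ℤ n → ℚ
  rowℚ x q = ∑ℚ (λ j → x j * fromℤ (Vec.lookup q j))

  infixl 6 _⊝_
  _⊝_ : ∀ {n} → Vec ℤ n → Vec ℤ n → Vec ℤ n
  _⊝_ = Vec.zipWith ℤ._-_

  rowℚ-⊝ : ∀ {n} (x : Fin n → ℚ) q q′ → rowℚ x (q ⊝ q′) ≡ rowℚ x q - rowℚ x q′
  rowℚ-⊝ x q q′ = trans
    (∑ℚ-cong λ j → trans (cong (λ z → x j * fromℤ z) (Vec.lookup-zipWith ℤ._-_ j q q′))
      (trans (cong (x j *_) (fromℤ-minus (Vec.lookup q j) (Vec.lookup q′ j)))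
        (solve 3 (λ x a b → x :* (a :- b) := x :* a :- x :* b) refl (x j) (fromℤ (Vec.lookup q j)) (fromℤ (Vec.lookup q′ j)))))
    (∑ℚ-minus (λ j → x j * fromℤ (Vec.lookup q j)) (λ j → x j * fromℤ (Vec.lookup q′ j)))

  ∑ₗℚ : ∀ {I : Set} → List I → (I → ℚ) → ℚ
  ∑ₗℚ xs f = List.foldr (λ a s → f a + s) 0ℚ xs

  ∑ₗℚ-≤ : ∀ {I : Set} c (f : I → ℚ) (g : I → ℕ) xs → (∀ {x} → x ∈ xs → f x ≤ c * ι (g x)) → ∑ₗℚ xs f ≤ c * ι (∑ₗ xs g)
  ∑ₗℚ-≤ c f g []       h = ≤-reflexive (sym (*-zeroʳ c))
  ∑ₗℚ-≤ c f g (x ∷ xs) h = subst (f x + ∑ₗℚ xs f ≤_)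
    (trans (sym (*-distribˡ-+ c (ι (g x)) (ι (∑ₗ xs g)))) (cong (c *_) (sym (ι-+ (g x) (∑ₗ xs g)))))
    (+-mono-≤ (h (here refl)) (∑ₗℚ-≤ c f g xs (h ∘ there)))

  abs⁺ : ∀ {n} → Vec ℤ n → Fin n → ℕ
  abs⁺ q j = 1 ℕ.⊔ ℤ.∣ Vec.lookup q j ∣

  -- z q is Q times the vector of signed distances of the rows from the nearest integers.
  module Integral {m n} (x : Fin m → Fin n → ℚ) (Q : ℕ) (0<Q : 0 ℕ.< Q)
    (integral : ∀ i j → ∃[ a ] fromℤ a ≡ ι Q * x i j) where

    A : Fin m → Fin n → ℤ
    A i j = proj₁ (integral i j)

    z : Vec ℤ n → Fin m → ℤ
    z q i = ∑ℤ (λ j → A i j ℤ.* Vec.lookup q j) ℤ.+ (ℤ.- round (rowℚ (x i) q)) ℤ.* + Q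

    private
      0≤Q = ι-nonneg Q

    fromℤ-z : ∀ q i → fromℤ (z q i) ≡ ι Q * (rowℚ (x i) q - fromℤ (round (rowℚ (x i) q)))
    fromℤ-z q i = begin
      fromℤ (z q i)
        ≡⟨ fromℤ-+ (∑ℤ (λ j → A i j ℤ.* Vec.lookup q j)) _ ⟩
      fromℤ (∑ℤ (λ j → A i j ℤ.* Vec.lookup q j)) + fromℤ ((ℤ.- r) ℤ.* + Q)
        ≡⟨ cong₂ _+_ (trans (fromℤ-∑ (λ j → A i j ℤ.* Vec.lookup q j)) (trans (∑ℚ-cong entry) (∑ℚ-*ˡ (ι Q) (λ j → x i j * fromℤ (Vec.lookup q j)))))
             (trans (fromℤ-* (ℤ.- r) (+ Q)) (cong (_* ι Q) (fromℤ-neg r))) ⟩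
      ι Q * rowℚ (x i) q + (- fromℤ r) * ι Q
        ≡⟨ solve 3 (λ Q y r → Q :* y :+ (:- r) :* Q := Q :* (y :- r)) refl (ι Q) (rowℚ (x i) q) (fromℤ r) ⟩
      ι Q * (rowℚ (x i) q - fromℤ r) ∎
      where
      open ≡-Reasoning
      r = round (rowℚ (x i) q)
      entry : ∀ j → fromℤ (A i j ℤ.* Vec.lookup q j) ≡ ι Q * (x i j * fromℤ (Vec.lookup q j))
      entry j = trans (fromℤ-* (A i j) (Vec.lookup q j)) (trans (cong (_* fromℤ (Vec.lookup q j)) (proj₂ (integral i j)))
        (*-assoc (ι Q) (x i j) (fromℤ (Vec.lookup q j))))

    ι-∣Q*∣ : ∀ y p → fromℤ y ≡ ι Q * p → ι ℤ.∣ y ∣ ≡ ι Q * ∣ p ∣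
    ι-∣Q*∣ y p eq = trans (ι-∣∣ y) (trans (cong ∣_∣ eq) (trans (∣p*q∣≡∣p∣*∣q∣ (ι Q) p) (cong (_* ∣ p ∣) (0≤p⇒∣p∣≡p 0≤Q))))

    ι-∣z∣ : ∀ q i → ι ℤ.∣ z q i ∣ ≡ ι Q * ∥ rowℚ (x i) q ∥
    ι-∣z∣ q i = ι-∣Q*∣ (z q i) (rowℚ (x i) q - fromℤ (round (rowℚ (x i) q))) (fromℤ-z q i)

    ∣z∣≤Q : ∀ q i → ℤ.∣ z q i ∣ ℕ.≤ Q
    ∣z∣≤Q q i = ι-≤⁻ (subst₂ _≤_ (sym (ι-∣z∣ q i)) (*-identityʳ (ι Q))
      (*-monoˡ (ι Q) 0≤Q (≤-trans (∥∥≤½ (rowℚ (x i) q)) (≤-by ½ 0≤½ refl))))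

    -- z q i - z q′ i is `Q` times the difference between the row value at q - q′ and an integer,
    -- which need not be the nearest one.
    ∣Δz∣≥ : ∀ q q′ i → ι Q * ∥ rowℚ (x i) (q ⊝ q′) ∥ ≤ ι ℤ.∣ z q i ℤ.- z q′ i ∣
    ∣Δz∣≥ q q′ i = subst (ι Q * ∥ y⊝y′ ∥ ≤_) (sym (ι-∣Q*∣ (z q i ℤ.- z q′ i) (y⊝y′ - fromℤ (r ℤ.- r′)) eq))
      (*-monoˡ (ι Q) 0≤Q (∥∥-minimal y⊝y′ (r ℤ.- r′)))
      where
      y = rowℚ (x i) q
      y′ = rowℚ (x i) q′
      y⊝y′ = rowℚ (x i) (q ⊝ q′)
      r = round y
      r′ = round y′
      eq : fromℤ (z q i ℤ.- z q′ i) ≡ ι Q * (y⊝y′ - fromℤ (r ℤ.- r′))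
      eq = trans (fromℤ-minus (z q i) (z q′ i)) (trans (cong₂ _-_ (fromℤ-z q i) (fromℤ-z q′ i))
        (trans (solve 5 (λ Q y r y′ r′ → Q :* (y :- r) :- Q :* (y′ :- r′) := Q :* ((y :- y′) :- (r :- r′))) refl (ι Q) y (fromℤ r) y′ (fromℤ r′))
          (cong₂ (λ u v → ι Q * (u - v)) (sym (rowℚ-⊝ (x i) q q′)) (sym (fromℤ-minus r r′)))))

    module _ {φ₀ : ℚ} (D : ℕ) (1≤φ₀D : 1ℚ ≤ φ₀ * ι D) where

      -- Multiplication by Q ^ m D clears the denominators, as φ₀ D ≥ 1. `w` is |z q| for a point
      -- and |z q - z q′| for a pair; in the second case Q y ≤ w may be strict.
      large : ∀ (a : ℕ) (y : Fin m → ℚ) (w : Fin m → ℕ) → (∀ i → 0ℚ ≤ y i) → (∀ i → ι Q * y i ≤ ι (w i)) →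
              φ₀ ≤ ι a * ∏ℚ y → Q ℕ.^ m ℕ.≤ D ℕ.* (a ℕ.* ∏ w)
      large a y w y≥0 Qy≤w φ₀≤ = ι-≤⁻ (begin
        ι (Q ℕ.^ m)                          ≡⟨ trans (ι-^ Q m) (sym (*-identityʳ _)) ⟩
        ι Q ^ m * 1ℚ                         ≤⟨ *-monoˡ (ι Q ^ m) Q^m≥0 (≤-trans 1≤φ₀D (*-monoʳ (ι D) (ι-nonneg D) φ₀≤)) ⟩
        ι Q ^ m * (ι a * ∏ℚ y * ι D)         ≡⟨ solve 4 (λ Q a y D → Q :* (a :* y :* D) := D :* (a :* (Q :* y))) refl (ι Q ^ m) (ι a) (∏ℚ y) (ι D) ⟩
        ι D * (ι a * (ι Q ^ m * ∏ℚ y))       ≡⟨ cong (λ p → ι D * (ι a * p)) (∏ℚ-scale (ι Q) y) ⟨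
        ι D * (ι a * ∏ℚ (λ i → ι Q * y i))   ≤⟨ *-monoˡ (ι D) (ι-nonneg D) (*-monoˡ (ι a) (ι-nonneg a) (∏ℚ-mono (λ i → *-nonneg 0≤Q (y≥0 i)) Qy≤w)) ⟩
        ι D * (ι a * ∏ℚ (ι ∘ w))             ≡⟨ cong (λ p → ι D * (ι a * p)) (ι-∏ w) ⟨
        ι D * (ι a * ι (∏ w))                ≡⟨ trans (cong (ι D *_) (sym (ι-* a (∏ w)))) (sym (ι-* D (a ℕ.* ∏ w))) ⟩
        ι (D ℕ.* (a ℕ.* ∏ w))                ∎)
        where
        open ≤-Reasoning
        Q^m≥0 = ^-nonneg m 0≤Q

  recip-≤ : ∀ {B y} → 0ℚ ≤ y → 0ℚ ≤ B → 1ℚ ≤ B * y → recip y ≤ B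
  recip-≤ {B} {y} 0≤y 0≤B 1≤By = begin
    recip y               ≡⟨ *-identityʳ (recip y) ⟨
    recip y * 1ℚ          ≤⟨ *-monoˡ (recip y) (<⇒≤ (recip-pos 0<y)) 1≤By ⟩
    recip y * (B * y)     ≡⟨ solve 3 (λ r B y → r :* (B :* y) := B :* (y :* r)) refl (recip y) B y ⟩
    B * (y * recip y)     ≡⟨ cong (B *_) (recip-inverse 0<y) ⟩
    B * 1ℚ                ≡⟨ *-identityʳ B ⟩
    B                     ∎
    where
    open ≤-Reasoning
    0<y : 0ℚ < y
    0<y = ≰⇒> λ y≤0 → <-irrefl refl (<-≤-trans 0<1 (≤-trans 1≤By
      (≤-trans (*-monoˡ B 0≤B y≤0) (≤-reflexive (*-zeroʳ B)))))

  recip-nonneg : ∀ {y} → 0ℚ ≤ y → 0ℚ ≤ recip y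
  recip-nonneg {y} 0≤y with <-cmp 0ℚ y
  ... | tri< 0<y _ _    = <⇒≤ (recip-pos 0<y)
  ... | tri≈ _ refl _   = ≤-refl
  ... | tri> _ _ y<0    = contradiction (≤-<-trans 0≤y y<0) (<-irrefl refl)

  constant : (b n m : ℕ) → ℕ
  constant b n m = (2 ℕ.+ d) ℕ.^ m ℕ.* b ℕ.^ n ℕ.* (b ℕ.^ (m ℕ.* 3 ℕ.+ n) ℕ.+ b ℕ.^ (m ℕ.* 2 ℕ.+ d) ℕ.* suc (d ℕ.* b ℕ.^ d))
    where d = n ℕ.+ m

  -- The factor b ^ m comes from rounding m logarithms in 1 / ∥Lᵢ q∥ ≤ b ^ (1 + kᵢ). The bound is
  -- independent of the common denominator, so it holds alike for arbitrarily fine approximations of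
  -- a real matrix.
  rational-bound : ∀ {b n m m′} → 5 ℕ.≤ b → Fin m → m ≡ suc m′ → (x : Fin m → Fin n → ℚ) →
    ∀ {φ₀} D → 1ℚ ≤ φ₀ * ι D → (t : Fin n → ℕ) → (∀ j → 0 ℕ.< t j) →
    ∀ qs → Unique qs → (∀ {q} → q ∈ qs → ∀ j → + 0 ℤ.≤ Vec.lookup q j × ℤ.∣ Vec.lookup q j ∣ ℕ.≤ t j) →
    (∀ {q} → q ∈ qs → φ₀ ≤ ι (∏ (abs⁺ q)) * ∏ℚ (λ i → ∥ rowℚ (x i) q ∥)) →
    AllPairs (λ q q′ → φ₀ ≤ ι (∏ (abs⁺ (q ⊝ q′))) * ∏ℚ (λ i → ∥ rowℚ (x i) (q ⊝ q′) ∥)) qs →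
    ∀ ρ → 0 ℕ.< ρ → D ℕ.* ∏ t ℕ.≤ b ℕ.^ ρ →
    ∑ₗℚ qs (λ q → ∏ℚ (λ i → recip ∥ rowℚ (x i) q ∥)) ≤
    ι (b ℕ.^ m) * ι (constant b n m ℕ.* (∏ t ℕ.* ρ ℕ.^ m ℕ.+ D ℕ.* ∏ t ℕ.* ρ ℕ.^ m′))
  rational-bound {b} {n} {m} {m′} 5≤b i₀ m≡ x {φ₀} D 1≤φ₀D t 0<t qs qs! in-box bad bad-pairs ρ 0<ρ D∏t≤ =
    apply (common-denominator₂ x)
    where
    apply : ∃[ Q ] (0 ℕ.< Q × ∀ i j → ∃[ a ] fromℤ a ≡ ι Q * x i j) → _
    apply (Q , 0<Q , integral) = ≤-trans
      (∑ₗℚ-≤ (ι (b ℕ.^ m)) (λ q → ∏ℚ (λ i → recip ∥ rowℚ (x i) q ∥)) (λ q → b ℕ.^ ∑ (exponent q)) qs summand)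
      (*-monoˡ (ι (b ℕ.^ m)) (ι-nonneg (b ℕ.^ m)) (ι-mono {∑ₗ qs (λ q → b ℕ.^ ∑ (exponent q))}
        (Counting.Orbit.Core.∑-bound b n m 5≤b i₀ Q 0<Q A z lattice D m′ m≡ t 0<t
          qs qs! q≥0 q≤t z≤Q z-large apart ρ 0<ρ D∏t≤)))
      where
      open Integral x Q 0<Q integral
      lattice : ∀ q i → ∃[ p ] z q i ≡ ∑ℤ (λ j → A i j ℤ.* Vec.lookup q j) ℤ.+ p ℤ.* + Q
      lattice q i = ℤ.- round (rowℚ (x i) q) , refl
      exponent : Vec ℤ n → Fin m → ℕ
      exponent = Counting.Orbit.Core.exponent b n m 5≤b i₀ Q 0<Q A z lattice D m′ m≡ t 0<t
      q≥0 : ∀ {q} → q ∈ qs → ∀ j → + 0 ℤ.≤ Vec.lookup q j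
      q≥0 q∈ j = proj₁ (in-box q∈ j)
      q≤t : ∀ {q} → q ∈ qs → ∀ j → ℤ.∣ Vec.lookup q j ∣ ℕ.≤ t j
      q≤t q∈ j = proj₂ (in-box q∈ j)
      z≤Q : ∀ {q} → q ∈ qs → ∀ i → ℤ.∣ z q i ∣ ℕ.≤ Q
      z≤Q {q} _ = ∣z∣≤Q q
      ∥∥≥0 : ∀ q i → 0ℚ ≤ ∥ rowℚ (x i) q ∥
      ∥∥≥0 q i = 0≤∣p∣ (rowℚ (x i) q - fromℤ (round (rowℚ (x i) q)))
      z-large : ∀ {q} → q ∈ qs → Q ℕ.^ m ℕ.≤ D ℕ.* (∏ (abs⁺ q) ℕ.* ∏ (λ i → ℤ.∣ z q i ∣))
      z-large {q} q∈ = large D 1≤φ₀D (∏ (abs⁺ q)) (λ i → ∥ rowℚ (x i) q ∥) (λ i → ℤ.∣ z q i ∣)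
        (∥∥≥0 q) (λ i → ≤-reflexive (sym (ι-∣z∣ q i))) (bad q∈)
      apart : AllPairs (λ q q′ → Q ℕ.^ m ℕ.≤ D ℕ.*
        (∏ (λ j → 1 ℕ.⊔ ℤ.∣ Vec.lookup q j ℤ.- Vec.lookup q′ j ∣) ℕ.* ∏ (λ i → ℤ.∣ z q i ℤ.- z q′ i ∣))) qs
      apart = AllPairs.map (λ {q} {q′} h → subst (λ a → Q ℕ.^ m ℕ.≤ D ℕ.* (a ℕ.* ∏ (λ i → ℤ.∣ z q i ℤ.- z q′ i ∣)))
          (Counting.∏-cong λ j → cong (λ y → 1 ℕ.⊔ ℤ.∣ y ∣) (Vec.lookup-zipWith ℤ._-_ j q q′))
          (large D 1≤φ₀D (∏ (abs⁺ (q ⊝ q′))) (λ i → ∥ rowℚ (x i) (q ⊝ q′) ∥) (λ i → ℤ.∣ z q i ℤ.- z q′ i ∣)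
            (∥∥≥0 (q ⊝ q′)) (∣Δz∣≥ q q′) h)) bad-pairs
      recip≤ : ∀ {q} → q ∈ qs → ∀ i → recip ∥ rowℚ (x i) q ∥ ≤ ι (b ℕ.^ suc (exponent q i))
      recip≤ {q} q∈ i = recip-≤ (∥∥≥0 q i) (ι-nonneg B) (*-cancelˡ-≤-pos (ι Q) {{positive (ι-pos 0<Q)}} (begin
        ι Q * 1ℚ                                 ≡⟨ *-identityʳ (ι Q) ⟩
        ι Q                                      ≤⟨ ι-mono {Q} (Counting.Orbit.Core.Q≤b^*z b n m 5≤b i₀ Q 0<Q A z lattice D m′ m≡ t 0<t
                                                      qs qs! q≥0 q≤t z≤Q z-large apart q∈ i) ⟩
        ι (B ℕ.* ℤ.∣ z q i ∣)                    ≡⟨ ι-* B ℤ.∣ z q i ∣ ⟩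
        ι B * ι ℤ.∣ z q i ∣                      ≡⟨ cong (ι B *_) (ι-∣z∣ q i) ⟩
        ι B * (ι Q * ∥ rowℚ (x i) q ∥)           ≡⟨ solve 3 (λ B Q y → B :* (Q :* y) := Q :* (B :* y)) refl (ι B) (ι Q) ∥ rowℚ (x i) q ∥ ⟩
        ι Q * (ι B * ∥ rowℚ (x i) q ∥)           ∎))
        where
        open ≤-Reasoning
        B = b ℕ.^ suc (exponent q i)
      summand : ∀ {q} → q ∈ qs → ∏ℚ (λ i → recip ∥ rowℚ (x i) q ∥) ≤ ι (b ℕ.^ m) * ι (b ℕ.^ ∑ (exponent q))
      summand {q} q∈ = begin
        ∏ℚ (λ i → recip ∥ rowℚ (x i) q ∥)           ≤⟨ ∏ℚ-mono (λ i → recip-nonneg (∥∥≥0 q i)) (recip≤ q∈) ⟩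
        ∏ℚ (λ i → ι (b ℕ.^ suc (exponent q i)))     ≡⟨ ι-∏ (λ i → b ℕ.^ suc (exponent q i)) ⟨
        ι (∏ (λ i → b ℕ.^ suc (exponent q i)))      ≡⟨ cong ι (trans (∏-^ b (λ i → suc (exponent q i))) (cong (b ℕ.^_)
          (trans (∑-+ (const 1) (exponent q)) (cong (ℕ._+ ∑ (exponent q)) (trans (∑-const m 1) (ℕ.*-identityʳ m)))))) ⟩
        ι (b ℕ.^ (m ℕ.+ ∑ (exponent q)))            ≡⟨ cong ι (ℕ.^-distribˡ-+-* b m (∑ (exponent q))) ⟩
        ι (b ℕ.^ m ℕ.* b ℕ.^ ∑ (exponent q))        ≡⟨ ι-* (b ℕ.^ m) (b ℕ.^ ∑ (exponent q)) ⟩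
        ι (b ℕ.^ m) * ι (b ℕ.^ ∑ (exponent q))      ∎
        where open ≤-Reasoning

  -- Lower bounds for the partial sums of the logarithmic series

  ι-suc : ∀ j → ι (suc j) ≡ ι j + 1ℚ
  ι-suc j = fromℤ-suc (+ j)

  bernoulliℚ : ∀ {r} j → 0ℚ ≤ r → r ≤ 1ℚ → 1ℚ - ι j * r ≤ (1ℚ - r) ^ j
  bernoulliℚ {r} zero    0≤r r≤1 = ≤-reflexive (solve 1 (λ r → con 1ℚ :- con 0ℚ :* r := con 1ℚ) refl r)
  bernoulliℚ {r} (suc j) 0≤r r≤1 = begin
    1ℚ - ι (suc j) * r             ≤⟨ ≤-by (ι j * (r * r)) (*-nonneg (ι-nonneg j) (*-nonneg 0≤r 0≤r))
      (trans (solve 2 (λ j r → (con 1ℚ :- r) :* (con 1ℚ :- j :* r) := con 1ℚ :- (j :+ con 1ℚ) :* r :+ j :* (r :* r)) refl (ι j) r)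
        (cong (λ s → 1ℚ - s * r + ι j * (r * r)) (sym (ι-suc j)))) ⟩
    (1ℚ - r) * (1ℚ - ι j * r)      ≤⟨ *-monoˡ (1ℚ - r) (sub-nonneg r≤1) (bernoulliℚ j 0≤r r≤1) ⟩
    (1ℚ - r) ^ suc j               ∎
    where open ≤-Reasoning

  module _ {r : ℚ} (0≤r : 0ℚ ≤ r) (r≤1 : r ≤ 1ℚ) where

    -- Every term added is at least ½ / (N + 1), because (1 - r) ^ j ≥ 1 - j r ≥ ½ for j ≤ N + 1.
    logSum-block : ∀ c M N → c ℕ.+ M ℕ.≤ suc N → ι (suc N) * r ≤ ½ →
      logSum M (1ℚ - r) + ι c * (½ * 1/suc N) ≤ logSum (c ℕ.+ M) (1ℚ - r)
    logSum-block zero    M N _  _  = ≤-reflexive (solve 2 (λ l x → l :+ con 0ℚ :* x := l) refl (logSum M (1ℚ - r)) (½ * 1/suc N))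
    logSum-block (suc c) M N c≤ Nr = begin
      L + ι (suc c) * h                  ≡⟨ trans (cong (λ s → L + s * h) (ι-suc c)) (solve 3 (λ L c h → L :+ (c :+ con 1ℚ) :* h := (L :+ c :* h) :+ h) refl L (ι c) h) ⟩
      (L + ι c * h) + h                  ≤⟨ +-mono-≤ (logSum-block c M N (ℕ.≤-trans (ℕ.n≤1+n (c ℕ.+ M)) c≤) Nr)
        (*-mono 0≤½ (1/suc-nonneg (c ℕ.+ M)) ½≤ (1/suc-antitone (ℕ.≤-pred c≤))) ⟩
      logSum (suc c ℕ.+ M) (1ℚ - r)      ∎
      where
      open ≤-Reasoning
      L = logSum M (1ℚ - r)
      h = ½ * 1/suc N
      ½≤ : ½ ≤ (1ℚ - r) ^ suc (c ℕ.+ M)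
      ½≤ = ≤-trans (≤-by (½ - ι (suc (c ℕ.+ M)) * r)
          (sub-nonneg (≤-trans (*-monoʳ r 0≤r (ι-mono {suc (c ℕ.+ M)} {suc N} c≤)) Nr))
          (solve 1 (λ x → con 1ℚ :- x := con ½ :+ (con ½ :- x)) refl (ι (suc (c ℕ.+ M)) * r)))
        (bernoulliℚ (suc (c ℕ.+ M)) 0≤r r≤1)

    -- As in the proof that the harmonic series diverges, the terms from M + 1 to 2 M, M a power of
    -- 2, add at least M · ½ · 1 / (2 M) = ¼.
    logSum-2^ : ∀ a → ι (2 ℕ.^ suc a) * r ≤ 1ℚ → ½ * ½ * ι (suc (suc a)) ≤ logSum (2 ℕ.^ a) (1ℚ - r)
    logSum-2^ zero 2r≤1 = begin
      ½                                        ≤⟨ ≤-by (½ * (1ℚ - ι 2 * r)) (*-nonneg 0≤½ (sub-nonneg 2r≤1))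
        (solve 1 (λ r → con 0ℚ :+ (con 1ℚ :- r) :* con 1ℚ :* con 1ℚ := con ½ :+ con ½ :* (con 1ℚ :- con (ι 2) :* r)) refl r) ⟩
      0ℚ + (1ℚ - r) ^ 1 * 1/suc 0              ∎
      where open ≤-Reasoning
    logSum-2^ (suc a) 4Mr≤1 with 2 ℕ.^ a | ℕ.m^n>0 2 a | logSum-2^ a
    ... | M@(suc M-1) | _ | ih = begin
      ½ * ½ * ι (suc (suc (suc a)))             ≡⟨ trans (cong (½ * ½ *_) (ι-suc (suc (suc a))))
        (solve 1 (λ x → con (½ * ½) :* (x :+ con 1ℚ) := con (½ * ½) :* x :+ con ½ :* con ½) refl (ι (suc (suc a)))) ⟩
      ½ * ½ * ι (suc (suc a)) + ½ * ½           ≤⟨ +-mono-≤ (ih (≤-trans 2Mr≤½ (≤-by ½ 0≤½ refl))) (≤-reflexive quarter) ⟩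
      logSum M (1ℚ - r) + ι M * (½ * 1/suc N)   ≤⟨ logSum-block M M N (ℕ.≤-reflexive 2M≡) (subst (λ k → ι k * r ≤ ½) (trans (cong (M ℕ.+_) (ℕ.+-identityʳ M)) 2M≡) 2Mr≤½) ⟩
      logSum (M ℕ.+ M) (1ℚ - r)                 ≡⟨ cong (λ k → logSum (M ℕ.+ k) (1ℚ - r)) (ℕ.+-identityʳ M) ⟨
      logSum (2 ℕ.* M) (1ℚ - r)                 ∎
      where
      open ≤-Reasoning
      N = M-1 ℕ.+ M
      2M≡ : M ℕ.+ M ≡ suc N
      2M≡ = refl
      2Mr≤½ : ι (2 ℕ.* M) * r ≤ ½
      2Mr≤½ = ≤-trans (≤-reflexive (trans (solve 2 (λ y r → y :* r := con ½ :* (con (ι 2) :* y :* r)) refl (ι (2 ℕ.* M)) r)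
          (cong (λ y → ½ * (y * r)) (sym (ι-* 2 (2 ℕ.* M))))))
        (≤-trans (*-monoˡ ½ 0≤½ 4Mr≤1) (≤-reflexive (*-identityʳ ½)))
      quarter : ½ * ½ ≡ ι M * (½ * 1/suc N)
      quarter = sym (trans (solve 2 (λ M h → M :* (con ½ :* h) := con ½ :* (con ½ :* ((M :+ M) :* h))) refl (ι M) (1/suc N))
        (trans (cong (λ y → ½ * (½ * (y * 1/suc N))) (sym (ι-+ M M))) (trans (cong (λ y → ½ * (½ * y)) (1/suc-inverse N)) (cong (½ *_) (*-identityʳ ½)))))

  -- A lower bound ≫ 1 + a fails for X near 1, whence X ≥ 3 / 2, and when too few terms of the
  -- series are summed, whence 2 ^ a ≤ k.
  logApprox-lower : ∀ {X} a k → ι 3 * ½ ≤ X → ι (2 ℕ.^ a) ≤ X → 2 ℕ.^ a ℕ.≤ k → ½ * ½ * ι (suc a) ≤ logApprox k X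
  logApprox-lower {X} a k 3/2≤X 2^a≤X 2^a≤k = subst (λ x → ½ * ½ * ι (suc a) ≤ logSum k (1ℚ - recip x)) (sym 1⊔X≡X)
    (by-cases a 2^a≤X 2^a≤k)
    where
    open ≤-Reasoning
    1≤X : 1ℚ ≤ X
    1≤X = ≤-trans (≤-by ½ 0≤½ refl) 3/2≤X
    0<X = <-≤-trans 0<1 1≤X
    1⊔X≡X : 1ℚ ⊔ X ≡ X
    1⊔X≡X = p≤q⇒p⊔q≡q 1≤X
    r = recip X
    0≤r : 0ℚ ≤ r
    0≤r = <⇒≤ (recip-pos 0<X)
    r≤1 : r ≤ 1ℚ
    r≤1 = recip-antitone 0<1 1≤X
    mono : ∀ {j k} → j ℕ.≤ k → logSum j (1ℚ - r) ≤ logSum k (1ℚ - r)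
    mono {j} {k} j≤k = subst (λ l → logSum j (1ℚ - r) ≤ logSum l (1ℚ - r)) (ℕ.m∸n+n≡m j≤k) (logSum-mono j (k ℕ.∸ j) (sub-nonneg r≤1))
    by-cases : ∀ a → ι (2 ℕ.^ a) ≤ X → 2 ℕ.^ a ℕ.≤ k → ½ * ½ * ι (suc a) ≤ logSum k (1ℚ - r)
    by-cases zero _ 1≤k = begin
      ½ * ½                          ≤⟨ ≤-by (ι 3 * (½ * ½) - r) (sub-nonneg r≤¾)
        (solve 1 (λ r → con 0ℚ :+ (con 1ℚ :- r) :* con 1ℚ :* con 1ℚ := con (½ * ½) :+ (con (ι 3 * (½ * ½)) :- r)) refl r) ⟩
      logSum 1 (1ℚ - r)              ≤⟨ mono 1≤k ⟩
      logSum k (1ℚ - r)              ∎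
      where
      r≤¾ : r ≤ ι 3 * (½ * ½)
      r≤¾ = recip-≤ (<⇒≤ 0<X) (≤-trans 0≤½ (≤-by (½ * ½) (*-nonneg 0≤½ 0≤½) refl)) (≤-trans
        (≤-by (½ * ½ * ½) (*-nonneg (*-nonneg 0≤½ 0≤½) 0≤½) refl)
        (*-monoˡ (ι 3 * (½ * ½)) (≤-trans 0≤½ (≤-by (½ * ½) (*-nonneg 0≤½ 0≤½) refl)) 3/2≤X))
    by-cases (suc a) 2^a≤X 2^a≤k = ≤-trans (logSum-2^ 0≤r r≤1 a
        (≤-trans (*-monoʳ r 0≤r 2^a≤X) (≤-reflexive (recip-inverse 0<X))))
      (mono (ℕ.≤-trans (ℕ.m≤m+n (2 ℕ.^ a) (2 ℕ.^ a ℕ.+ 0)) 2^a≤k))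

  -- Parameters for given approximations of T̄ and φ (T̄)

  natural-floor : ∀ {p} → 0ℚ ≤ p → ∃[ x ] (ι x ≤ p × p < ι (suc x))
  natural-floor {p} 0≤p = ℤ.∣ floor p ∣ , subst (λ z → fromℤ z ≤ p) (sym eq) (floor≤ p) ,
    subst (p <_) (trans (cong (λ z → fromℤ z + 1ℚ) (sym eq)) (sym (ι-suc ℤ.∣ floor p ∣))) (<floor+1 p)
    where
    eq : + ℤ.∣ floor p ∣ ≡ floor p
    eq = ℤ.0≤i⇒+∣i∣≡i (ℤ.≮⇒≥ λ floor<0 → <-irrefl refl (<-≤-trans (≤-<-trans 0≤p (<floor+1 p)) (fromℤ-< floor<0)))

  ^-*-distrib : ∀ n p q → (p * q) ^ n ≡ p ^ n * q ^ n
  ^-*-distrib zero    p q = refl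
  ^-*-distrib (suc n) p q = trans (cong (p * q *_) (^-*-distrib n p q))
    (solve 4 (λ p q x y → p :* q :* (x :* y) := p :* x :* (q :* y)) refl p q (p ^ n) (q ^ n))

  ^-mono-exponent : ∀ {p m n} → 1ℚ ≤ p → m ℕ.≤ n → p ^ m ≤ p ^ n
  ^-mono-exponent {p} {n = n} 1≤p ℕ.z≤n       = 1≤^ n 1≤p
  ^-mono-exponent {p}         1≤p (ℕ.s≤s m≤n) = *-monoˡ p (≤-trans 0≤1 1≤p) (^-mono-exponent 1≤p m≤n)

  -- φ ≤ 9 / 8 and T ≥ 7 / 4 are what approximation leaves of φ ≤ 1 and T̄ ≥ 2; they still give T /
  -- φ ≥ 14 / 9 > 3 / 2.
  module Parameters {n n′ N k : ℕ} {T φ : ℚ} (n≡ : n ≡ suc n′) (0<φ : 0ℚ < φ) (φ≤ : φ ≤ 1ℚ + ½ * ½ * ½)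
    (T≥ : 1ℚ + ½ + ½ * ½ ≤ T) (N≤ : ι N ≤ ι (2 ℕ.^ suc n) * T ^ n) (T/φ≤k : T * recip φ ≤ ι k) where

    private
      r = recip φ
      X = T * r
      0≤r = <⇒≤ (recip-pos 0<φ)
      0≤¼ : 0ℚ ≤ ½ * ½
      0≤¼ = *-nonneg 0≤½ 0≤½
      0≤⅛ : 0ℚ ≤ ½ * ½ * ½
      0≤⅛ = *-nonneg 0≤¼ 0≤½
      1≤T : 1ℚ ≤ T
      1≤T = ≤-trans (≤-by (½ + ½ * ½) (+-nonneg 0≤½ 0≤¼) refl) T≥
      0≤T = ≤-trans 0≤1 1≤T
      0≤X : 0ℚ ≤ X
      0≤X = *-nonneg 0≤T 0≤r
      φr≡1 = recip-inverse 0<φ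
      1≤2r : 1ℚ ≤ ι 2 * r
      1≤2r = ≤-trans (≤-reflexive (sym φr≡1)) (*-monoʳ r 0≤r (≤-trans φ≤ (≤-by (½ + ½ * ½ + ½ * ½ * ½) (+-nonneg (+-nonneg 0≤½ 0≤¼) 0≤⅛) refl)))
      3/2≤X : ι 3 * ½ ≤ X
      3/2≤X = begin
        ι 3 * ½                                    ≡⟨ *-identityʳ (ι 3 * ½) ⟨
        ι 3 * ½ * 1ℚ                               ≡⟨ cong (ι 3 * ½ *_) φr≡1 ⟨
        ι 3 * ½ * (φ * r)                          ≤⟨ *-monoˡ (ι 3 * ½) (≤-trans 0≤1 (≤-by ½ 0≤½ refl)) (*-monoʳ r 0≤r φ≤) ⟩
        ι 3 * ½ * ((1ℚ + ½ * ½ * ½) * r)           ≡⟨ *-assoc (ι 3 * ½) (1ℚ + ½ * ½ * ½) r ⟨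
        ι 3 * ½ * (1ℚ + ½ * ½ * ½) * r             ≤⟨ *-monoʳ r 0≤r (≤-trans (≤-by (½ * ½ * ½ * ½) (*-nonneg 0≤⅛ 0≤½) refl) T≥) ⟩
        X                                          ∎
        where open ≤-Reasoning

      D-floor = natural-floor {ι 2 * r} (≤-trans 0≤1 1≤2r)
      X-floor = natural-floor {X} 0≤X
      open Logarithm 2 ℕ.≤-refl
      x = proj₁ X-floor

    -- `D` is the least integer above 2 / φ, `a` the integer part of log₂ (T / φ). `ρ` collects the
    -- powers of 2 in D N ≤ (4 / φ) 2 ^ (n + 1) T ^ n: 2 from the 4, n + 1, and (a + 2) n from T ^ n
    -- / φ ≤ (2 T / φ) ^ n.
    D a ρ : ℕ
    D = suc (proj₁ D-floor)
    a = lg x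
    ρ = suc n ℕ.+ 2 ℕ.+ suc (suc a) ℕ.* n

    private
      0<x : 0 ℕ.< x
      0<x = ℕ.≰⇒> λ x≤0 → <-irrefl refl (<-≤-trans
        (≤-<-trans (≤-trans (≤-by ½ 0≤½ refl) 3/2≤X) (proj₂ (proj₂ X-floor))) (ι-mono {suc x} {1} (ℕ.s≤s x≤0)))
      2^a≤X : ι (2 ℕ.^ a) ≤ X
      2^a≤X = ≤-trans (ι-mono (b^lg≤x 0<x)) (proj₁ (proj₂ X-floor))
      X≤2^ : X ≤ ι (2 ℕ.^ suc a)
      X≤2^ = ≤-trans (<⇒≤ (proj₂ (proj₂ X-floor))) (ι-mono (x<b^[1+lg] x))

    D-lower : 1ℚ ≤ ½ * φ * ι D
    D-lower = begin
      1ℚ                       ≡⟨ φr≡1 ⟨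
      φ * r                    ≡⟨ solve 2 (λ φ r → φ :* r := con ½ :* φ :* (con (ι 2) :* r)) refl φ r ⟩
      ½ * φ * (ι 2 * r)        ≤⟨ *-monoˡ (½ * φ) (*-nonneg 0≤½ (<⇒≤ 0<φ)) (<⇒≤ (proj₂ (proj₂ D-floor))) ⟩
      ½ * φ * ι D              ∎
      where open ≤-Reasoning

    D-upper : ι D ≤ ι 4 * r
    D-upper = begin
      ι D                      ≡⟨ ι-suc (proj₁ D-floor) ⟩
      ι (proj₁ D-floor) + 1ℚ   ≤⟨ +-mono-≤ (proj₁ (proj₂ D-floor)) 1≤2r ⟩
      ι 2 * r + ι 2 * r        ≡⟨ solve 1 (λ r → con (ι 2) :* r :+ con (ι 2) :* r := con (ι 4) :* r) refl r ⟩
      ι 4 * r                  ∎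
      where open ≤-Reasoning

    DN≤ : D ℕ.* N ℕ.≤ 2 ℕ.^ ρ
    DN≤ = ι-≤⁻ (begin
      ι (D ℕ.* N)                                    ≡⟨ ι-* D N ⟩
      ι D * ι N                                      ≤⟨ *-mono (ι-nonneg D) (*-nonneg (ι-nonneg (2 ℕ.^ suc n)) (^-nonneg n 0≤T)) D-upper N≤ ⟩
      ι 4 * r * (ι (2 ℕ.^ suc n) * T ^ n)            ≡⟨ solve 3 (λ r p t → con (ι 4) :* r :* (p :* t) := p :* con (ι 4) :* (t :* r)) refl r (ι (2 ℕ.^ suc n)) (T ^ n) ⟩
      ι (2 ℕ.^ suc n) * ι 4 * (T ^ n * r)            ≤⟨ *-mono (*-nonneg (ι-nonneg (2 ℕ.^ suc n)) (ι-nonneg 4)) (^-nonneg n (ι-nonneg (2 ℕ.^ suc (suc a)))) (≤-reflexive (sym p≡)) (≤-trans Tr≤ pow) ⟩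
      ι (2 ℕ.^ (suc n ℕ.+ 2)) * ι (2 ℕ.^ suc (suc a)) ^ n    ≡⟨ cong (ι (2 ℕ.^ (suc n ℕ.+ 2)) *_) (trans (sym (ι-^ (2 ℕ.^ suc (suc a)) n)) (cong ι (ℕ.^-*-assoc 2 (suc (suc a)) n))) ⟩
      ι (2 ℕ.^ (suc n ℕ.+ 2)) * ι (2 ℕ.^ (suc (suc a) ℕ.* n)) ≡⟨ trans (sym (ι-* (2 ℕ.^ (suc n ℕ.+ 2)) _)) (cong ι (sym (ℕ.^-distribˡ-+-* 2 (suc n ℕ.+ 2) (suc (suc a) ℕ.* n)))) ⟩
      ι (2 ℕ.^ ρ)                                    ∎)
      where
      open ≤-Reasoning
      p≡ : ι (2 ℕ.^ (suc n ℕ.+ 2)) ≡ ι (2 ℕ.^ suc n) * ι 4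
      p≡ = trans (cong ι (ℕ.^-distribˡ-+-* 2 (suc n) 2)) (ι-* (2 ℕ.^ suc n) 4)
      ≤^n : ∀ {n} → n ≡ suc n′ → ∀ {p} → 1ℚ ≤ p → p ≤ p ^ n
      ≤^n refl = ≤^suc n′
      -- r ≤ 2 r ≤ (2 r) ^ n, since 2 r ≥ 1 and n ≥ 1.
      Tr≤ : T ^ n * r ≤ (ι 2 * X) ^ n
      Tr≤ = begin
        T ^ n * r             ≤⟨ *-monoˡ (T ^ n) (^-nonneg n 0≤T) (≤-trans (≤-by r 0≤r (solve 1 (λ r → con (ι 2) :* r := r :+ r) refl r)) (≤^n n≡ 1≤2r)) ⟩
        T ^ n * (ι 2 * r) ^ n ≡⟨ ^-*-distrib n T (ι 2 * r) ⟨
        (T * (ι 2 * r)) ^ n   ≡⟨ cong (_^ n) (solve 2 (λ T r → T :* (con (ι 2) :* r) := con (ι 2) :* (T :* r)) refl T r) ⟩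
        (ι 2 * X) ^ n         ∎
      pow : (ι 2 * X) ^ n ≤ ι (2 ℕ.^ suc (suc a)) ^ n
      pow = ^-mono n (*-nonneg (ι-nonneg 2) 0≤X) (≤-trans (*-monoˡ (ι 2) (ι-nonneg 2) X≤2^) (≤-reflexive (sym (ι-* 2 (2 ℕ.^ suc a)))))

    private
      -- ρ ≤ (3 + 3 n) (1 + a), and (1 + a) / 4 ≤ ℓ.
      c = 4 ℕ.* (3 ℕ.+ 3 ℕ.* n)
      ℓ = logApprox k X
      ρ≤ : ι ρ ≤ ι c * ℓ
      ρ≤ = begin
        ι ρ                                  ≤⟨ ι-mono ρ≤′ ⟩
        ι ((3 ℕ.+ 3 ℕ.* n) ℕ.* suc a)        ≡⟨ ι-* (3 ℕ.+ 3 ℕ.* n) (suc a) ⟩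
        ι (3 ℕ.+ 3 ℕ.* n) * ι (suc a)        ≡⟨ solve 2 (λ x y → x :* y := con (ι 4) :* x :* (con (½ * ½) :* y)) refl (ι (3 ℕ.+ 3 ℕ.* n)) (ι (suc a)) ⟩
        ι 4 * ι (3 ℕ.+ 3 ℕ.* n) * (½ * ½ * ι (suc a))  ≤⟨ *-mono (*-nonneg (ι-nonneg 4) (ι-nonneg (3 ℕ.+ 3 ℕ.* n))) (≤-trans (*-nonneg 0≤¼ (ι-nonneg (suc a))) ℓ≥)
          (≤-reflexive (sym (ι-* 4 (3 ℕ.+ 3 ℕ.* n)))) ℓ≥ ⟩
        ι c * ℓ                              ∎
        where
        open ≤-Reasoning
        ℓ≥ : ½ * ½ * ι (suc a) ≤ ℓ
        ℓ≥ = logApprox-lower a k 3/2≤X 2^a≤X (ι-≤⁻ (≤-trans 2^a≤X T/φ≤k))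
        ρ≤′ : ρ ℕ.≤ (3 ℕ.+ 3 ℕ.* n) ℕ.* suc a
        ρ≤′ = ℕ.≤-trans (ℕ.m≤m+n ρ (3 ℕ.* a ℕ.+ 2 ℕ.* (a ℕ.* n))) (ℕ.≤-reflexive
          (ℕ-Solver.solve 2 (λ n a → (ℕ-Solver.con 1 ⊞ n) ⊞ ℕ-Solver.con 2 ⊞ (ℕ-Solver.con 2 ⊞ a) ⊠ n ⊞ (ℕ-Solver.con 3 ⊠ a ⊞ ℕ-Solver.con 2 ⊠ (a ⊠ n)) ≋ (ℕ-Solver.con 3 ⊞ ℕ-Solver.con 3 ⊠ n) ⊠ (ℕ-Solver.con 1 ⊞ a)) refl n a))
    0<ρ : 0 ℕ.< ρ
    0<ρ = ℕ.s≤s ℕ.z≤n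

    bound : ∀ {m m′} C → m′ ℕ.≤ m →
      ι (C ℕ.* (N ℕ.* ρ ℕ.^ m ℕ.+ D ℕ.* N ℕ.* ρ ℕ.^ m′)) ≤
      ι (C ℕ.* (2 ℕ.^ suc n ℕ.* 4 ℕ.* c ℕ.^ m)) * (T ^ n * ℓ ^ m + T ^ n * r * ℓ ^ m′)
    bound {m} {m′} C m′≤m = begin
      ι (C ℕ.* (N ℕ.* ρ ℕ.^ m ℕ.+ D ℕ.* N ℕ.* ρ ℕ.^ m′))
        ≡⟨ trans (ι-* C _) (cong (ι C *_) (trans (ι-+ (N ℕ.* ρ ℕ.^ m) _) (cong₂ _+_ (trans (ι-* N _) (cong (ι N *_) (ι-^ ρ m)))
             (trans (ι-* (D ℕ.* N) _) (cong₂ _*_ (ι-* D N) (ι-^ ρ m′)))))) ⟩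
      ι C * (ι N * ι ρ ^ m + ι D * ι N * ι ρ ^ m′)
        ≤⟨ *-monoˡ (ι C) (ι-nonneg C) (+-mono-≤
             (*-mono (ι-nonneg N) 0≤pw N≤ (power m ℕ.≤-refl))
             (*-mono (*-nonneg (ι-nonneg D) (ι-nonneg N)) 0≤pw′ (*-mono (ι-nonneg D) (*-nonneg (ι-nonneg (2 ℕ.^ suc n)) 0≤T^n) D-upper N≤) (power m′ m′≤m))) ⟩
      ι C * (p * t * (q * l) + ι 4 * r * (p * t) * (q * l′))
        ≤⟨ *-monoˡ (ι C) (ι-nonneg C) (≤-by (ι 3 * (p * t * (q * l))) (*-nonneg (ι-nonneg 3) (*-nonneg (*-nonneg (ι-nonneg (2 ℕ.^ suc n)) 0≤T^n) 0≤pw))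
             (solve 6 (λ p t q l r l′ → p :* con (ι 4) :* q :* (t :* l :+ t :* r :* l′)
                := (p :* t :* (q :* l) :+ con (ι 4) :* r :* (p :* t) :* (q :* l′)) :+ con (ι 3) :* (p :* t :* (q :* l))) refl p t q l r l′)) ⟩
      ι C * (p * ι 4 * q * (t * l + t * r * l′))
        ≡⟨ trans (sym (*-assoc (ι C) (p * ι 4 * q) (t * l + t * r * l′))) (cong (_* (t * l + t * r * l′)) (sym constants)) ⟩
      ι (C ℕ.* (2 ℕ.^ suc n ℕ.* 4 ℕ.* c ℕ.^ m)) * (t * l + t * r * l′) ∎
      where
      open ≤-Reasoning
      p = ι (2 ℕ.^ suc n)
      t = T ^ n
      q = ι c ^ m
      l = ℓ ^ m
      l′ = ℓ ^ m′
      0≤T^n = ^-nonneg n 0≤T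
      1≤c : 1ℚ ≤ ι c
      1≤c = ι-mono {1} {c} (ℕ.s≤s ℕ.z≤n)
      0≤q : 0ℚ ≤ q
      0≤q = ^-nonneg m (ι-nonneg c)
      0≤ℓ : 0ℚ ≤ ℓ
      0≤ℓ = *-cancelˡ-≤-pos (ι c) {{positive (<-≤-trans 0<1 1≤c)}} (≤-trans (≤-reflexive (*-zeroʳ (ι c))) (≤-trans (ι-nonneg ρ) ρ≤))
      0≤pw : 0ℚ ≤ q * l
      0≤pw = *-nonneg 0≤q (^-nonneg m 0≤ℓ)
      0≤pw′ : 0ℚ ≤ q * l′
      0≤pw′ = *-nonneg 0≤q (^-nonneg m′ 0≤ℓ)
      power : ∀ x → x ℕ.≤ m → ι ρ ^ x ≤ q * ℓ ^ x
      power x x≤m = begin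
        ι ρ ^ x            ≤⟨ ^-mono x (ι-nonneg ρ) ρ≤ ⟩
        (ι c * ℓ) ^ x      ≡⟨ ^-*-distrib x (ι c) ℓ ⟩
        ι c ^ x * ℓ ^ x    ≤⟨ *-monoʳ (ℓ ^ x) (^-nonneg x 0≤ℓ) (^-mono-exponent 1≤c x≤m) ⟩
        q * ℓ ^ x          ∎
      constants : ι (C ℕ.* (2 ℕ.^ suc n ℕ.* 4 ℕ.* c ℕ.^ m)) ≡ ι C * (p * ι 4 * q)
      constants = trans (ι-* C _) (cong (ι C *_) (trans (ι-* (2 ℕ.^ suc n ℕ.* 4) (c ℕ.^ m)) (cong₂ _*_ (ι-* (2 ℕ.^ suc n) 4) (ι-^ c m))))

  final-constant : (n m : ℕ) → ℕ
  final-constant n m = 5 ℕ.^ m ℕ.* constant 5 n m ℕ.* (2 ℕ.^ suc n ℕ.* 4 ℕ.* (4 ℕ.* (3 ℕ.+ 3 ℕ.* n)) ℕ.^ m)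

  -- This is the theorem at the k-th terms of the Cauchy sequences. Asking for ½ φ instead of φ
  -- leaves room for the errors of approximation.
  rational-theorem : ∀ {n n′ m m′ k} {T φ : ℚ} → n ≡ suc n′ → m ≡ suc m′ → Fin m → (x : Fin m → Fin n → ℚ) →
    (t : Fin n → ℕ) → (∀ j → 0 ℕ.< t j) → 0ℚ < φ → φ ≤ 1ℚ + ½ * ½ * ½ → 1ℚ + ½ + ½ * ½ ≤ T →
    ι (∏ t) ≤ ι (2 ℕ.^ suc n) * T ^ n → T * recip φ ≤ ι k →
    ∀ qs → Unique qs → (∀ {q} → q ∈ qs → ∀ j → + 0 ℤ.≤ Vec.lookup q j × ℤ.∣ Vec.lookup q j ∣ ℕ.≤ t j) →
    (∀ {q} → q ∈ qs → ½ * φ ≤ ι (∏ (abs⁺ q)) * ∏ℚ (λ i → ∥ rowℚ (x i) q ∥)) →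
    AllPairs (λ q q′ → ½ * φ ≤ ι (∏ (abs⁺ (q ⊝ q′))) * ∏ℚ (λ i → ∥ rowℚ (x i) (q ⊝ q′) ∥)) qs →
    let ℓ = logApprox k (T * recip φ) in
    ∑ₗℚ qs (λ q → ∏ℚ (λ i → recip ∥ rowℚ (x i) q ∥)) ≤
    ι (final-constant n m) * (T ^ n * ℓ ^ m + T ^ n * recip φ * ℓ ^ m′)
  rational-theorem {n} {n′} {m} {m′} {k} {T} {φ} n≡ m≡ i₀ x t 0<t 0<φ φ≤ T≥ N≤ X≤k qs qs! in-box bad bad-pairs = ≤-trans
    (rational-bound {5} ℕ.≤-refl i₀ m≡ x D D-lower t 0<t qs qs! in-box bad bad-pairs ρ 0<ρ
      (ℕ.≤-trans DN≤ (ℕ.^-monoˡ-≤ ρ (ℕ.m≤m+n 2 3))))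
    (≤-trans (≤-reflexive (trans (sym (ι-* (5 ℕ.^ m) _)) (cong ι (sym (ℕ.*-assoc (5 ℕ.^ m) (constant 5 n m) _)))))
      (bound (5 ℕ.^ m ℕ.* constant 5 n m) (ℕ.≤-trans (ℕ.n≤1+n m′) (ℕ.≤-reflexive (sym m≡)))))
    where open Parameters {n} {n′} {∏ t} {k} {T} {φ} n≡ 0<φ φ≤ T≥ N≤ X≤k

open import Defs
open ℚ-Solver using (solve; _:=_; _:+_; _:*_; _:-_; con)
open Counting using (∏; ∏-mono; lookup-ext)
open RationalCase hiding (_^_)
open RawSemiringOps ℚ.+-*-rawSemiring using () renaming (_^_ to _^ℚ_)

-- Inequalities between reals and between their terms; roots

Eventually : (ℕ → Set) → Set
Eventually P = ∃[ N ] (∀ k → N ℕ.≤ k → P k)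

ev-map : ∀ {P Q : ℕ → Set} → (∀ k → P k → Q k) → Eventually P → Eventually Q
ev-map f (N , p) = N , λ k N≤k → f k (p k N≤k)

ev-∧ : ∀ {P Q : ℕ → Set} → Eventually P → Eventually Q → Eventually (λ k → P k × Q k)
ev-∧ (M , p) (N , q) = M ℕ.⊔ N , λ k h → p k (ℕ.m⊔n≤o⇒m≤o M N h) , q k (ℕ.m⊔n≤o⇒n≤o M N h)

ev-All : ∀ {I : Set} {P : I → ℕ → Set} {xs} → All (λ x → Eventually (P x)) xs → Eventually (λ k → All (λ x → P x k) xs)
ev-All []       = 0 , λ _ _ → []
ev-All (p ∷ ps) = ev-map (λ { _ (q , qs) → q ∷ qs }) (ev-∧ p (ev-All ps))

ev-AllPairs : ∀ {I : Set} {R : I → I → ℕ → Set} {xs} → AllPairs (λ x y → Eventually (R x y)) xs →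
              Eventually (λ k → AllPairs (λ x y → R x y k) xs)
ev-AllPairs []       = 0 , λ _ _ → []
ev-AllPairs (p ∷ ps) = ev-map (λ { _ (q , qs) → q ∷ qs }) (ev-∧ (ev-All p) (ev-AllPairs ps))

private
  δ<η : ∀ {η} → 0ℚ ℚ.< η → 0ℚ ℚ.< ½ ℚ.* (½ ℚ.* (½ ℚ.* η))
  δ<η = Rational.half-pos ∘ Rational.half-pos ∘ Rational.half-pos

-- The order of reals is undecidable, but that of two terms at one late index is not. If x is not
-- above y + ½ η there, all later terms satisfy the claim; otherwise y < x, which x ≤ y excludes.
≤⇒eventually : ∀ x y → x ≤ y → ∀ {η} → 0ℚ ℚ.< η → Eventually (λ k → seq x k ℚ.≤ seq y k ℚ.+ η)
≤⇒eventually x y x≤y {η} 0<η = by-cases (cauchy x δ (δ<η 0<η)) (cauchy y δ (δ<η 0<η))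
  where
  open Rational
  open ℚ.≤-Reasoning
  δ = ½ ℚ.* (½ ℚ.* (½ ℚ.* η))
  by-cases : ∃[ M ] (∀ k l → M ℕ.≤ k → M ℕ.≤ l → ℚ.∣ seq x k ℚ.- seq x l ∣ ℚ.≤ δ) →
             ∃[ N ] (∀ k l → N ℕ.≤ k → N ℕ.≤ l → ℚ.∣ seq y k ℚ.- seq y l ∣ ℚ.≤ δ) → _
  by-cases (M , hx) (N , hy) with seq x (M ℕ.⊔ N) ℚ.≤? seq y (M ℕ.⊔ N) ℚ.+ ½ ℚ.* η
  ... | yes x≤y+ = M ℕ.⊔ N , λ k h → begin
    seq x k                                   ≤⟨ ≤-∣-∣ (seq x k) (seq x K) (hx k K (ℕ.m⊔n≤o⇒m≤o M N h) (ℕ.m≤m⊔n M N)) ⟩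
    seq x K ℚ.+ δ                             ≤⟨ ℚ.+-monoˡ-≤ δ x≤y+ ⟩
    seq y K ℚ.+ ½ ℚ.* η ℚ.+ δ                 ≤⟨ ℚ.+-monoˡ-≤ δ (ℚ.+-monoˡ-≤ (½ ℚ.* η)
      (≤-∣-∣ (seq y K) (seq y k) (hy K k (ℕ.m≤n⊔m M N) (ℕ.m⊔n≤o⇒n≤o M N h)))) ⟩
    seq y k ℚ.+ δ ℚ.+ ½ ℚ.* η ℚ.+ δ           ≤⟨ ≤-by (½ ℚ.* (½ ℚ.* η)) (ℚ.<⇒≤ (half-pos (half-pos 0<η)))
      (solve 2 (λ y η → y :+ η := y :+ con ½ :* (con ½ :* (con ½ :* η)) :+ con ½ :* η :+ con ½ :* (con ½ :* (con ½ :* η)) :+ con ½ :* (con ½ :* η))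
        refl (seq y k) η) ⟩
    seq y k ℚ.+ η                             ∎
    where K = M ℕ.⊔ N
  ... | no x≰y+ = contradiction (½ ℚ.* (½ ℚ.* η) , M ℕ.⊔ N , half-pos (half-pos 0<η) , λ k h → begin
    seq y k ℚ.+ ½ ℚ.* (½ ℚ.* η)               ≤⟨ ℚ.+-monoˡ-≤ _ (≤-∣-∣ (seq y k) (seq y K) (hy k K (ℕ.m⊔n≤o⇒n≤o M N h) (ℕ.m≤n⊔m M N))) ⟩
    seq y K ℚ.+ δ ℚ.+ ½ ℚ.* (½ ℚ.* η)         ≤⟨ ≤-by (seq x K ℚ.- (seq y K ℚ.+ ½ ℚ.* η)) (sub-nonneg (ℚ.<⇒≤ (ℚ.≰⇒> x≰y+)))
      (solve 3 (λ x y η → x :- con ½ :* (con ½ :* (con ½ :* η))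
        := y :+ con ½ :* (con ½ :* (con ½ :* η)) :+ con ½ :* (con ½ :* η) :+ (x :- (y :+ con ½ :* η))) refl (seq x K) (seq y K) η) ⟩
    seq x K ℚ.- δ                             ≤⟨ ≤-by (seq x k ℚ.+ δ ℚ.- seq x K) (sub-nonneg (≤-∣-∣ (seq x K) (seq x k) (hx K k (ℕ.m≤m⊔n M N) (ℕ.m⊔n≤o⇒m≤o M N h))))
      (solve 3 (λ a b δ → b := a :- δ :+ (b :+ δ :- a)) refl (seq x K) (seq x k) δ) ⟩
    seq x k                                   ∎) x≤y
    where K = M ℕ.⊔ N

eventually⇒≤ : ∀ x y → (∀ {η} → 0ℚ ℚ.< η → Eventually (λ k → seq x k ℚ.≤ seq y k ℚ.+ η)) → x ≤ y
eventually⇒≤ x y h (ε , M , 0<ε , y+ε≤x) with h (Rational.half-pos 0<ε)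
... | N , x≤y+½ε = ℚ.<-irrefl refl (ℚ.<-≤-trans strict (ℚ.≤-trans (y+ε≤x K (ℕ.m≤m⊔n M N)) (x≤y+½ε K (ℕ.m≤n⊔m M N))))
  where
  K = M ℕ.⊔ N
  strict : seq y K ℚ.+ ½ ℚ.* ε ℚ.< seq y K ℚ.+ ε
  strict = ℚ.+-monoʳ-< (seq y K) (subst₂ ℚ._<_ (ℚ.+-identityʳ (½ ℚ.* ε)) (Rational.halves ε)
    (ℚ.+-monoʳ-< (½ ℚ.* ε) (Rational.half-pos 0<ε)))

half-step : ∀ r h ε → h ℚ.≤ ½ ℚ.* ε → r ℚ.+ h ℚ.+ ½ ℚ.* ε ℚ.≤ r ℚ.+ ε
half-step r h ε h≤ = Rational.≤-by (½ ℚ.* ε ℚ.- h) (Rational.sub-nonneg h≤)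
  (solve 3 (λ r h ε → r :+ ε := r :+ h :+ con ½ :* ε :+ (con ½ :* ε :- h)) refl r h ε)

rootBelow-nonneg : ∀ n k x → 0ℚ ℚ.≤ Rational.rootBelow n k x
rootBelow-nonneg n k x = Rational.grid-nonneg k (Rational.search n k x (Rational.searchBound k x))

module _ (n k : ℕ) {x y e : ℚ} (0≤x : 0ℚ ℚ.≤ x) (0≤y : 0ℚ ℚ.≤ y) (0≤e : 0ℚ ℚ.≤ e) where
  open Rational

  -- Roots are subadditive because powers are superadditive. The underscore stands for e ^ suc n.
  rootBelow-gap : x ℚ.≤ y ℚ.+ _ →
    rootBelow (suc n) k x ℚ.< rootBelow (suc n) k y ℚ.+ 1/suc k ℚ.+ e
  rootBelow-gap x≤ = ^-cancel-< {rootBelow (suc n) k x} {rootBelow (suc n) k y ℚ.+ 1/suc k ℚ.+ e} (suc n)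
    (+-nonneg {rootBelow (suc n) k y ℚ.+ 1/suc k} {e} r≥0 0≤e)
    (ℚ.≤-<-trans (rootBelow-lower n k {x} 0≤x) (ℚ.≤-<-trans x≤
      (ℚ.<-≤-trans (ℚ.+-monoˡ-< _ (rootBelow-upper n k {y} 0≤y))
        (^-superadditive {rootBelow (suc n) k y ℚ.+ 1/suc k} {e} n r≥0 0≤e))))
    where
    r≥0 : 0ℚ ℚ.≤ rootBelow (suc n) k y ℚ.+ 1/suc k
    r≥0 = +-nonneg {rootBelow (suc n) k y} {1/suc k} (rootBelow-nonneg (suc n) k y) (1/suc-nonneg k)

⊔-+ : ∀ {x y η} → 0ℚ ℚ.≤ η → x ℚ.≤ y ℚ.+ η → 0ℚ ℚ.⊔ x ℚ.≤ 0ℚ ℚ.⊔ y ℚ.+ η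
⊔-+ {x} {y} {η} 0≤η x≤ = ℚ.⊔-lub (Rational.+-nonneg {0ℚ ℚ.⊔ y} {η} (ℚ.p≤p⊔q 0ℚ y) 0≤η)
  (ℚ.≤-trans x≤ (ℚ.+-monoˡ-≤ η (ℚ.p≤q⊔p 0ℚ y)))

-- The left-hand side is p to the power n in the sense of Defs, where the operator is private.
^-recast : ∀ p n → 0ℚ ℚ.≤ p → _ ℚ.≤ p ^ℚ n
^-recast p n 0≤p = Rational.^-mono {p} {p} n 0≤p ℚ.≤-refl

rootBelow-upper-≤ : ∀ n k {x} → 0ℚ ℚ.≤ x → x ℚ.≤ (Rational.rootBelow (suc n) k x ℚ.+ Rational.1/suc k) ^ℚ suc n
rootBelow-upper-≤ n k {x} 0≤x = ℚ.≤-trans (ℚ.<⇒≤ (rootBelow-upper n k {x} 0≤x))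
  (^-recast (rootBelow (suc n) k x ℚ.+ 1/suc k) (suc n) (+-nonneg {rootBelow (suc n) k x} {1/suc k}
    (rootBelow-nonneg (suc n) k x) (1/suc-nonneg k)))
  where open Rational

-- Keeping r a variable, and not root (suc n) z, spares Agda from unfolding the search for the root.
RootOf : ℕ → ℝ → ℝ → Set
RootOf n z r = ∀ k → seq r k ≡ Rational.rootBelow (suc n) k (0ℚ ℚ.⊔ seq z k)

root-RootOf : ∀ n .{{_ : NonZero (suc n)}} z → RootOf n z (proj₁ (root (suc n) z))
root-RootOf n z k = refl

RootOf-upper : ∀ n z r → RootOf n z r → ∀ k → seq z k ℚ.≤ (seq r k ℚ.+ Rational.1/suc k) ^ℚ suc n
RootOf-upper n z r r≡ k = ℚ.≤-trans (ℚ.p≤q⊔p 0ℚ (seq z k)) (go (r≡ k))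
  where
  go : ∀ {s} → s ≡ Rational.rootBelow (suc n) k (0ℚ ℚ.⊔ seq z k) → 0ℚ ℚ.⊔ seq z k ℚ.≤ (s ℚ.+ Rational.1/suc k) ^ℚ suc n
  go refl = rootBelow-upper-≤ n k {0ℚ ℚ.⊔ seq z k} (ℚ.p≤p⊔q 0ℚ (seq z k))

-- If r stayed above s by ε, `rootBelow-gap` with e = ½ ε would be violated at an index where x ≤ y
-- + e ^ suc n and the rounding error of the root is at most ½ ε.
RootOf-mono : ∀ n x y r s → RootOf n x r → RootOf n y s → x ≤ y → r ≤ s
RootOf-mono n x y r s r≡ s≡ x≤y (ε , M , 0<ε , h) =
  at (≤⇒eventually x y x≤y (^-pos {½ ℚ.* ε} (suc n) (half-pos 0<ε))) (1/suc-≤ (½ ℚ.* ε) (half-pos 0<ε))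
  where
  open Rational
  below : ∀ k → M ℕ.≤ k → rootBelow (suc n) k (0ℚ ℚ.⊔ seq y k) ℚ.+ ε ℚ.≤ rootBelow (suc n) k (0ℚ ℚ.⊔ seq x k)
  below k M≤k = subst₂ (λ a b → a ℚ.+ ε ℚ.≤ b)
    {seq s k} {rootBelow (suc n) k (0ℚ ℚ.⊔ seq y k)} {seq r k} {rootBelow (suc n) k (0ℚ ℚ.⊔ seq x k)} (s≡ k) (r≡ k) (h k M≤k)
  above : ∀ k → 1/suc k ℚ.≤ ½ ℚ.* ε → seq x k ℚ.≤ seq y k ℚ.+ _ →
          rootBelow (suc n) k (0ℚ ℚ.⊔ seq x k) ℚ.< rootBelow (suc n) k (0ℚ ℚ.⊔ seq y k) ℚ.+ ε
  above k fine near = ℚ.<-≤-trans (rootBelow-gap n k {0ℚ ℚ.⊔ seq x k} {0ℚ ℚ.⊔ seq y k} {½ ℚ.* ε}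
      (ℚ.p≤p⊔q 0ℚ (seq x k)) (ℚ.p≤p⊔q 0ℚ (seq y k)) (ℚ.<⇒≤ (half-pos 0<ε))
      (⊔-+ {seq x k} {seq y k} (^-nonneg {½ ℚ.* ε} (suc n) (ℚ.<⇒≤ (half-pos 0<ε))) near))
    (half-step (rootBelow (suc n) k (0ℚ ℚ.⊔ seq y k)) (1/suc k) ε fine)
  at : Eventually (λ k → seq x k ℚ.≤ seq y k ℚ.+ _) → ∃[ N ] 1/suc N ℚ.≤ ½ ℚ.* ε → ⊥
  at (N , near) (N′ , fine) = ℚ.<-irrefl {rootBelow (suc n) K (0ℚ ℚ.⊔ seq x K)} refl (ℚ.<-≤-trans
      (above K (ℚ.≤-trans (1/suc-antitone {N′} {K} (ℕ.≤-trans (ℕ.m≤n⊔m N N′) (ℕ.m≤n⊔m M (N ℕ.⊔ N′)))) fine)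
        (near K (ℕ.≤-trans (ℕ.m≤m⊔n N N′) (ℕ.m≤n⊔m M (N ℕ.⊔ N′)))))
      (below K (ℕ.m≤m⊔n M (N ℕ.⊔ N′))))
    where
    K : ℕ
    K = M ℕ.⊔ (N ℕ.⊔ N′)

root-upper : ∀ n .{{_ : NonZero n}} x k →
  seq x k ℚ.≤ (seq (proj₁ (root n x)) k ℚ.+ Rational.1/suc k) ^ℚ n
root-upper (suc n) {{nz}} x = RootOf-upper n x (proj₁ (root (suc n) {{nz}} x)) (root-RootOf n {{nz}} x)

root-mono : ∀ n .{{_ : NonZero n}} x y → x ≤ y → proj₁ (root n x) ≤ proj₁ (root n y)
root-mono (suc n) {{nz}} x y = RootOf-mono n x y (proj₁ (root (suc n) {{nz}} x)) (proj₁ (root (suc n) {{nz}} y))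
  (root-RootOf n {{nz}} x) (root-RootOf n {{nz}} y)

first : ∀ m .{{_ : NonZero m}} → Fin m
first (suc m) = zero

seq-sum : ∀ {n} (f : Fin n → ℝ) k → seq (sum f) k ≡ ∑ℚ (λ j → seq (f j) k)
seq-sum {zero}  f k = refl
seq-sum {suc n} f k = cong (λ s → seq (f zero) k ℚ.+ s) (seq-sum (f ∘ suc) k)

seq-product : ∀ {n} (f : Fin n → ℝ) k → seq (product f) k ≡ ∏ℚ (λ j → seq (f j) k)
seq-product {zero}  f k = refl
seq-product {suc n} f k = cong (seq (f zero) k ℚ.*_) (seq-product (f ∘ suc) k)

seq-^ : ∀ x n k → seq (x ^ n) k ≡ seq x k ^ℚ n
seq-^ x zero    k = refl
seq-^ x (suc n) k = cong (seq x k ℚ.*_) (seq-^ x n k)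

seq-sumOver : ∀ {I : Set} (f : I → ℝ) xs k → seq (sumOver f xs) k ≡ ∑ₗℚ xs (λ a → seq (f a) k)
seq-sumOver f []       k = refl
seq-sumOver f (x ∷ xs) k = cong (λ s → seq (f x) k ℚ.+ s) (seq-sumOver f xs k)

∑ₗℚ-map : ∀ {I J : Set} (g : I → J) (f : I → ℚ) (f′ : J → ℚ) xs → (∀ x → f x ≡ f′ (g x)) → ∑ₗℚ xs f ≡ ∑ₗℚ (List.map g xs) f′
∑ₗℚ-map g f f′ []       h = refl
∑ₗℚ-map g f f′ (x ∷ xs) h = cong₂ ℚ._+_ (h x) (∑ₗℚ-map g f f′ xs h)

product-lower : ∀ {n} (a : Fin n → ℕ) (T : Fin n → ℝ) → (∀ j → 0 ℕ.< a j) → (∀ j → fromℕ (a j) ≤ T j) →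
  ∀ {η} → 0ℚ ℚ.< η → Eventually (λ k → ι (∏ a) ℚ.≤ seq (product T) k ℚ.+ η)
product-lower {zero}  a T a>0 h {η} 0<η = 0 , λ k _ → Rational.≤-by η (ℚ.<⇒≤ 0<η) refl
product-lower {suc n} a T a>0 h {η} 0<η = ev-map (λ { k (near₀ , near) → step k near₀ near })
  (ev-∧ (≤⇒eventually (fromℕ (a zero)) (T zero) (h zero) 0<θ) (product-lower (a ∘ suc) (T ∘ suc) (a>0 ∘ suc) (h ∘ suc) 0<θ))
  where
  open Rational
  a₀ = ι (a zero)
  A = ι (∏ (a ∘ suc))
  s = a₀ ℚ.+ A ℚ.+ 1ℚ
  0<s : 0ℚ ℚ.< s
  0<s = ℚ.+-mono-≤-< (+-nonneg (ι-nonneg (a zero)) (ι-nonneg (∏ (a ∘ suc)))) 0<1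
  θ′ = η ℚ.* recip s
  0<θ′ : 0ℚ ℚ.< θ′
  0<θ′ = *-pos 0<η (recip-pos 0<s)
  -- θ ≤ 1 keeps a₀ - θ and A - θ non-negative, so that the inequalities can be multiplied; θ s ≤ η
  -- bounds the error, since (a₀ - θ) (A - θ) + θ s ≥ a₀ A.
  θ = 1ℚ ℚ.⊓ θ′
  0<θ : 0ℚ ℚ.< θ
  0<θ = [ (λ eq → subst (0ℚ ℚ.<_) (sym eq) 0<1) , (λ eq → subst (0ℚ ℚ.<_) (sym eq) 0<θ′) ]′ (ℚ.⊓-sel 1ℚ θ′)
  step : ∀ k → a₀ ℚ.≤ seq (T zero) k ℚ.+ θ → A ℚ.≤ seq (product (T ∘ suc)) k ℚ.+ θ →
         ι (∏ a) ℚ.≤ seq (T zero) k ℚ.* seq (product (T ∘ suc)) k ℚ.+ η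
  step k near₀ near = begin
    ι (∏ a)                            ≡⟨ ι-* (a zero) (∏ (a ∘ suc)) ⟩
    a₀ ℚ.* A                           ≤⟨ ≤-by (θ ℚ.* θ ℚ.+ θ) (+-nonneg (*-nonneg (ℚ.<⇒≤ 0<θ) (ℚ.<⇒≤ 0<θ)) (ℚ.<⇒≤ 0<θ))
      (solve 3 (λ a A θ → (a :- θ) :* (A :- θ) :+ θ :* (a :+ A :+ con 1ℚ) := a :* A :+ (θ :* θ :+ θ)) refl a₀ A θ) ⟩
    (a₀ ℚ.- θ) ℚ.* (A ℚ.- θ) ℚ.+ θ ℚ.* s   ≤⟨ ℚ.+-mono-≤
      (*-mono {a₀ ℚ.- θ} {x} {A ℚ.- θ} {y} (minus≥0 {a zero} (a>0 zero))
        (ℚ.≤-trans (minus≥0 {∏ (a ∘ suc)} 0<A) (minus≤ {A} {y} near)) (minus≤ {a₀} {x} near₀) (minus≤ {A} {y} near))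
      (ℚ.≤-trans (*-monoʳ s (ℚ.<⇒≤ 0<s) (ℚ.p⊓q≤q 1ℚ θ′)) (ℚ.≤-reflexive θ′s≡η)) ⟩
    x ℚ.* y ℚ.+ η                      ∎
    where
    open ℚ.≤-Reasoning
    x = seq (T zero) k
    y = seq (product (T ∘ suc)) k
    0<A : 0 ℕ.< ∏ (a ∘ suc)
    0<A = Counting.∏-pos (a ∘ suc) (a>0 ∘ suc)
    minus≥0 : ∀ {c} → 0 ℕ.< c → 0ℚ ℚ.≤ ι c ℚ.- θ
    minus≥0 {c} 0<c = sub-nonneg (ℚ.≤-trans (ℚ.p⊓q≤p 1ℚ θ′) (ι-mono {1} {c} 0<c))
    minus≤ : ∀ {c x} → c ℚ.≤ x ℚ.+ θ → c ℚ.- θ ℚ.≤ x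
    minus≤ {c} {x} h = ≤-by (x ℚ.+ θ ℚ.- c) (sub-nonneg h) (solve 3 (λ c x θ → x := c :- θ :+ (x :+ θ :- c)) refl c x θ)
    θ′s≡η : θ′ ℚ.* s ≡ η
    θ′s≡η = trans (solve 3 (λ η r s → η :* r :* s := η :* (s :* r)) refl η (recip s) s)
      (trans (cong (η ℚ.*_) (recip-inverse 0<s)) (ℚ.*-identityʳ η))

-- These natural numbers replace T: the box with sides max {1, |q j| : q ∈ qs} still contains qs.
box-side : ∀ {n} → List (Vec ℤ n) → Fin n → ℕ
box-side qs j = List.foldr (λ q s → ℤ.∣ Vec.lookup q j ∣ ℕ.⊔ s) 1 qs

module _ {n} (j : Fin n) where

  box-side-pos : ∀ qs → 0 ℕ.< box-side qs j
  box-side-pos []       = ℕ.s≤s ℕ.z≤n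
  box-side-pos (q ∷ qs) = ℕ.≤-trans (box-side-pos qs) (ℕ.m≤n⊔m ℤ.∣ Vec.lookup q j ∣ _)

  ∣q∣≤box-side : ∀ {qs q} → q ∈ qs → ℤ.∣ Vec.lookup q j ∣ ℕ.≤ box-side qs j
  ∣q∣≤box-side             (here refl) = ℕ.m≤m⊔n _ _
  ∣q∣≤box-side {q′ ∷ qs} (there q∈)  = ℕ.≤-trans (∣q∣≤box-side q∈) (ℕ.m≤n⊔m ℤ.∣ Vec.lookup q′ j ∣ (box-side qs j))

  box-side≤ : ∀ (x : ℝ) → 1ℝ ≤ x → ∀ qs → (∀ {q} → q ∈ qs → fromℕ ℤ.∣ Vec.lookup q j ∣ ≤ x) → fromℕ (box-side qs j) ≤ x
  box-side≤ x 1≤x []       h = 1≤x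
  box-side≤ x 1≤x (q ∷ qs) h = [ (λ eq → subst (λ c → fromℕ c ≤ x) (sym eq) (h (here refl)))
    , (λ eq → subst (λ c → fromℕ c ≤ x) (sym eq) (box-side≤ x 1≤x qs (h ∘ there))) ]′
    (ℕ.⊔-sel ℤ.∣ Vec.lookup q j ∣ (box-side qs j))

⊝≡0 : ∀ {n} {q q′ : Vec ℤ n} → q ⊝ q′ ≡ Vec.replicate n (+ 0) → q ≡ q′
⊝≡0 {n} {q} {q′} eq = lookup-ext q q′ λ j → ℤ.i-j≡0⇒i≡j (Vec.lookup q j) (Vec.lookup q′ j)
  (trans (sym (Vec.lookup-zipWith ℤ._-_ j q q′)) (trans (cong (λ v → Vec.lookup v j) eq) (Vec.lookup-replicate j (+ 0))))

∣i-j∣≤⊔ : ∀ {x y} → + 0 ℤ.≤ x → + 0 ℤ.≤ y → ℤ.∣ x ℤ.- y ∣ ℕ.≤ ℤ.∣ x ∣ ℕ.⊔ ℤ.∣ y ∣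
∣i-j∣≤⊔ {+ a} {+ b} _ _ = subst (λ i → ℤ.∣ i ∣ ℕ.≤ a ℕ.⊔ b) (sym (ℤ.m-n≡m⊖n a b)) (ℤ.∣m⊝n∣≤m⊔n a b)

≤-termwise : ∀ (x y : ℝ) (f g : ℕ → ℚ) → (∀ k → seq x k ≡ f k) → (∀ k → seq y k ≡ g k) →
             Eventually (λ k → f k ℚ.≤ g k) → x ≤ y
≤-termwise x y f g x≡ y≡ f≤g = eventually⇒≤ x y λ {η} 0<η → ev-map (λ k f≤g →
  subst₂ (λ a b → a ℚ.≤ b ℚ.+ η) {f k} {seq x k} {g k} {seq y k} (sym (x≡ k)) (sym (y≡ k))
    (ℚ.≤-trans f≤g (Rational.≤-by η (ℚ.<⇒≤ 0<η) refl))) f≤g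

-- N ≥ 1 turns the additive error ½ into a factor 2, as N ≤ 2 (N - ½) ≤ 2 p; and T + h ≤ 2 T.
volume-≤ : ∀ n {N p T h} → 1ℚ ℚ.≤ N → N ℚ.≤ p ℚ.+ ½ → p ℚ.≤ (T ℚ.+ h) ^ℚ n → 0ℚ ℚ.≤ h → h ℚ.≤ 1ℚ → 1ℚ ℚ.≤ T →
           N ℚ.≤ ι (2 ℕ.^ suc n) ℚ.* T ^ℚ n
volume-≤ n {N} {p} {T} {h} 1≤N N≤ p≤ 0≤h h≤1 1≤T = begin
  N                                    ≤⟨ ≤-by (N ℚ.- 1ℚ) (sub-nonneg 1≤N)
    (solve 1 (λ N → con (ι 2) :* (N :- con ½) := N :+ (N :- con 1ℚ)) refl N) ⟩
  ι 2 ℚ.* (N ℚ.- ½)                    ≤⟨ *-monoˡ {N ℚ.- ½} {p} (ι 2) (ι-nonneg 2) (≤-by (p ℚ.+ ½ ℚ.- N) (sub-nonneg N≤)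
    (solve 2 (λ N p → p := N :- con ½ :+ (p :+ con ½ :- N)) refl N p)) ⟩
  ι 2 ℚ.* p                            ≤⟨ *-monoˡ {p} {(T ℚ.+ h) ^ℚ n} (ι 2) (ι-nonneg 2) p≤ ⟩
  ι 2 ℚ.* (T ℚ.+ h) ^ℚ n               ≤⟨ *-monoˡ {(T ℚ.+ h) ^ℚ n} {(ι 2 ℚ.* T) ^ℚ n} (ι 2) (ι-nonneg 2)
    (^-mono {T ℚ.+ h} {ι 2 ℚ.* T} n (+-nonneg (ℚ.≤-trans 0≤1 1≤T) 0≤h) (ℚ.≤-trans (ℚ.+-monoʳ-≤ T (ℚ.≤-trans h≤1 1≤T))
      (ℚ.≤-reflexive (solve 1 (λ T → T :+ T := con (ι 2) :* T) refl T)))) ⟩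
  ι 2 ℚ.* (ι 2 ℚ.* T) ^ℚ n             ≡⟨ cong (ι 2 ℚ.*_) (trans (^-*-distrib n (ι 2) T) (cong (ℚ._* T ^ℚ n) (sym (ι-^ 2 n)))) ⟩
  ι 2 ℚ.* (ι (2 ℕ.^ n) ℚ.* T ^ℚ n)     ≡⟨ trans (sym (ℚ.*-assoc (ι 2) (ι (2 ℕ.^ n)) (T ^ℚ n))) (cong (ℚ._* T ^ℚ n) (sym (ι-* 2 (2 ℕ.^ n)))) ⟩
  ι (2 ℕ.^ suc n) ℚ.* T ^ℚ n           ∎
  where
  open ℚ.≤-Reasoning
  open Rational

-- From rational approximations to the real matrix

module Main (m n : ℕ) .{{_ : NonZero m}} .{{_ : NonZero n}} (φ : NonIncreasing) (L : Matrix m n) (bad : MultBadlyApproximable φ L)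
  (T : Fin n → ℝ) (1≤T : ∀ j → 1ℝ ≤ T j) (2≤T̄ : 2ℝ ≤ proj₁ (geometricMean T))
  (qs : List (ℤⁿ∖0 n)) (enumerates : Enumerates T qs) where

  open Enumerates enumerates
  open Rational using
    (half-pos; ≤-by; 0≤½; recip; logApprox; sub-nonneg; 1/suc-nonneg; 1/suc-antitone; +-nonneg; *-nonneg)

  private
    ps = List.map proj₁ qs
    t = box-side ps
    x : ℕ → Fin m → Fin n → ℚ
    x k i j = seq (L i j) k
    Tₖ φₖ : ℕ → ℚ
    Tₖ k = seq (proj₁ (geometricMean T)) k
    φₖ k = seq (fun φ (geometricMean T)) k

  in-box : ∀ {q} → q ∈ ps → InBox T q
  in-box q∈ with ∈.∈-map⁻ proj₁ q∈
  ... | q , q∈qs , refl = All.lookup sound q∈qs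

  t≤T : ∀ j → fromℕ (t j) ≤ T j
  t≤T j = box-side≤ j (T j) (1≤T j) ps λ {q} q∈ →
    subst (λ z → fromℤ z ≤ T j) (sym (ℤ.0≤i⇒+∣i∣≡i (proj₁ (in-box q∈ j)))) (proj₂ (in-box q∈ j))

  0<t : ∀ j → 0 ℕ.< t j
  0<t j = box-side-pos j ps

  seq-∏⁺ : ∀ (v : Vec ℤ n) k → seq (∏⁺ v) k ≡ ι (∏ (abs⁺ v))
  seq-∏⁺ v k = trans (seq-product (λ j → Vec.lookup v j ⁺) k) (sym (ι-∏ (abs⁺ v)))

  seq-∥row∥ : ∀ i q k → seq ∥ row L i q ∥ k ≡ Rational.∥ rowℚ (x k i) q ∥
  seq-∥row∥ i q k = cong Rational.∥_∥ (seq-sum (λ j → L i j * fromℤ (Vec.lookup q j)) k)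

  ε : ℚ
  ε = proj₁ (positive φ (geometricMean T))

  0<ε : 0ℚ ℚ.< ε
  0<ε = proj₁ (proj₂ (proj₂ (positive φ (geometricMean T))))

  φ≥ε : Eventually (λ k → ε ℚ.≤ φₖ k)
  φ≥ε = proj₁ (proj₂ (positive φ (geometricMean T))) , λ k h → ℚ.≤-trans (ℚ.≤-reflexive (sym (ℚ.+-identityˡ ε))) (proj₂ (proj₂ (proj₂ (positive φ (geometricMean T)))) k h)

  Bad : Vec ℤ n → ℕ → Set
  Bad v k = ½ ℚ.* φₖ k ℚ.≤ ι (∏ (abs⁺ v)) ℚ.* ∏ℚ (λ i → Rational.∥ rowℚ (x k i) v ∥)

  -- |v j| ≤ t j gives ∏⁺ v ≤ ∏ T, so the monotonicity of φ replaces its value at the mean of v by φ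
  -- (T̄). The two comparisons cost ε / 4 each, in all at most half of φₖ ≥ ε.
  eventually-bad : ∀ v → v ≢ Vec.replicate n (+ 0) → (∀ j → ℤ.∣ Vec.lookup v j ∣ ℕ.≤ t j) → Eventually (Bad v)
  eventually-bad v v≢0 v≤t = ev-map (λ { k (large , (mono , lower)) → step k large mono lower })
    (ev-∧ φ≥ε (ev-∧ (≤⇒eventually (fun φ (geometricMean T)) (fun φ (root n (∏⁺ v))) (antitone φ (root n (∏⁺ v)) (geometricMean T) root≤) (half-pos (half-pos 0<ε)))
      (≤⇒eventually (fun φ (root n (∏⁺ v))) (∏⁺ v * product (λ i → ∥ row L i v ∥)) (bad (v , v≢0)) (half-pos (half-pos 0<ε)))))
    where
    open ℚ.≤-Reasoning
    ∏⁺≤ : ∏⁺ v ≤ product T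
    ∏⁺≤ = eventually⇒≤ (∏⁺ v) (product T) λ {η} 0<η → ev-map (λ k h → ℚ.≤-trans (ℚ.≤-trans (ℚ.≤-reflexive (seq-∏⁺ v k))
      (ι-mono (∏-mono {f = abs⁺ v} {t} λ j → ℕ.⊔-lub (0<t j) (v≤t j)))) h) (product-lower t T 0<t t≤T 0<η)
    root≤ : proj₁ (root n (∏⁺ v)) ≤ proj₁ (geometricMean T)
    root≤ = root-mono n (∏⁺ v) (product T) ∏⁺≤
    step : ∀ k → ε ℚ.≤ φₖ k → φₖ k ℚ.≤ seq (fun φ (root n (∏⁺ v))) k ℚ.+ ½ ℚ.* (½ ℚ.* ε) →
      seq (fun φ (root n (∏⁺ v))) k ℚ.≤ seq (∏⁺ v * product (λ i → ∥ row L i v ∥)) k ℚ.+ ½ ℚ.* (½ ℚ.* ε) → Bad v k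
    step k large mono lower = begin
      ½ ℚ.* φₖ k                          ≤⟨ ≤-by (½ ℚ.* (φₖ k ℚ.- ε)) (*-nonneg 0≤½ (sub-nonneg large))
        (solve 2 (λ φ ε → φ :- con ½ :* ε := con ½ :* φ :+ con ½ :* (φ :- ε)) refl (φₖ k) ε) ⟩
      φₖ k ℚ.- ½ ℚ.* ε                    ≤⟨ ℚ.+-monoˡ-≤ (ℚ.- (½ ℚ.* ε)) (ℚ.≤-trans mono (ℚ.+-monoˡ-≤ (½ ℚ.* (½ ℚ.* ε)) lower)) ⟩
      P ℚ.+ ½ ℚ.* (½ ℚ.* ε) ℚ.+ ½ ℚ.* (½ ℚ.* ε) ℚ.- ½ ℚ.* ε
        ≡⟨ solve 2 (λ p ε → p :+ con ½ :* (con ½ :* ε) :+ con ½ :* (con ½ :* ε) :- con ½ :* ε := p) refl P ε ⟩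
      P                                   ≡⟨ cong₂ ℚ._*_ (seq-∏⁺ v k) (trans (seq-product (λ i → ∥ row L i v ∥) k) (∏ℚ-cong λ i → seq-∥row∥ i v k)) ⟩
      ι (∏ (abs⁺ v)) ℚ.* ∏ℚ (λ i → Rational.∥ rowℚ (x k i) v ∥) ∎
      where P = seq (∏⁺ v * product (λ i → ∥ row L i v ∥)) k

  all-bad : Eventually (λ k → All (λ q → Bad q k) ps)
  all-bad = ev-All (All.tabulate λ {q} q∈ → eventually-bad q (nonzero q∈) (λ j → ∣q∣≤box-side j q∈))
    where
    nonzero : ∀ {q} → q ∈ ps → q ≢ Vec.replicate n (+ 0)
    nonzero q∈ with ∈.∈-map⁻ proj₁ q∈
    ... | (q , q≢0) , _ , refl = q≢0

  -- The entries of q and q′ lie between 0 and t j, hence |q j - q′ j| ≤ t j, and differences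
  -- satisfy the same bound with φ (T̄) as the points themselves.
  pairs-bad : Eventually (λ k → AllPairs (λ q q′ → Bad (q ⊝ q′) k) ps)
  pairs-bad = ev-AllPairs (pairs ps unique id)
    where
    pairs : ∀ rs → Unique rs → (∀ {q} → q ∈ rs → q ∈ ps) → AllPairs (λ q q′ → Eventually (Bad (q ⊝ q′))) rs
    pairs []       []           rs⊆ = []
    pairs (q ∷ rs) (q∉rs ∷ rs!) rs⊆ = All.tabulate (λ {q′} q′∈ → eventually-bad (q ⊝ q′) (λ eq → All.lookup q∉rs q′∈ (⊝≡0 eq))
      λ j → let q∈ps = rs⊆ (here refl) ; q′∈ps = rs⊆ (there q′∈) in
        ℕ.≤-trans (ℕ.≤-reflexive (cong ℤ.∣_∣ (Vec.lookup-zipWith ℤ._-_ j q q′)))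
          (ℕ.≤-trans (∣i-j∣≤⊔ {Vec.lookup q j} {Vec.lookup q′ j} (proj₁ (in-box q∈ps j)) (proj₁ (in-box q′∈ps j)))
            (ℕ.⊔-lub (∣q∣≤box-side j q∈ps) (∣q∣≤box-side j q′∈ps))))
      ∷ pairs rs rs! (rs⊆ ∘ there)

  φ-upper : Eventually (λ k → φₖ k ℚ.≤ 1ℚ ℚ.+ ½ ℚ.* ½ ℚ.* ½)
  φ-upper = ≤⇒eventually (fun φ (geometricMean T)) 1ℝ (≤1 φ (geometricMean T)) (half-pos (half-pos (half-pos Rational.0<1)))

  T-lower : Eventually (λ k → 1ℚ ℚ.+ ½ ℚ.+ ½ ℚ.* ½ ℚ.≤ Tₖ k)
  T-lower = ev-map (λ k h → ≤-by (Tₖ k ℚ.+ ½ ℚ.* ½ ℚ.- ι 2) (sub-nonneg h)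
      (solve 1 (λ T → T := con (1ℚ ℚ.+ ½ ℚ.+ ½ ℚ.* ½) :+ (T :+ con (½ ℚ.* ½) :- con (ι 2))) refl (Tₖ k)))
    (≤⇒eventually 2ℝ (proj₁ (geometricMean T)) 2≤T̄ (half-pos (half-pos Rational.0<1)))

  N-upper : Eventually (λ k → ι (∏ t) ℚ.≤ ι (2 ℕ.^ suc n) ℚ.* Tₖ k ^ℚ n)
  N-upper = ev-map (λ { k (T≥ , near) → step k T≥ near }) (ev-∧ T-lower (product-lower t T 0<t t≤T (half-pos Rational.0<1)))
    where
    step : ∀ k → 1ℚ ℚ.+ ½ ℚ.+ ½ ℚ.* ½ ℚ.≤ Tₖ k → ι (∏ t) ℚ.≤ seq (product T) k ℚ.+ ½ → ι (∏ t) ℚ.≤ ι (2 ℕ.^ suc n) ℚ.* Tₖ k ^ℚ n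
    step k T≥ near = volume-≤ n {ι (∏ t)} {seq (product T) k} {Tₖ k} {Rational.1/suc k} (ι-mono {1} (Counting.∏-pos t 0<t)) near
      (root-upper n (product T) k) (1/suc-nonneg k) (1/suc-antitone {0} {k} ℕ.z≤n)
      (ℚ.≤-trans (≤-by (½ ℚ.+ ½ ℚ.* ½) (+-nonneg 0≤½ (*-nonneg 0≤½ 0≤½)) refl) T≥)

  -- A Cauchy sequence is bounded, so the index outgrows it. This gives the k-th term of `log⁺`
  -- enough terms of the series for `logApprox-lower`.
  X-upper : Eventually (λ k → Tₖ k ℚ.* recip (φₖ k) ℚ.≤ ι k)
  X-upper = go (Rational.Cauchy-bounded {seq X} (cauchy X))
    where
    X = proj₁ (geometricMean T) /[ φ ] geometricMean T
    go : ∃[ B ] ∃[ N ] (0ℚ ℚ.< B × (∀ k → N ℕ.≤ k → ℚ.∣ seq X k ∣ ℚ.≤ B)) → Eventually (λ k → Tₖ k ℚ.* recip (φₖ k) ℚ.≤ ι k)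
    go (B , N , 0<B , X≤B) = let y , _ , B< = natural-floor (ℚ.<⇒≤ 0<B) in N ℕ.⊔ suc y , λ k h →
      ℚ.≤-trans (Rational.p≤∣p∣ (seq X k)) (ℚ.≤-trans (X≤B k (ℕ.m⊔n≤o⇒m≤o N (suc y) h))
        (ℚ.≤-trans (ℚ.<⇒≤ B<) (ι-mono (ℕ.m⊔n≤o⇒n≤o N (suc y) h))))

  rhsₖ : ℕ → ℚ
  rhsₖ k = ι (final-constant n m) ℚ.* (Tₖ k ^ℚ n ℚ.* ℓ ^ℚ m ℚ.+ Tₖ k ^ℚ n ℚ.* recip (φₖ k) ℚ.* ℓ ^ℚ (m ∸ 1))
    where ℓ = logApprox k (Tₖ k ℚ.* recip (φₖ k))

  lhsₖ : ℕ → ℚ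
  lhsₖ k = ∑ₗℚ ps (λ q → ∏ℚ (λ i → recip (Rational.∥ rowℚ (x k i) q ∥)))

  lhs≡ : ∀ k → seq (sumOver (term φ L bad) qs) k ≡ lhsₖ k
  lhs≡ k = trans (seq-sumOver (term φ L bad) qs k) (∑ₗℚ-map proj₁ _ (λ q → ∏ℚ (λ i → recip (Rational.∥ rowℚ (x k i) q ∥))) qs λ q →
    trans (seq-product (λ i → reciprocal ∥ row L i (proj₁ q) ∥ (∥row∥-pos φ L bad q i)) k)
      (∏ℚ-cong λ i → cong recip (seq-∥row∥ i (proj₁ q) k)))

  rhs≡ : ∀ k → seq (fromℕ (final-constant n m) * (proj₁ (geometricMean T) ^ n * log⁺ (proj₁ (geometricMean T) /[ φ ] geometricMean T) ^ m
          + proj₁ (geometricMean T) ^ n /[ φ ] geometricMean T * log⁺ (proj₁ (geometricMean T) /[ φ ] geometricMean T) ^ (m ∸ 1))) k ≡ rhsₖ k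
  rhs≡ k = cong (ι (final-constant n m) ℚ.*_) (cong₂ ℚ._+_
    (cong₂ ℚ._*_ (seq-^ (proj₁ (geometricMean T)) n k) (seq-^ ℓ m k))
    (cong₂ ℚ._*_ (cong (ℚ._* recip (φₖ k)) (seq-^ (proj₁ (geometricMean T)) n k)) (seq-^ ℓ (m ∸ 1) k)))
    where ℓ = log⁺ (proj₁ (geometricMean T) /[ φ ] geometricMean T)

  lhs≤rhs : Eventually (λ k → lhsₖ k ℚ.≤ rhsₖ k)
  lhs≤rhs = ev-map (λ { k (ε≤ , φ≤ , T≥ , N≤ , X≤ , bad₁ , bad₂) →
      rational-theorem {n} {n ∸ 1} {m} {m ∸ 1} {k} {Tₖ k} {φₖ k}
          (sym (ℕ.suc-pred n)) (sym (ℕ.suc-pred m)) (first m) (x k) t 0<t (ℚ.<-≤-trans 0<ε ε≤) φ≤ T≥ N≤ X≤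
          ps unique (λ {q} q∈ j → proj₁ (in-box q∈ j) , ∣q∣≤box-side j q∈) (All.lookup bad₁) bad₂ })
    (ev-∧ φ≥ε (ev-∧ φ-upper (ev-∧ T-lower (ev-∧ N-upper (ev-∧ X-upper (ev-∧ all-bad pairs-bad))))))

  theorem : sumOver (term φ L bad) qs ≤ fromℕ (final-constant n m) * (proj₁ (geometricMean T) ^ n * log⁺ (proj₁ (geometricMean T) /[ φ ] geometricMean T) ^ m
          + proj₁ (geometricMean T) ^ n /[ φ ] geometricMean T * log⁺ (proj₁ (geometricMean T) /[ φ ] geometricMean T) ^ (m ∸ 1))
  theorem = ≤-termwise (sumOver (term φ L bad) qs)
    (fromℕ (final-constant n m) * (proj₁ (geometricMean T) ^ n * log⁺ (proj₁ (geometricMean T) /[ φ ] geometricMean T) ^ m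
          + proj₁ (geometricMean T) ^ n /[ φ ] geometricMean T * log⁺ (proj₁ (geometricMean T) /[ φ ] geometricMean T) ^ (m ∸ 1)))
    lhsₖ rhsₖ lhs≡ rhs≡ lhs≤rhs

mainTheorem3 : ∀ (m n : ℕ) .{{_ : NonZero m}} .{{_ : NonZero n}} →
    ∃[ C ] (∀ (φ : NonIncreasing) (L : Matrix m n) (bad : MultBadlyApproximable φ L)
              (T : Fin n → ℝ) → (∀ j → 1ℝ ≤ T j) → 2ℝ ≤ proj₁ (geometricMean T) →
              (qs : List (ℤⁿ∖0 n)) → Enumerates T qs →
              let T̄  = geometricMean T
                  T̄ⁿ = proj₁ T̄ ^ n
                  ℓ  = log⁺ (proj₁ T̄ /[ φ ] T̄)
              in sumOver (term φ L bad) qs ≤ C * (T̄ⁿ * ℓ ^ m + T̄ⁿ /[ φ ] T̄ * ℓ ^ (m ∸ 1)))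
mainTheorem3 m n {{nonZero-m}} {{nonZero-n}} = fromℕ (final-constant n m) , λ φ L bad T 1≤T 2≤T̄ qs enumerates →
  Main.theorem m n {{nonZero-m}} {{nonZero-n}} φ L bad T 1≤T 2≤T̄ qs enumerates
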